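{- Let $\mathbb{F}=\mathbb{Z}_3$ and $\beta^{m,n}_d=\dim_{\mathbb{Z}_3}\tilde{H}_d(\mathsf{M}_{m,n};\mathbb{Z}_3)$. Suppose $m\le n\le 2m-5$, $m+n\equiv 1\pmod 3$, $(m,n)\neq(5,5)$, and $d=\nu_{m,n}$. Then \[ \beta^{m,n}_d= \beta^{m-1,n-2}_{d-1}+(n-2)\beta^{m-1,n-1}_{d-1}+2\binom{m-1}{2}\beta^{m-3,n-2}_{d-2}, \] i.e. the inequality $\beta^{m,n}_d\le \beta^{m-1,n-2}_{d-1}+(n-2)\beta^{m-1,n-1}_{d-1}+2\binom{m-1}{2}\beta^{m-3,n-2}_{d-2}$ (valid for $m\ge3$, $n\ge2$) is sharp.
   Context: $\mathsf{M}_{m,n}$ denotes the chessboard complex: the simplicial complex whose faces are the matchings in the complete bipartite graph $K_{m,n}$ (defined for all $m,n\ge0$, with $\mathsf{M}_{m,n}\cong\mathsf{M}_{n,m}$). For $1\le m\le n$, $\nu_{m,n}=\min\{m-1,\lceil\frac{m+n-4}{3}\rceil\}$. $\tilde H$ denotes reduced simplicial homology. -}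

module Defs where

open import Data.Nat using (ℕ; zero; suc; _+_; _*_; _∸_; _<_; _⊓_; _/_)
open import Data.Nat.DivMod using (_mod_)
open import Data.Fin using (Fin; toℕ) renaming (zero to fz; suc to fs)
open import Data.Vec using (Vec; lookup; insertAt)
open import Data.Product using (Σ; _×_; _,_; proj₁; proj₂)
open import Data.Sum using (_⊎_)
open import Relation.Binary.PropositionalEquality using (_≡_; _≢_)
open import Relation.Nullary using (¬_)

F3 : Set
F3 = Fin 3

0F : F3
0F = fz

_+F_ : F3 → F3 → F3
a +F b = (toℕ a + toℕ b) mod 3

_*F_ : F3 → F3 → F3
a *F b = (toℕ a * toℕ b) mod 3

-F_ : F3 → F3
-F a = (3 ∸ toℕ a) mod 3

ΣF : (k : ℕ) → (Fin k → F3) → F3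
ΣF zero    f = 0F
ΣF (suc k) f = f fz +F ΣF k (λ i → f (fs i))

sgn : {k : ℕ} → Fin k → F3 → F3
sgn fz     x = x
sgn (fs p) x = -F (sgn p x)

-- Vertices of the chessboard complex M_{m,n}: edges (i,j) of K_{m,n}.
V : ℕ → ℕ → Set
V m n = Fin m × Fin n

-- strict lexicographic order on vertices (used to orient simplices)
_<V_ : {m n : ℕ} → V m n → V m n → Set
(i , j) <V (i' , j') = (toℕ i < toℕ i') ⊎ ((i ≡ i') × (toℕ j < toℕ j'))

-- A vector of k vertices is an (oriented, sorted) (k-1)-face of M_{m,n}:
-- strictly increasing in lex order, and a matching (distinct rows, distinct columns).
-- k = 0 is the empty face (giving reduced homology).
IsFace : {m n k : ℕ} → Vec (V m n) k → Set
IsFace {k = k} σ = (p q : Fin k) → toℕ p < toℕ q →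
  (lookup σ p <V lookup σ q)
  × (proj₁ (lookup σ p) ≢ proj₁ (lookup σ q))
  × (proj₂ (lookup σ p) ≢ proj₂ (lookup σ q))

-- Z_3-valued functions on k-vertex sequences; a chain of dimension k-1
-- is such a function vanishing off the faces.
Cochain : ℕ → ℕ → ℕ → Set
Cochain m n k = Vec (V m n) k → F3

IsChain : {m n k : ℕ} → Cochain m n k → Set
IsChain c = ∀ σ → ¬ IsFace σ → c σ ≡ 0F

-- Boundary map (reduced; for k = 0 it is the augmentation).
-- Coefficient of σ in ∂c is Σ_{pos,v} (-1)^pos c(σ with v inserted at pos).
∂ : {m n k : ℕ} → Cochain m n (suc k) → Cochain m n k
∂ {m} {n} {k} c σ =
  ΣF (suc k) (λ pos → sgn pos (ΣF m (λ i → ΣF n (λ j → c (insertAt σ pos (i , j))))))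

_≐_ : {m n k : ℕ} → Cochain m n k → Cochain m n k → Set
c ≐ c' = ∀ σ → c σ ≡ c' σ

zeroC : {m n k : ℕ} → Cochain m n k
zeroC σ = 0F

_+C_ : {m n k : ℕ} → Cochain m n k → Cochain m n k → Cochain m n k
(c +C c') σ = c σ +F c' σ

lin : {m n k b : ℕ} → (Fin b → F3) → (Fin b → Cochain m n k) → Cochain m n k
lin {b = b} a z σ = ΣF b (λ i → a i *F z i σ)

-- IsBetti m n d b : dim_{Z_3} H̃_d(M_{m,n}; Z_3) = b, i.e. there are b cycles
-- whose homology classes form a basis of H̃_d = ker ∂_d / im ∂_{d+1}.
-- (d-chains live on sequences of d+1 vertices.)
IsBetti : ℕ → ℕ → ℕ → ℕ → Set
IsBetti m n d b =
  Σ (Fin b → Cochain m n (suc d)) λ z →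
    ((i : Fin b) → IsChain (z i))
  × ((i : Fin b) → ∂ (z i) ≐ zeroC)
  × ((a : Fin b → F3) (w : Cochain m n (suc (suc d))) → IsChain w →
       lin a z ≐ ∂ w → (i : Fin b) → a i ≡ 0F)
  × ((c : Cochain m n (suc d)) → IsChain c → ∂ c ≐ zeroC →
       Σ (Fin b → F3) λ a → Σ (Cochain m n (suc (suc d))) λ w →
         IsChain w × (c ≐ (lin a z +C ∂ w)))

-- ν_{m,n} = min{m-1, ⌈(m+n-4)/3⌉}
ν : ℕ → ℕ → ℕ
ν m n = (m ∸ 1) ⊓ ((m + n ∸ 4 + 2) / 3)

{-# OPTIONS --safe #-}
module Submission where

-- Write m + n = 3d + 4. The complexes M_{m-1,n-1} and M_{m-3,n-2} are F₃-acyclic in degrees d - 1 and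
-- d - 2, so b₂ = b₃ = 0, and it remains to see that y ↦ (r c₁ - r c₂) ∧ y, for a row r and two columns
-- c₁, c₂, is an isomorphism H_{d-1}(M_{m-1,n-2}) → H_d(M_{m,n}).
--
-- Surjectivity: a cycle can be pushed off all edges of r and off all pairs of edges that use both c₁ and
-- c₂, since the links in question are acyclic; what is left lies in the suspension of M_{m-1,n-2} formed by
-- the cones over r c₁ and r c₂. The same argument, with Mayer–Vietoris for the two columns, gives the
-- acyclicity by induction.
--
-- Injectivity: by surjectivity with rows and columns exchanged, every class of H_{d-1}(M_{m-1,n-2}) is a
-- combination of differences b c - e c of edges, hence is negated by the transposition of the rows b and e.
-- Let ∂ w = (r c₁ - r c₂) ∧ y, and let w_j be the coefficient of r j in w. Up to boundaries, y is a
-- sum over the columns j ≠ c₁ of terms that depend on the cycle w_j only, plus the part of w off r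
-- that uses both columns. The antisymmetry trades that part for terms in the w_j, because 2 = -1 in F₃, and
-- then the contribution of each w_j is a boundary.

open import Defs
open import Algebra.Bundles using (CommutativeRing)
open import Algebra.Solver.Ring.AlmostCommutativeRing
  using (AlmostCommutativeRing; fromCommutativeRing; _-Raw-AlmostCommutative⟶_)
import Algebra.Solver.Ring.Simple as RingSolver
open import Data.Fin using (Fin; toℕ; fromℕ<; punchIn; combine; finToFun; funToFin)
  renaming (zero to fz; suc to fs)
import Data.Fin.Permutation.Components as PC
open import Data.Fin.Permutation using (Permutation′; _⟨$⟩ʳ_; transpose)
open import Data.Fin.Properties
  using (all?; any?; suc-injective; injective⇒≤; punchInᵢ≢i; toℕ-injective; toℕ-fromℕ<; funToFin-finToFin; finToFun-funToFin)
  renaming (_≟_ to _≟F_)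
open import Data.List using (List; []; _∷_; _++_; length; map)
import Data.List as List
open import Data.List.Membership.Propositional using (_∈_; _∉_)
import Data.List.Membership.DecPropositional as DecMembership
open import Data.List.Properties using (map-++; length-map)
open import Data.List.Relation.Unary.Any using (here; there; index)
open import Data.List.Relation.Unary.Any.Properties using (lookup-index)
open import Data.Maybe using (Maybe; just; nothing; maybe; zip)
import Data.Maybe as Maybe
open import Data.Maybe.Properties using (just-injective)
open import Data.Nat as ℕ
  using (ℕ; zero; suc; pred; _+_; _*_; _∸_; _^_; _≤_; _<_; _≤?_; _<?_; s≤s; z≤n; _%_; _/_; _⊓_)
open import Data.Nat.Combinatorics using (_C_)
open import Data.Nat.Divisibility using (divides)
open import Data.Nat.DivMod using (m≡m%n+[m/n]*n; +-distrib-/-∣ʳ; m*n/n≡m)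
open import Data.Nat.Properties
  using ( ≤-trans; ≤-reflexive; ≤-antisym; ≤-pred; ≰⇒>; <⇒≱; <⇒≤; ≮⇒≥; <-cmp; <-irrefl; <-asym; n≤1+n; m≤n+m; m≤m+n
        ; +-comm; +-suc; +-identityʳ; +-mono-≤; +-monoʳ-≤; +-cancelˡ-≤; +-cancelʳ-≡; *-zeroʳ; *-cancelˡ-≤; ^-monoʳ-<
        ; ∸-monoˡ-≤; m≥n⇒m⊓n≡n)
open import Data.Nat.Tactic.RingSolver using (solve-∀)
open import Data.Product using (Σ; ∃; ∃₂; _×_; _,_; proj₁; proj₂)
open import Data.Product.Properties using () renaming (≡-dec to ×-≡-dec)
open import Data.Sum using (_⊎_; inj₁; inj₂; [_,_]′)
import Data.Sum as Sum
open import Data.Vec using (Vec; []; _∷_; lookup; insertAt)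
open import Data.Vec.Properties using (insertAt-lookup; insertAt-punchIn)
open import Function using (_∘_; id)
open import Level using (0ℓ)
open import Relation.Binary using (Setoid)
open import Relation.Binary.Consequences using (dec⇒weaklyDec)
open import Relation.Binary.Definitions using (DecidableEquality; tri<; tri≈; tri>)
open import Relation.Binary.PropositionalEquality hiding (resp)
open import Relation.Nullary using (¬_; Dec; yes; no; does; contradiction)
open import Relation.Nullary.Decidable
  using (dec-true; dec-false; decidable-stable; from-yes; ¬?; _×-dec_; _→-dec_)
open import Data.Bool using (true; false; if_then_else_)
open AlmostCommutativeRing using (rawRing)

-- Everything rests on one numerical budget: a board with `m` rows and `n` columns is exact in
-- degree `s` when `s ≤ m`, `s ≤ n` and `3s ≤ m + n + 1`. In the critical degree `d + 2` the last
-- inequality fails by one for the full board, while the links and subboards used for both halves of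
-- the isomorphism satisfy it with equality. The other two inequalities are where the hypotheses
-- enter: surjectivity deletes three rows in degree `d` and the antisymmetry deletes five columns in
-- degree `d - 1`, which needs `d + 3 ≤ m` and `d + 4 ≤ n`. The first is `n ≤ 2m - 5`; the second
-- holds throughout the region except at `(5,5)`, where `d = 2`. Chains are alternating functions on
-- all words in the vertices of one fixed board, and a deleted row or column is a vanishing
-- condition. Links, cones and subboards then share a type, and contraction and exterior
-- multiplication are total operators subject to a few identities. The sorted chains of the
-- statement enter only through a chain isomorphism at the end.

pattern 1F = fs fz
pattern 2F = fs (fs fz)


-- Arithmetic and finite sums in F₃

+F-assoc : ∀ a b c → (a +F b) +F c ≡ a +F (b +F c)
+F-assoc = from-yes (all? λ a → all? λ b → all? λ c → (a +F b) +F c ≟F a +F (b +F c))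

+F-comm : ∀ a b → a +F b ≡ b +F a
+F-comm = from-yes (all? λ a → all? λ b → a +F b ≟F b +F a)

+F-identityˡ : ∀ a → 0F +F a ≡ a
+F-identityˡ = from-yes (all? λ a → 0F +F a ≟F a)

+F-identityʳ : ∀ a → a +F 0F ≡ a
+F-identityʳ = from-yes (all? λ a → a +F 0F ≟F a)

-F-inverseˡ : ∀ a → (-F a) +F a ≡ 0F
-F-inverseˡ = from-yes (all? λ a → (-F a) +F a ≟F 0F)

-F-inverseʳ : ∀ a → a +F (-F a) ≡ 0F
-F-inverseʳ = from-yes (all? λ a → a +F (-F a) ≟F 0F)

*F-assoc : ∀ a b c → (a *F b) *F c ≡ a *F (b *F c)
*F-assoc = from-yes (all? λ a → all? λ b → all? λ c → (a *F b) *F c ≟F a *F (b *F c))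

*F-comm : ∀ a b → a *F b ≡ b *F a
*F-comm = from-yes (all? λ a → all? λ b → a *F b ≟F b *F a)

*F-identityˡ : ∀ a → 1F *F a ≡ a
*F-identityˡ = from-yes (all? λ a → 1F *F a ≟F a)

*F-identityʳ : ∀ a → a *F 1F ≡ a
*F-identityʳ = from-yes (all? λ a → a *F 1F ≟F a)

*F-distribˡ-+F : ∀ a b c → a *F (b +F c) ≡ (a *F b) +F (a *F c)
*F-distribˡ-+F = from-yes (all? λ a → all? λ b → all? λ c → a *F (b +F c) ≟F (a *F b) +F (a *F c))

*F-distribʳ-+F : ∀ a b c → (b +F c) *F a ≡ (b *F a) +F (c *F a)
*F-distribʳ-+F = from-yes (all? λ a → all? λ b → all? λ c → (b +F c) *F a ≟F (b *F a) +F (c *F a))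

F3-commutativeRing : CommutativeRing 0ℓ 0ℓ
F3-commutativeRing = record
  { Carrier = F3
  ; _≈_ = _≡_
  ; _+_ = _+F_
  ; _*_ = _*F_
  ; -_ = -F_
  ; 0# = 0F
  ; 1# = 1F
  ; isCommutativeRing = record
    { isRing = record
      { +-isAbelianGroup = record
        { isGroup = record
          { isMonoid = record
            { isSemigroup = record
              { isMagma = isMagma _+F_
              ; assoc = +F-assoc
              }
            ; identity = +F-identityˡ , +F-identityʳ
            }
          ; inverse = -F-inverseˡ , -F-inverseʳ
          ; ⁻¹-cong = cong -F_
          }
        ; comm = +F-comm
        }
      ; *-cong = cong₂ _*F_
      ; *-assoc = *F-assoc
      ; *-identity = *F-identityˡ , *F-identityʳ
      ; distrib = *F-distribˡ-+F , *F-distribʳ-+F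
      }
    ; *-comm = *F-comm
    }
  }

open RingSolver (fromCommutativeRing F3-commutativeRing) _≟F_
  using (solve; _:=_; _:+_; :-_; _:*_; con) public

open CommutativeRing F3-commutativeRing using (+-commutativeMonoid)
open import Algebra.Properties.CommutativeMonoid.Sum +-commutativeMonoid
  using (∑-distrib-+; ∑-comm; sum-permute; sum-replicate-zero) renaming (sum to sumᵛ)

ΣF≡sum : ∀ k (f : Fin k → F3) → ΣF k f ≡ sumᵛ f
ΣF≡sum zero    f = refl
ΣF≡sum (suc k) f = cong (f fz +F_) (ΣF≡sum k (f ∘ fs))

ΣF-cong : ∀ k {f g : Fin k → F3} → (∀ i → f i ≡ g i) → ΣF k f ≡ ΣF k g
ΣF-cong zero    eq = refl
ΣF-cong (suc k) eq = cong₂ _+F_ (eq fz) (ΣF-cong k (eq ∘ fs))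

ΣF-zero : ∀ k {f : Fin k → F3} → (∀ i → f i ≡ 0F) → ΣF k f ≡ 0F
ΣF-zero k eq = trans (ΣF-cong k eq) (trans (ΣF≡sum k _) (sum-replicate-zero k))

ΣF-+ : ∀ k (f g : Fin k → F3) → ΣF k (λ i → f i +F g i) ≡ ΣF k f +F ΣF k g
ΣF-+ k f g = trans (ΣF≡sum k _)
  (trans (∑-distrib-+ f g) (sym (cong₂ _+F_ (ΣF≡sum k f) (ΣF≡sum k g))))

ΣF-swap : ∀ k l (f : Fin k → Fin l → F3) →
  ΣF k (λ i → ΣF l (f i)) ≡ ΣF l (λ j → ΣF k (λ i → f i j))
ΣF-swap k l f = begin
  ΣF k (λ i → ΣF l (f i))         ≡⟨ ΣF-cong k (λ i → ΣF≡sum l (f i)) ⟩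
  ΣF k (λ i → sumᵛ (f i))         ≡⟨ ΣF≡sum k _ ⟩
  sumᵛ (λ i → sumᵛ (f i))         ≡⟨ ∑-comm f ⟩
  sumᵛ (λ j → sumᵛ (λ i → f i j)) ≡⟨ sym (ΣF≡sum l _) ⟩
  ΣF l (λ j → sumᵛ (λ i → f i j)) ≡⟨ ΣF-cong l (λ j → sym (ΣF≡sum k _)) ⟩
  ΣF l (λ j → ΣF k (λ i → f i j)) ∎
  where open ≡-Reasoning

ΣF-permute : ∀ k (π : Permutation′ k) (f : Fin k → F3) →
  ΣF k (λ i → f (π ⟨$⟩ʳ i)) ≡ ΣF k f
ΣF-permute k π f =
  trans (ΣF≡sum k _) (trans (sym (sum-permute f π)) (sym (ΣF≡sum k f)))

ΣF-single : ∀ k (i₀ : Fin k) {f : Fin k → F3} →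
  (∀ i → i ≢ i₀ → f i ≡ 0F) → ΣF k f ≡ f i₀
ΣF-single (suc k) fz {f} off =
  trans (cong (f fz +F_) (ΣF-zero k (λ i → off (fs i) λ ()))) (+F-identityʳ _)
ΣF-single (suc k) (fs i₀) {f} off =
  trans (cong (_+F ΣF k (f ∘ fs)) (off fz λ ()))
        (trans (+F-identityˡ _) (ΣF-single k i₀ (λ i i≢ → off (fs i) (i≢ ∘ suc-injective))))

-- Alternating functions on words

module Words {Vertex : Set} (_≟_ : DecidableEquality Vertex) where

  infixl 6 _⊕_ _⊖_
  infix  8 -ₗ_
  infix  4 _≈_

  -- Words may be unsorted and of any length. A chain is stored together with all its reorderings,
  -- so contraction with a vertex is prepending a letter, without a search for its sorted place.
  record Λ : Set where
    no-eta-equality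
    constructor form
    infix 30 _⟨_⟩
    field _⟨_⟩ : List Vertex → F3
  open Λ public

  record _≈_ (x y : Λ) : Set where
    constructor pointwise
    field at : ∀ σ → x ⟨ σ ⟩ ≡ y ⟨ σ ⟩
  open _≈_ public

  ≈-refl : ∀ {x} → x ≈ x
  ≈-refl = pointwise λ σ → refl

  ≈-sym : ∀ {x y} → x ≈ y → y ≈ x
  ≈-sym p = pointwise λ σ → sym (at p σ)

  ≈-trans : ∀ {x y z} → x ≈ y → y ≈ z → x ≈ z
  ≈-trans p q = pointwise λ σ → trans (at p σ) (at q σ)

  Λ-setoid : Setoid _ _
  Λ-setoid = record
    { Carrier = Λ ; _≈_ = _≈_
    ; isEquivalence = record { refl = ≈-refl ; sym = ≈-sym ; trans = ≈-trans } }

  open import Relation.Binary.Reasoning.Setoid Λ-setoid public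

  𝟘 : Λ
  𝟘 ⟨ σ ⟩ = 0F

  _⊕_ : Λ → Λ → Λ
  (x ⊕ y) ⟨ σ ⟩ = x ⟨ σ ⟩ +F y ⟨ σ ⟩

  -ₗ_ : Λ → Λ
  (-ₗ x) ⟨ σ ⟩ = -F (x ⟨ σ ⟩)

  _⊖_ : Λ → Λ → Λ
  x ⊖ y = x ⊕ -ₗ y

  ∑ : ∀ {k} → (Fin k → Λ) → Λ
  ∑ {k} f ⟨ σ ⟩ = ΣF k (λ i → f i ⟨ σ ⟩)

  ⊕-cong : ∀ {x x′ y y′} → x ≈ x′ → y ≈ y′ → x ⊕ y ≈ x′ ⊕ y′
  ⊕-cong p q = pointwise λ σ → cong₂ _+F_ (at p σ) (at q σ)

  -ₗ-cong : ∀ {x x′} → x ≈ x′ → -ₗ x ≈ -ₗ x′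
  -ₗ-cong p = pointwise λ σ → cong -F_ (at p σ)

  ⊖-cong : ∀ {x x′ y y′} → x ≈ x′ → y ≈ y′ → x ⊖ y ≈ x′ ⊖ y′
  ⊖-cong p q = ⊕-cong p (-ₗ-cong q)

  ∑-cong : ∀ {k} {f g : Fin k → Λ} → (∀ i → f i ≈ g i) → ∑ f ≈ ∑ g
  ∑-cong {k} p = pointwise λ σ → ΣF-cong k (λ i → at (p i) σ)

  ∑-zero : ∀ {k} {f : Fin k → Λ} → (∀ i → f i ≈ 𝟘) → ∑ f ≈ 𝟘
  ∑-zero {k} p = pointwise λ σ → ΣF-zero k (λ i → at (p i) σ)

  ∑-⊕ : ∀ {k} (f g : Fin k → Λ) → ∑ (λ i → f i ⊕ g i) ≈ ∑ f ⊕ ∑ g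
  ∑-⊕ {k} f g = pointwise λ σ → ΣF-+ k _ _

  ∑-single : ∀ {k} (i₀ : Fin k) {f : Fin k → Λ} → (∀ i → i ≢ i₀ → f i ≈ 𝟘) → ∑ f ≈ f i₀
  ∑-single {k} i₀ off = pointwise λ σ → ΣF-single k i₀ (λ i i≢ → at (off i i≢) σ)

  ∑-swap : ∀ {k l} (f : Fin k → Fin l → Λ) → ∑ (λ i → ∑ (f i)) ≈ ∑ (λ j → ∑ (λ i → f i j))
  ∑-swap {k} {l} f = pointwise λ σ → ΣF-swap k l _

  ≈𝟘⇒-≈𝟘 : ∀ {x} → x ≈ 𝟘 → -ₗ x ≈ 𝟘
  ≈𝟘⇒-≈𝟘 p = pointwise λ σ → cong -F_ (at p σ)

  ⊕-zero : ∀ {x y} → x ≈ 𝟘 → y ≈ 𝟘 → x ⊕ y ≈ 𝟘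
  ⊕-zero p q = pointwise λ σ → cong₂ _+F_ (at p σ) (at q σ)

  ⊖-zero : ∀ {x y} → x ≈ 𝟘 → y ≈ 𝟘 → x ⊖ y ≈ 𝟘
  ⊖-zero p q = ⊕-zero p (≈𝟘⇒-≈𝟘 q)

  ⊕-identityʳ : ∀ {x y} → y ≈ 𝟘 → x ⊕ y ≈ x
  ⊕-identityʳ {x} p = pointwise λ σ → trans (cong (x ⟨ σ ⟩ +F_) (at p σ)) (+F-identityʳ _)

  ⊕-identityˡ : ∀ {x y} → x ≈ 𝟘 → x ⊕ y ≈ y
  ⊕-identityˡ {x} {y} p = pointwise λ σ → trans (cong (_+F y ⟨ σ ⟩) (at p σ)) (+F-identityˡ _)

  ⊖-identityʳ : ∀ {x y} → y ≈ 𝟘 → x ⊖ y ≈ x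
  ⊖-identityʳ p = ⊕-identityʳ (≈𝟘⇒-≈𝟘 p)

  ⊖-inverse : ∀ {x y} → x ≈ y → x ⊖ y ≈ 𝟘
  ⊖-inverse {x} {y} p =
    pointwise λ σ → trans (cong (_+F (-F y ⟨ σ ⟩)) (at p σ)) (-F-inverseʳ (y ⟨ σ ⟩))

  ⊖≈𝟘⇒≈ : ∀ {x y} → x ⊖ y ≈ 𝟘 → x ≈ y
  ⊖≈𝟘⇒≈ {x} {y} p = pointwise λ σ →
    trans (solve 2 (λ a b → a := (a :+ (:- b)) :+ b) refl (x ⟨ σ ⟩) (y ⟨ σ ⟩))
          (trans (cong (_+F y ⟨ σ ⟩) (at p σ)) (+F-identityˡ _))

  -ₗ-involutive : ∀ {x} → -ₗ (-ₗ x) ≈ x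
  -ₗ-involutive {x} = pointwise λ σ → solve 1 (λ a → :- (:- a) := a) refl (x ⟨ σ ⟩)

  private
    _⊗_ : Λ → Λ → Λ
    (x ⊗ y) ⟨ σ ⟩ = x ⟨ σ ⟩ *F y ⟨ σ ⟩

    const : F3 → Λ
    const c ⟨ σ ⟩ = c

    -- The pointwise product exists only to make the ring solver applicable to sums in Λ.
    Λ-commutativeRing : CommutativeRing _ _
    Λ-commutativeRing = record
      { Carrier = Λ ; _≈_ = _≈_ ; _+_ = _⊕_ ; _*_ = _⊗_ ; -_ = -ₗ_ ; 0# = 𝟘 ; 1# = const 1F
      ; isCommutativeRing = record
        { isRing = record
          { +-isAbelianGroup = record
            { isGroup = record
              { isMonoid = record
                { isSemigroup = record
                  { isMagma = record { isEquivalence = Setoid.isEquivalence Λ-setoid ; ∙-cong = ⊕-cong }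
                  ; assoc = λ x y z → pointwise λ σ → +F-assoc (x ⟨ σ ⟩) (y ⟨ σ ⟩) (z ⟨ σ ⟩)
                  }
                ; identity = (λ x → ⊕-identityˡ ≈-refl) , (λ x → ⊕-identityʳ ≈-refl)
                }
              ; inverse = (λ x → pointwise λ σ → -F-inverseˡ (x ⟨ σ ⟩)) , (λ x → ⊖-inverse ≈-refl)
              ; ⁻¹-cong = -ₗ-cong
              }
            ; comm = λ x y → pointwise λ σ → +F-comm (x ⟨ σ ⟩) (y ⟨ σ ⟩)
            }
          ; *-cong = λ p q → pointwise λ σ → cong₂ _*F_ (at p σ) (at q σ)
          ; *-assoc = λ x y z → pointwise λ σ → *F-assoc (x ⟨ σ ⟩) (y ⟨ σ ⟩) (z ⟨ σ ⟩)
          ; *-identity = (λ x → pointwise λ σ → *F-identityˡ (x ⟨ σ ⟩))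
                       , (λ x → pointwise λ σ → *F-identityʳ (x ⟨ σ ⟩))
          ; distrib = (λ x y z → pointwise λ σ → *F-distribˡ-+F (x ⟨ σ ⟩) (y ⟨ σ ⟩) (z ⟨ σ ⟩))
                    , (λ x y z → pointwise λ σ → *F-distribʳ-+F (x ⟨ σ ⟩) (y ⟨ σ ⟩) (z ⟨ σ ⟩))
          }
        ; *-comm = λ x y → pointwise λ σ → *F-comm (x ⟨ σ ⟩) (y ⟨ σ ⟩)
        }
      }

    const-homomorphism : rawRing (fromCommutativeRing F3-commutativeRing)
                         -Raw-AlmostCommutative⟶ fromCommutativeRing Λ-commutativeRing
    const-homomorphism = record
      { ⟦_⟧ = const
      ; +-homo = λ c d → pointwise λ σ → refl
      ; *-homo = λ c d → pointwise λ σ → refl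
      ; -‿homo = λ c → pointwise λ σ → refl
      ; 0-homo = pointwise λ σ → refl
      ; 1-homo = pointwise λ σ → refl
      }

  open import Algebra.Solver.Ring (rawRing (fromCommutativeRing F3-commutativeRing))
    (fromCommutativeRing Λ-commutativeRing) const-homomorphism
    (λ c d → Maybe.map (λ p → pointwise λ σ → p) (dec⇒weaklyDec _≟F_ c d))
    public using () renaming (solve to Λ-solve; _:=_ to _:≈_; _:+_ to _:⊕_; :-_ to ⊝_)

  record Linear (L : Λ → Λ) : Set where
    field
      resp : ∀ {x y} → x ≈ y → L x ≈ L y
      add  : ∀ x y → L (x ⊕ y) ≈ L x ⊕ L y

    null : ∀ {x} → x ≈ 𝟘 → L x ≈ 𝟘
    null {x} p = begin
      L x               ≈⟨ Λ-solve 1 (λ b → b :≈ (b :⊕ b) :⊕ (⊝ b)) ≈-refl (L x) ⟩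
      (L x ⊕ L x) ⊖ L x ≈⟨ ⊖-cong (≈-trans (≈-sym (add x x)) (resp (⊕-identityʳ p))) ≈-refl ⟩
      L x ⊖ L x         ≈⟨ ⊖-inverse ≈-refl ⟩
      𝟘                 ∎

    neg : ∀ x → L (-ₗ x) ≈ -ₗ L x
    neg x = begin
      L (-ₗ x)               ≈⟨ Λ-solve 2 (λ b c → b :≈ (c :⊕ b) :⊕ (⊝ c)) ≈-refl (L (-ₗ x)) (L x) ⟩
      (L x ⊕ L (-ₗ x)) ⊖ L x ≈⟨ ⊖-cong (≈-trans (≈-sym (add x (-ₗ x))) (null (⊖-inverse ≈-refl))) ≈-refl ⟩
      𝟘 ⊖ L x                ≈⟨ ⊕-identityˡ ≈-refl ⟩
      -ₗ L x                 ∎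

    sub : ∀ x y → L (x ⊖ y) ≈ L x ⊖ L y
    sub x y = ≈-trans (add x (-ₗ y)) (⊕-cong ≈-refl (neg y))

    sum : ∀ {k} (f : Fin k → Λ) → L (∑ f) ≈ ∑ (λ i → L (f i))
    sum {zero}  f = ≈-trans (null (pointwise λ σ → refl)) (pointwise λ σ → refl)
    sum {suc k} f = begin
      L (∑ f)                             ≈⟨ resp (pointwise λ σ → refl) ⟩
      L (f fz ⊕ ∑ (λ i → f (fs i)))       ≈⟨ add _ _ ⟩
      L (f fz) ⊕ L (∑ (λ i → f (fs i)))   ≈⟨ ⊕-cong ≈-refl (sum (λ i → f (fs i))) ⟩
      L (f fz) ⊕ ∑ (λ i → L (f (fs i)))   ≈⟨ pointwise (λ σ → refl) ⟩
      ∑ (λ i → L (f i))                   ∎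

  open Linear public

  linear-∘ : ∀ {L M} → Linear L → Linear M → Linear (L ∘ M)
  resp (linear-∘ l m) p = resp l (resp m p)
  add (linear-∘ l m) x y = ≈-trans (resp l (add m x y)) (add l _ _)

  linear-∑ : ∀ {k} {L : Fin k → Λ → Λ} → (∀ i → Linear (L i)) → Linear (λ x → ∑ (λ i → L i x))
  resp (linear-∑ l) p = ∑-cong (λ i → resp (l i) p)
  add (linear-∑ l) x y = ≈-trans (∑-cong (λ i → add (l i) x y)) (∑-⊕ _ _)

  linear-id : Linear id
  resp linear-id p = p
  add linear-id x y = ≈-refl

  linear-⊖ : ∀ {L M} → Linear L → Linear M → Linear (λ x → L x ⊖ M x)
  resp (linear-⊖ l m) p = ⊖-cong (resp l p) (resp m p)
  add (linear-⊖ l m) x y = ≈-trans (⊖-cong (add l x y) (add m x y))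
    (Λ-solve 4 (λ a b c d → (a :⊕ b) :⊕ (⊝ (c :⊕ d)) :≈ (a :⊕ (⊝ c)) :⊕ (b :⊕ (⊝ d))) ≈-refl _ _ _ _)


  δ : Vertex → Vertex → F3 → F3
  δ u v c = if does (u ≟ v) then c else 0F

  -- a v is contraction with v and e v exterior multiplication by v: a u (e v x) + e v (a u x) = δ u v x,
  -- and the boundary of an alternating function is the sum of its contractions.
  a : Vertex → Λ → Λ
  a v x ⟨ σ ⟩ = x ⟨ v ∷ σ ⟩

  e : Vertex → Λ → Λ
  e v x ⟨ [] ⟩    = 0F
  e v x ⟨ u ∷ σ ⟩ = δ u v (x ⟨ σ ⟩) +F (-F (e v (a u x) ⟨ σ ⟩))

  δ-same : ∀ v c → δ v v c ≡ c
  δ-same v c rewrite dec-true (v ≟ v) refl = refl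

  δ-diff : ∀ {u v} c → u ≢ v → δ u v c ≡ 0F
  δ-diff {u} {v} c u≢v rewrite dec-false (u ≟ v) u≢v = refl

  δ-null : ∀ {u v c} → (u ≡ v → c ≡ 0F) → δ u v c ≡ 0F
  δ-null {u} {v} h with u ≟ v
  ... | yes p = h p
  ... | no  _ = refl

  δ-+ : ∀ u v c d → δ u v (c +F d) ≡ δ u v c +F δ u v d
  δ-+ u v c d with does (u ≟ v)
  ... | true  = refl
  ... | false = refl

  a-linear : ∀ v → Linear (a v)
  resp (a-linear v) p = pointwise λ σ → at p (v ∷ σ)
  add (a-linear v) x y = pointwise λ σ → refl

  e-resp : ∀ v {x y} → x ≈ y → ∀ σ → e v x ⟨ σ ⟩ ≡ e v y ⟨ σ ⟩
  e-resp v p []      = refl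
  e-resp v p (u ∷ σ) =
    cong₂ (λ c d → δ u v c +F (-F d)) (at p σ) (e-resp v (resp (a-linear u) p) σ)

  e-add : ∀ v x y σ → e v (x ⊕ y) ⟨ σ ⟩ ≡ e v x ⟨ σ ⟩ +F e v y ⟨ σ ⟩
  e-add v x y []      = refl
  e-add v x y (u ∷ σ) =
    trans (cong₂ (λ c d → c +F (-F d)) (δ-+ u v (x ⟨ σ ⟩) (y ⟨ σ ⟩))
                 (trans (e-resp v (add (a-linear u) x y) σ) (e-add v (a u x) (a u y) σ)))
          (solve 4 (λ a b c d → (a :+ b) :+ (:- (c :+ d)) := (a :+ (:- c)) :+ (b :+ (:- d))) refl
            (δ u v (x ⟨ σ ⟩)) (δ u v (y ⟨ σ ⟩)) (e v (a u x) ⟨ σ ⟩) (e v (a u y) ⟨ σ ⟩))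

  e-linear : ∀ v → Linear (e v)
  resp (e-linear v) p = pointwise (e-resp v p)
  add (e-linear v) x y = pointwise (e-add v x y)

  ae-same : ∀ v x → a v (e v x) ≈ x ⊖ e v (a v x)
  ae-same v x = pointwise λ σ → cong (_+F (-F (e v (a v x) ⟨ σ ⟩))) (δ-same v _)

  ae-diff : ∀ {u v} x → u ≢ v → a u (e v x) ≈ -ₗ e v (a u x)
  ae-diff {u} {v} x u≢v = pointwise λ σ →
    trans (cong (_+F (-F (e v (a u x) ⟨ σ ⟩))) (δ-diff (x ⟨ σ ⟩) u≢v)) (+F-identityˡ _)

  record Alt (x : Λ) : Set where
    constructor alternating
    field swap-sign : ∀ ρ u v σ → x ⟨ ρ ++ u ∷ v ∷ σ ⟩ ≡ -F (x ⟨ ρ ++ v ∷ u ∷ σ ⟩)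
  open Alt public

  aa-anti : ∀ {x} → Alt x → ∀ u v → a u (a v x) ≈ -ₗ a v (a u x)
  aa-anti α u v = pointwise λ σ → swap-sign α [] v u σ

  alt-resp : ∀ {x y} → x ≈ y → Alt x → Alt y
  alt-resp p α = alternating λ ρ u v σ →
    trans (sym (at p _)) (trans (swap-sign α ρ u v σ) (cong -F_ (at p _)))

  alt-⊕ : ∀ {x y} → Alt x → Alt y → Alt (x ⊕ y)
  alt-⊕ {x} {y} α β = alternating λ ρ u v σ →
    trans (cong₂ _+F_ (swap-sign α ρ u v σ) (swap-sign β ρ u v σ))
      (solve 2 (λ c d → (:- c) :+ (:- d) := :- (c :+ d)) refl
        (x ⟨ ρ ++ v ∷ u ∷ σ ⟩) (y ⟨ ρ ++ v ∷ u ∷ σ ⟩))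

  alt-neg : ∀ {x} → Alt x → Alt (-ₗ x)
  alt-neg α = alternating λ ρ u v σ → cong -F_ (swap-sign α ρ u v σ)

  alt-𝟘 : Alt 𝟘
  alt-𝟘 = alternating λ ρ u v σ → refl

  alt-a : ∀ v {x} → Alt x → Alt (a v x)
  alt-a w α = alternating λ ρ → swap-sign α (w ∷ ρ)

  alt-e : ∀ v {x} → Alt x → Alt (e v x)
  alt-e v {x} α = alternating (go α)
    where
    δ-neg : ∀ u v c → δ u v (-F c) ≡ -F δ u v c
    δ-neg u v c with does (u ≟ v)
    ... | true  = refl
    ... | false = refl

    go : ∀ {x} → Alt x → ∀ ρ t u σ → e v x ⟨ ρ ++ t ∷ u ∷ σ ⟩ ≡ -F (e v x ⟨ ρ ++ u ∷ t ∷ σ ⟩)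
    go {x} α (w ∷ ρ) t u σ =
      trans (cong₂ (λ c d → c +F (-F d))
               (trans (cong (δ w v) (swap-sign α ρ t u σ)) (δ-neg w v (x ⟨ ρ ++ u ∷ t ∷ σ ⟩)))
               (go (alt-a w α) ρ t u σ))
            (solve 2 (λ c d → (:- c) :+ (:- (:- d)) := :- (c :+ (:- d))) refl
              (δ w v (x ⟨ ρ ++ u ∷ t ∷ σ ⟩)) (e v (a w x) ⟨ ρ ++ u ∷ t ∷ σ ⟩))
    go {x} α [] t u σ =
      trans (cong (λ d → δ t v (x ⟨ u ∷ σ ⟩) +F (-F (δ u v (x ⟨ t ∷ σ ⟩) +F (-F d))))
              (trans (e-resp v (aa-anti α u t) σ) (at (neg (e-linear v) (a t (a u x))) σ)))
            (solve 3 (λ p q r → p :+ (:- (q :+ (:- (:- r)))) := :- (q :+ (:- (p :+ (:- r))))) refl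
              (δ t v (x ⟨ u ∷ σ ⟩)) (δ u v (x ⟨ t ∷ σ ⟩)) (e v (a t (a u x)) ⟨ σ ⟩))

  -- The degree is the dimension plus two. Degree 0 contains only the zero function and stands for
  -- dimension -2, which gives the induction on connectivity a trivial start.
  record Deg (s : ℕ) (x : Λ) : Set where
    constructor degree
    field off-degree : ∀ σ → suc (length σ) ≢ s → x ⟨ σ ⟩ ≡ 0F
  open Deg public

  deg-resp : ∀ {s x y} → x ≈ y → Deg s x → Deg s y
  deg-resp p d = degree λ σ n → trans (sym (at p σ)) (off-degree d σ n)

  deg-⊕ : ∀ {s x y} → Deg s x → Deg s y → Deg s (x ⊕ y)
  deg-⊕ d d′ = degree λ σ n → cong₂ _+F_ (off-degree d σ n) (off-degree d′ σ n)

  deg-neg : ∀ {s x} → Deg s x → Deg s (-ₗ x)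
  deg-neg d = degree λ σ n → cong -F_ (off-degree d σ n)

  deg-𝟘 : ∀ {s} → Deg s 𝟘
  deg-𝟘 = degree λ σ n → refl

  deg-a : ∀ {s} v {x} → Deg (suc s) x → Deg s (a v x)
  deg-a v d = degree λ σ n → off-degree d (v ∷ σ) (n ∘ cong pred)

  deg-e : ∀ {s} v {x} → Deg s x → Deg (suc s) (e v x)
  deg-e v d = degree (go d)
    where
    go : ∀ {s x} → Deg s x → ∀ σ → suc (length σ) ≢ suc s → e v x ⟨ σ ⟩ ≡ 0F
    go d []      n = refl
    go {zero} {x} d (u ∷ σ) n = trans (cong₂ (λ c f → c +F (-F f)) (δ-null {u} {v} (λ _ → off-degree d σ λ ()))
      (at (null (e-linear v) (pointwise λ τ → off-degree d (u ∷ τ) λ ())) σ)) refl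
    go {suc s} d (u ∷ σ) n = cong₂ (λ c f → c +F (-F f))
      (δ-null {u} {v} (λ _ → off-degree d σ (n ∘ cong suc)))
      (go (deg-a u d) σ (n ∘ cong suc))

  deg-zero : ∀ {x} → Deg 0 x → x ≈ 𝟘
  deg-zero d = pointwise λ σ → off-degree d σ λ ()

-- Chains of the chessboard complex

-- Pigeonhole: if every index occurred in `xs`, its position would inject `Fin n` into the positions
-- of a shorter list.
fresh : ∀ {n} (xs : List (Fin n)) → length xs < n → ∃ λ i → i ∉ xs
fresh {n} xs short = by-search (any? λ i → ¬? (i ∈? xs))
  where
  open DecMembership (_≟F_ {n}) using (_∈?_)
  by-search : Dec (∃ λ i → i ∉ xs) → ∃ λ i → i ∉ xs
  by-search (yes found) = found
  by-search (no none)   = contradiction (injective⇒≤ {f = index ∘ member} index-injective) (<⇒≱ short)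
    where
    member : ∀ i → i ∈ xs
    member i = decidable-stable (i ∈? xs) (λ i∉ → none (i , i∉))
    index-injective : ∀ {i j} → index (member i) ≡ index (member j) → i ≡ j
    index-injective {i} {j} eq =
      trans (lookup-index (member i)) (trans (cong (List.lookup xs) eq) (sym (lookup-index (member j))))

-- Rows and columns are kept abstract, so that the transposed board is a second instance.
module Board {Vertex : Set} (_≟_ : DecidableEquality Vertex) (p q : ℕ)
  (row : Vertex → Fin p) (col : Vertex → Fin q) (mk : Fin p → Fin q → Vertex)
  (row-mk : ∀ i j → row (mk i j) ≡ i) (col-mk : ∀ i j → col (mk i j) ≡ j)
  (mk-η : ∀ v → mk (row v) (col v) ≡ v) where

  open Words _≟_
  open DecMembership (_≟F_ {p}) using () renaming (_∈?_ to _∈ʳ?_)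
  open DecMembership (_≟F_ {q}) using () renaming (_∈?_ to _∈ᶜ?_)

  linear-neg : Linear -ₗ_
  resp linear-neg = -ₗ-cong
  add linear-neg x y = Λ-solve 2 (λ c d → ⊝ (c :⊕ d) :≈ (⊝ c) :⊕ (⊝ d)) ≈-refl x y

  ∑-⊖ : ∀ {k} (f g : Fin k → Λ) → ∑ (λ i → f i ⊖ g i) ≈ ∑ f ⊖ ∑ g
  ∑-⊖ f g = ≈-trans (∑-⊕ f (λ i → -ₗ g i)) (⊕-cong ≈-refl (≈-sym (sum linear-neg g)))

  ∂ᴸ : Λ → Λ
  ∂ᴸ x = ∑ λ i → ∑ λ j → a (mk i j) x

  ∂-linear : Linear ∂ᴸ
  ∂-linear = linear-∑ λ i → linear-∑ λ j → a-linear (mk i j)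

  -- `∂ᴸ` is a sum of contractions, and these anticommute on alternating functions. Hence the
  -- coefficient of a vertex in a cycle is itself a cycle, living in the link of that vertex.
  a∂ : ∀ {x} → Alt x → ∀ v → a v (∂ᴸ x) ≈ -ₗ ∂ᴸ (a v x)
  a∂ {x} α v = begin
    a v (∂ᴸ x)                              ≈⟨ sum (a-linear v) _ ⟩
    ∑ (λ i → a v (∑ λ j → a (mk i j) x))    ≈⟨ ∑-cong (λ i → sum (a-linear v) _) ⟩
    ∑ (λ i → ∑ λ j → a v (a (mk i j) x))    ≈⟨ ∑-cong (λ i → ∑-cong λ j → aa-anti α v (mk i j)) ⟩
    ∑ (λ i → ∑ λ j → -ₗ a (mk i j) (a v x)) ≈⟨ ∑-cong (λ i → ≈-sym (sum linear-neg _)) ⟩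
    ∑ (λ i → -ₗ ∑ λ j → a (mk i j) (a v x)) ≈⟨ ≈-sym (sum linear-neg _) ⟩
    -ₗ ∂ᴸ (a v x)                           ∎

  ∂a : ∀ {x} → Alt x → ∀ v → ∂ᴸ (a v x) ≈ -ₗ a v (∂ᴸ x)
  ∂a α v = ≈-trans (≈-sym -ₗ-involutive) (-ₗ-cong (≈-sym (a∂ α v)))

  alt-∑ : ∀ {k} {f : Fin k → Λ} → (∀ i → Alt (f i)) → Alt (∑ f)
  alt-∑ {k} {f} α = alternating λ ρ u v σ →
    trans (ΣF-cong k (λ i → swap-sign (α i) ρ u v σ)) (sym (at (sum linear-neg f) (ρ ++ v ∷ u ∷ σ)))

  alt-∂ : ∀ {x} → Alt x → Alt (∂ᴸ x)
  alt-∂ α = alt-∑ λ i → alt-∑ λ j → alt-a (mk i j) α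

  ∂∂ : ∀ {x} → Alt x → ∂ᴸ (∂ᴸ x) ≈ 𝟘
  ∂∂ {x} α = begin
    -- In F₃ every `c` equals `-(c + c)`, so a term that equals its own negative vanishes.
    ∂ᴸ (∂ᴸ x)                             ≈⟨ Λ-solve 1 (λ c → c :≈ ⊝ (c :⊕ c)) ≈-refl (∂ᴸ (∂ᴸ x)) ⟩
    -ₗ (∂ᴸ (∂ᴸ x) ⊕ ∂ᴸ (∂ᴸ x))            ≈⟨ -ₗ-cong (⊕-cong flip ≈-refl) ⟩
    -ₗ ((-ₗ ∂ᴸ (∂ᴸ x)) ⊕ ∂ᴸ (∂ᴸ x))       ≈⟨ Λ-solve 1 (λ c → ⊝ ((⊝ c) :⊕ c) :≈ c :⊕ (⊝ c)) ≈-refl (∂ᴸ (∂ᴸ x)) ⟩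
    ∂ᴸ (∂ᴸ x) ⊖ ∂ᴸ (∂ᴸ x)                 ≈⟨ ⊖-inverse ≈-refl ⟩
    𝟘                                     ∎
    where
    flip : ∂ᴸ (∂ᴸ x) ≈ -ₗ ∂ᴸ (∂ᴸ x)
    flip = begin
      ∂ᴸ (∂ᴸ x)                               ≈⟨ sum ∂-linear _ ⟩
      ∑ (λ i → ∂ᴸ (∑ λ j → a (mk i j) x))     ≈⟨ ∑-cong (λ i → sum ∂-linear _) ⟩
      ∑ (λ i → ∑ λ j → ∂ᴸ (a (mk i j) x))     ≈⟨ ∑-cong (λ i → ∑-cong λ j → ∂a α (mk i j)) ⟩
      ∑ (λ i → ∑ λ j → -ₗ a (mk i j) (∂ᴸ x))  ≈⟨ ∑-cong (λ i → ≈-sym (sum linear-neg _)) ⟩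
      ∑ (λ i → -ₗ ∑ λ j → a (mk i j) (∂ᴸ x))  ≈⟨ ≈-sym (sum linear-neg _) ⟩
      -ₗ ∂ᴸ (∂ᴸ x)                            ∎

  mk-injective : ∀ {i i′ j j′} → mk i j ≡ mk i′ j′ → i ≡ i′ × j ≡ j′
  mk-injective eq = trans (sym (row-mk _ _)) (trans (cong row eq) (row-mk _ _))
                  , trans (sym (col-mk _ _)) (trans (cong col eq) (col-mk _ _))

  -- Sum the relation between `a u` and `e v` over all vertices `u`: the term `δ u v x` survives
  -- once, at `u = v`. In particular coning a cycle with `v` fills it, as long as the cone is still
  -- a chain of the board.
  ∂e : ∀ v x → ∂ᴸ (e v x) ≈ x ⊖ e v (∂ᴸ x)
  ∂e v x = begin
    ∂ᴸ (e v x)                                                      ≈⟨ ∑-cong (λ i → ∑-cong λ j → pointwise λ σ → refl) ⟩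
    ∑ (λ i → ∑ λ j → Δ (mk i j) ⊖ e v (a (mk i j) x))               ≈⟨ ∑-cong (λ i → ∑-⊖ _ _) ⟩
    ∑ (λ i → (∑ λ j → Δ (mk i j)) ⊖ (∑ λ j → e v (a (mk i j) x)))   ≈⟨ ∑-⊖ _ _ ⟩
    (∑ λ i → ∑ λ j → Δ (mk i j)) ⊖ (∑ λ i → ∑ λ j → e v (a (mk i j) x))
      ≈⟨ ⊖-cong Δ-sum (≈-sym (≈-trans (sum (e-linear v) _) (∑-cong λ i → sum (e-linear v) _))) ⟩
    x ⊖ e v (∂ᴸ x)                                                  ∎
    where
    Δ : Vertex → Λ
    Δ u ⟨ σ ⟩ = δ u v (x ⟨ σ ⟩)

    Δ-off : ∀ {u} → u ≢ v → Δ u ≈ 𝟘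
    Δ-off u≢v = pointwise λ σ → δ-diff (x ⟨ σ ⟩) u≢v

    Δ-sum : (∑ λ i → ∑ λ j → Δ (mk i j)) ≈ x
    Δ-sum = begin
      (∑ λ i → ∑ λ j → Δ (mk i j))
        ≈⟨ ∑-single (row v) (λ i i≢ → ∑-zero λ j → Δ-off λ eq → i≢ (trans (sym (row-mk i j)) (cong row eq))) ⟩
      (∑ λ j → Δ (mk (row v) j))
        ≈⟨ ∑-single (col v) (λ j j≢ → Δ-off λ eq → j≢ (trans (sym (col-mk _ j)) (cong col eq))) ⟩
      Δ (mk (row v) (col v))
        ≈⟨ pointwise (λ σ → trans (cong (λ u → δ u v (x ⟨ σ ⟩)) (mk-η v)) (δ-same v (x ⟨ σ ⟩))) ⟩
      x ∎

  Conf : Vertex → Vertex → Set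
  Conf u v = row u ≡ row v ⊎ col u ≡ col v

  -- Chains with words of length s - 1, on the board with the rows D and the columns E deleted.
  record Good (D : List (Fin p)) (E : List (Fin q)) (s : ℕ) (x : Λ) : Set where
    field
      alt      : Alt x
      deg      : Deg s x
      conf     : ∀ {u v} → Conf u v → a u (a v x) ≈ 𝟘
      avoidRow : ∀ {v} → row v ∈ D → a v x ≈ 𝟘
      avoidCol : ∀ {v} → col v ∈ E → a v x ≈ 𝟘
  open Good public

  private variable
    D D′ : List (Fin p)
    E E′ : List (Fin q)
    s : ℕ
    x y : Λ

  good-resp : x ≈ y → Good D E s x → Good D E s y
  good-resp x≈y g = record
    { alt = alt-resp x≈y (alt g)
    ; deg = deg-resp x≈y (deg g)
    ; conf = λ c → ≈-trans (resp (a-linear _) (resp (a-linear _) (≈-sym x≈y))) (conf g c)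
    ; avoidRow = λ i → ≈-trans (resp (a-linear _) (≈-sym x≈y)) (avoidRow g i)
    ; avoidCol = λ i → ≈-trans (resp (a-linear _) (≈-sym x≈y)) (avoidCol g i)
    }

  good-⊕ : Good D E s x → Good D E s y → Good D E s (x ⊕ y)
  good-⊕ g h = record
    { alt = alt-⊕ (alt g) (alt h)
    ; deg = deg-⊕ (deg g) (deg h)
    ; conf = λ c → ≈-trans (resp (a-linear _) (add (a-linear _) _ _))
                     (≈-trans (add (a-linear _) _ _) (⊕-zero (conf g c) (conf h c)))
    ; avoidRow = λ i → ≈-trans (add (a-linear _) _ _) (⊕-zero (avoidRow g i) (avoidRow h i))
    ; avoidCol = λ i → ≈-trans (add (a-linear _) _ _) (⊕-zero (avoidCol g i) (avoidCol h i))
    }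

  good-neg : Good D E s x → Good D E s (-ₗ x)
  good-neg g = record
    { alt = alt-neg (alt g)
    ; deg = deg-neg (deg g)
    ; conf = λ c → ≈-trans (resp (a-linear _) (neg (a-linear _) _))
                     (≈-trans (neg (a-linear _) _) (≈𝟘⇒-≈𝟘 (conf g c)))
    ; avoidRow = λ i → ≈-trans (neg (a-linear _) _) (≈𝟘⇒-≈𝟘 (avoidRow g i))
    ; avoidCol = λ i → ≈-trans (neg (a-linear _) _) (≈𝟘⇒-≈𝟘 (avoidCol g i))
    }

  good-⊖ : Good D E s x → Good D E s y → Good D E s (x ⊖ y)
  good-⊖ g h = good-⊕ g (good-neg h)

  good-𝟘 : Good D E s 𝟘
  good-𝟘 = record
    { alt = alt-𝟘
    ; deg = deg-𝟘
    ; conf = λ _ → pointwise λ σ → refl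
    ; avoidRow = λ _ → pointwise λ σ → refl
    ; avoidCol = λ _ → pointwise λ σ → refl
    }

  good-zero : x ≈ 𝟘 → Good D E s x
  good-zero p = good-resp (≈-sym p) good-𝟘

  good-∑ : ∀ {k} {f : Fin k → Λ} → (∀ i → Good D E s (f i)) → Good D E s (∑ f)
  good-∑ {k = zero}      g = good-zero (pointwise λ σ → refl)
  good-∑ {k = suc k} {f} g =
    good-resp {f fz ⊕ ∑ (f ∘ fs)} (pointwise λ σ → refl) (good-⊕ (g fz) (good-∑ (g ∘ fs)))

  good-shrink : (∀ {i} → i ∈ D′ → i ∈ D) → (∀ {j} → j ∈ E′ → j ∈ E) → Good D E s x → Good D′ E′ s x
  good-shrink d⊆ e⊆ g = record
    { alt = alt g ; deg = deg g ; conf = conf g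
    ; avoidRow = avoidRow g ∘ d⊆ ; avoidCol = avoidCol g ∘ e⊆ }

  good-∷ʳ : ∀ {r} → (∀ j → a (mk r j) x ≈ 𝟘) → Good D E s x → Good (r ∷ D) E s x
  good-∷ʳ {x} {r = r} r-free g = record
    { alt = alt g ; deg = deg g ; conf = conf g
    ; avoidRow = λ { {v} (here eq) → subst (λ w → a w x ≈ 𝟘) (trans (cong (λ i → mk i (col v)) (sym eq)) (mk-η v)) (r-free (col v))
                   ; (there i) → avoidRow g i }
    ; avoidCol = avoidCol g }

  good-∷ᶜ : ∀ {c} → (∀ i → a (mk i c) x ≈ 𝟘) → Good D E s x → Good D (c ∷ E) s x
  good-∷ᶜ {x} {c = c} c-free g = record
    { alt = alt g ; deg = deg g ; conf = conf g
    ; avoidRow = avoidRow g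
    ; avoidCol = λ { {v} (here eq) → subst (λ w → a w x ≈ 𝟘) (trans (cong (mk (row v)) (sym eq)) (mk-η v)) (c-free (row v))
                   ; (there i) → avoidCol g i } }

  good-a : ∀ v → Good D E (suc s) x → Good (row v ∷ D) (col v ∷ E) s (a v x)
  good-a {x = x} v g = record
    { alt = alt-a v (alt g)
    ; deg = deg-a v (deg g)
    ; conf = λ {u} {w} c → ≈-trans (resp (a-linear u) (aa-anti (alt g) w v))
        (≈-trans (neg (a-linear u) _) (≈𝟘⇒-≈𝟘
        (≈-trans (aa-anti (alt-a w (alt g)) u v) (≈𝟘⇒-≈𝟘 (null (a-linear v) (conf g c))))))
    ; avoidRow = λ { (here eq) → conf g (inj₁ eq)
                   ; {u} (there i) → ≈-trans (aa-anti (alt g) u v) (≈𝟘⇒-≈𝟘 (null (a-linear v) (avoidRow g i))) }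
    ; avoidCol = λ { (here eq) → conf g (inj₂ eq)
                   ; {u} (there i) → ≈-trans (aa-anti (alt g) u v) (≈𝟘⇒-≈𝟘 (null (a-linear v) (avoidCol g i))) }
    }

  ae-zero : ∀ u v {x} → (u ≡ v → x ≈ 𝟘) → a u x ≈ 𝟘 → a u (e v x) ≈ 𝟘
  ae-zero u v h p = pointwise λ σ → cong₂ (λ c d → c +F (-F d))
    (δ-null (λ eq → at (h eq) σ)) (at (null (e-linear v) p) σ)

  aae-zero : ∀ u w v {x} → (w ≡ v → a u x ≈ 𝟘) → (u ≡ v → a w x ≈ 𝟘) → a u (a w x) ≈ 𝟘 →
    a u (a w (e v x)) ≈ 𝟘
  aae-zero u w v h k p = pointwise λ σ → cong₂ (λ c d → c +F (-F d))
    (δ-null (λ eq → at (h eq) σ))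
    (cong₂ (λ c d → c +F (-F d)) (δ-null (λ eq → at (k eq) σ)) (at (null (e-linear v) p) σ))

  -- The first two hypotheses allow `v` to lie on a deleted row or column provided `x` is then zero.
  -- This is how `good-ea` treats all vertices uniformly: at a deleted vertex the coefficient is
  -- zero anyway.
  good-e : ∀ v → (row v ∈ D → x ≈ 𝟘) → (col v ∈ E → x ≈ 𝟘) →
    Good (row v ∷ D) (col v ∷ E) s x → Good D E (suc s) (e v x)
  good-e v r∈ c∈ g = record
    { alt = alt-e v (alt g)
    ; deg = deg-e v (deg g)
    ; conf = λ {u} {w} c → aae-zero u w v
        (λ { refl → [ (λ eq → avoidRow g (here eq)) , (λ eq → avoidCol g (here eq)) ]′ c })
        (λ { refl → [ (λ eq → avoidRow g (here (sym eq))) , (λ eq → avoidCol g (here (sym eq))) ]′ c })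
        (conf g c)
    ; avoidRow = λ {u} i → ae-zero u v (λ { refl → r∈ i }) (avoidRow g (there i))
    ; avoidCol = λ {u} i → ae-zero u v (λ { refl → c∈ i }) (avoidCol g (there i))
    }

  good-ea : ∀ v → Good D E (suc s) x → Good D E (suc s) (e v (a v x))
  good-ea v g = good-e v (avoidRow g) (avoidCol g) (good-a v g)

  good-∂ : Good D E (suc s) x → Good D E s (∂ᴸ x)
  good-∂ {x = x} g = record
    { alt = alt-∂ (alt g)
    ; deg = degree λ σ n → ΣF-zero p λ i → ΣF-zero q λ j → off-degree (deg-a (mk i j) (deg g)) σ n
    ; conf = λ {u} {w} c → ≈-trans (resp (a-linear u) (a∂ (alt g) w)) (≈-trans (neg (a-linear u) _)
        (≈𝟘⇒-≈𝟘 (≈-trans (a∂ (alt-a w (alt g)) u) (≈𝟘⇒-≈𝟘 (null ∂-linear (conf g c))))))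
    ; avoidRow = λ {u} i → ≈-trans (a∂ (alt g) u) (≈𝟘⇒-≈𝟘 (null ∂-linear (avoidRow g i)))
    ; avoidCol = λ {u} i → ≈-trans (a∂ (alt g) u) (≈𝟘⇒-≈𝟘 (null ∂-linear (avoidCol g i)))
    }

  -- Vanishing of reduced homology in dimension `s - 2` for the board without `D` and `E`.
  Exact : ℕ → List (Fin p) → List (Fin q) → Set
  Exact s D E = ∀ {x} → Good D E s x → ∂ᴸ x ≈ 𝟘 → ∃ λ w → Good D E (suc s) w × ∂ᴸ w ≈ x

  a-cycle : ∀ v → Alt x → ∂ᴸ x ≈ 𝟘 → ∂ᴸ (a v x) ≈ 𝟘
  a-cycle v α z = ≈-trans (∂a α v) (≈𝟘⇒-≈𝟘 (null (a-linear v) z))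

  -- In both cases excluded by deletion the face is already absent, so nothing has to be filled.
  filler : ∀ v → Exact s (row v ∷ D) (col v ∷ E) → Good D E (suc s) x → ∂ᴸ x ≈ 𝟘 →
    ∃ λ u → Good (row v ∷ D) (col v ∷ E) (suc s) u × Good D E (suc (suc s)) (e v u) × ∂ᴸ u ≈ a v x
  filler {s} {D} {E} {x} v exact g z = by-membership (row v ∈ʳ? D) (col v ∈ᶜ? E)
    where
    Filling : Set
    Filling = ∃ λ u → Good (row v ∷ D) (col v ∷ E) (suc s) u × Good D E (suc (suc s)) (e v u) × ∂ᴸ u ≈ a v x

    by-zero : a v x ≈ 𝟘 → Filling
    by-zero p = 𝟘 , good-𝟘 , good-zero (null (e-linear v) ≈-refl) , ≈-trans (null ∂-linear ≈-refl) (≈-sym p)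

    by-exact : row v ∉ D → col v ∉ E →
      (∃ λ u → Good (row v ∷ D) (col v ∷ E) (suc s) u × ∂ᴸ u ≈ a v x) → Filling
    by-exact ∉D ∉E (u , gu , ∂u) = u , gu , good-e v (λ i → contradiction i ∉D) (λ i → contradiction i ∉E) gu , ∂u

    by-membership : Dec (row v ∈ D) → Dec (col v ∈ E) → Filling
    by-membership (yes i) _       = by-zero (avoidRow g i)
    by-membership (no _)  (yes i) = by-zero (avoidCol g i)
    by-membership (no ∉D) (no ∉E) = by-exact ∉D ∉E (exact (good-a v g) (a-cycle v (alt g) z))

  -- Splitting a chain along a row or a column

  module Line {ℓ : ℕ} (pt : Fin ℓ → Vertex) (pt-inj : ∀ {i j} → pt i ≡ pt j → i ≡ j)
    (pt-conf : ∀ i j → Conf (pt i) (pt j)) where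

    -- The points of a line conflict pairwise, so a word in the support of a chain uses at most one
    -- of them. For chains `keep` is therefore the part that uses the line, `drop` the part that
    -- does not, and `ann` the share of the boundary in which the letter on the line is removed.
    ann keep drop : Λ → Λ
    ann x  = ∑ λ i → a (pt i) x
    keep x = ∑ λ i → e (pt i) (a (pt i) x)
    drop x = x ⊖ keep x

    ann-linear : Linear ann
    ann-linear = linear-∑ λ i → a-linear (pt i)

    keep-linear : Linear keep
    keep-linear = linear-∑ λ i → linear-∘ (e-linear (pt i)) (a-linear (pt i))

    drop-linear : Linear drop
    drop-linear = linear-⊖ linear-id keep-linear

    cone : (Fin ℓ → Λ) → Λ
    cone u = ∑ λ i → e (pt i) (u i)

    a-cone : ∀ {u} → (∀ i j → a (pt i) (u j) ≈ 𝟘) → ∀ i → a (pt i) (cone u) ≈ u i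
    a-cone {u} off i = begin
      a (pt i) (cone u)                    ≈⟨ sum (a-linear _) _ ⟩
      ∑ (λ j → a (pt i) (e (pt j) (u j)))  ≈⟨ ∑-single i (λ j j≢i → ae-zero _ _ (λ eq → contradiction (sym (pt-inj eq)) j≢i) (off i j)) ⟩
      a (pt i) (e (pt i) (u i))            ≈⟨ ae-same (pt i) (u i) ⟩
      u i ⊖ e (pt i) (a (pt i) (u i))      ≈⟨ ⊖-identityʳ (null (e-linear _) (off i i)) ⟩
      u i                                  ∎

    a-keep-on : Good D E s x → ∀ i → a (pt i) (keep x) ≈ a (pt i) x
    a-keep-on g = a-cone λ i j → conf g (pt-conf i j)

    a-drop-on : Good D E s x → ∀ i → a (pt i) (drop x) ≈ 𝟘
    a-drop-on g i = ≈-trans (sub (a-linear _) _ _) (⊖-inverse (≈-sym (a-keep-on g i)))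

    a-cone-off : ∀ {u v} → (∀ i → pt i ≢ v) → a v (cone u) ≈ -ₗ cone (λ i → a v (u i))
    a-cone-off {u} {v} off = begin
      a v (cone u)                        ≈⟨ sum (a-linear v) _ ⟩
      ∑ (λ i → a v (e (pt i) (u i)))      ≈⟨ ∑-cong (λ i → ae-diff (u i) (λ eq → off i (sym eq))) ⟩
      ∑ (λ i → -ₗ e (pt i) (a v (u i)))   ≈⟨ ≈-sym (sum linear-neg _) ⟩
      -ₗ cone (λ i → a v (u i))           ∎

    a-keep-off : ∀ {v} → Alt x → (∀ i → pt i ≢ v) → a v (keep x) ≈ keep (a v x)
    a-keep-off {x} {v} α off = begin
      a v (keep x)                                 ≈⟨ a-cone-off off ⟩
      -ₗ cone (λ i → a v (a (pt i) x))             ≈⟨ -ₗ-cong (∑-cong λ i → resp (e-linear _) (aa-anti α v (pt i))) ⟩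
      -ₗ cone (λ i → -ₗ a (pt i) (a v x))          ≈⟨ -ₗ-cong (∑-cong λ i → neg (e-linear _) _) ⟩
      -ₗ ∑ (λ i → -ₗ e (pt i) (a (pt i) (a v x)))  ≈⟨ sum linear-neg _ ⟩
      ∑ (λ i → -ₗ (-ₗ e (pt i) (a (pt i) (a v x)))) ≈⟨ ∑-cong (λ i → -ₗ-involutive) ⟩
      keep (a v x)                                 ∎

    a-drop-off : ∀ {v} → Alt x → (∀ i → pt i ≢ v) → a v (drop x) ≈ drop (a v x)
    a-drop-off α off = ≈-trans (sub (a-linear _) _ _) (⊖-cong ≈-refl (a-keep-off α off))

    drop-fixes : (∀ i → a (pt i) x ≈ 𝟘) → drop x ≈ x
    drop-fixes free = ⊖-identityʳ (∑-zero λ i → null (e-linear _) (free i))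

    ∂-cone : ∀ u → ∂ᴸ (cone u) ≈ ∑ u ⊖ cone (λ i → ∂ᴸ (u i))
    ∂-cone u = ≈-trans (sum ∂-linear _) (≈-trans (∑-cong λ i → ∂e (pt i) (u i)) (∑-⊖ _ _))

    ∂-keep : Alt x → ∂ᴸ (keep x) ≈ ann x ⊕ keep (∂ᴸ x)
    ∂-keep {x} α = begin
      ∂ᴸ (keep x)                                     ≈⟨ ∂-cone _ ⟩
      ann x ⊖ ∑ (λ i → e (pt i) (∂ᴸ (a (pt i) x)))    ≈⟨ ⊖-cong ≈-refl (∑-cong λ i →
                                                          ≈-trans (resp (e-linear _) (∂a α (pt i))) (neg (e-linear _) _)) ⟩
      ann x ⊖ ∑ (λ i → -ₗ e (pt i) (a (pt i) (∂ᴸ x))) ≈⟨ ⊕-cong ≈-refl (sum linear-neg _) ⟩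
      ann x ⊕ ∑ (λ i → -ₗ (-ₗ e (pt i) (a (pt i) (∂ᴸ x)))) ≈⟨ ⊕-cong ≈-refl (∑-cong λ i → -ₗ-involutive) ⟩
      ann x ⊕ keep (∂ᴸ x)                             ∎

    ∂-drop : Alt x → ∂ᴸ (drop x) ≈ drop (∂ᴸ x) ⊖ ann x
    ∂-drop {x} α = begin
      ∂ᴸ (drop x)                       ≈⟨ sub ∂-linear _ _ ⟩
      ∂ᴸ x ⊖ ∂ᴸ (keep x)                ≈⟨ ⊖-cong ≈-refl (∂-keep α) ⟩
      ∂ᴸ x ⊖ (ann x ⊕ keep (∂ᴸ x))      ≈⟨ Λ-solve 3 (λ b c d → b :⊕ (⊝ (c :⊕ d)) :≈ (b :⊕ (⊝ d)) :⊕ (⊝ c)) ≈-refl _ _ _ ⟩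
      drop (∂ᴸ x) ⊖ ann x               ∎

    ∂-ann : Alt x → ∂ᴸ (ann x) ≈ -ₗ ann (∂ᴸ x)
    ∂-ann α = ≈-trans (sum ∂-linear _) (≈-trans (∑-cong λ i → ∂a α (pt i)) (≈-sym (sum linear-neg _)))

    -- The corrections for different points of a line do not interact: adding `∂ᴸ (cone u)` changes
    -- the coefficient of `pt i` by `-∂ᴸ (u i)` alone. Choosing each `u i` to fill that coefficient
    -- clears the whole line at once.
    a-∂cone : ∀ {u} → (∀ i → Alt (e (pt i) (u i))) → (∀ i j → a (pt i) (u j) ≈ 𝟘) →
      ∀ i → a (pt i) (∂ᴸ (cone u)) ≈ -ₗ ∂ᴸ (u i)
    a-∂cone {u} α off i = ≈-trans (a∂ (alt-∑ α) (pt i)) (-ₗ-cong (resp ∂-linear (a-cone off i)))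

    good-keep : Good D E (suc s) x → Good D E (suc s) (keep x)
    good-keep g = good-∑ λ i → good-ea (pt i) g

    good-drop : Good D E (suc s) x → Good D E (suc s) (drop x)
    good-drop g = good-⊖ g (good-keep g)

    alt-drop : Alt x → Alt (drop x)
    alt-drop α = alt-⊕ α (alt-neg (alt-∑ λ i → alt-e (pt i) (alt-a (pt i) α)))

    drop-zero : x ≈ 𝟘 → drop x ≈ 𝟘
    drop-zero = null drop-linear

  module RowLine (r : Fin p) = Line (mk r) (λ eq → proj₂ (mk-injective eq))
    (λ i j → inj₁ (trans (row-mk r i) (sym (row-mk r j))))
  module ColLine (c : Fin q) = Line (λ i → mk i c) (λ eq → proj₁ (mk-injective eq))
    (λ i j → inj₂ (trans (col-mk i c) (sym (col-mk j c))))

  good-a-mk : ∀ i j → Good D E (suc s) x → Good (i ∷ D) (j ∷ E) s (a (mk i j) x)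
  good-a-mk {D} {E} {s} {x} i j g =
    subst₂ (λ i′ j′ → Good (i′ ∷ D) (j′ ∷ E) s (a (mk i j) x)) (row-mk i j) (col-mk i j) (good-a (mk i j) g)

  good-e-mk : ∀ i j → (i ∈ D → x ≈ 𝟘) → (j ∈ E → x ≈ 𝟘) →
    Good (i ∷ D) (j ∷ E) s x → Good D E (suc s) (e (mk i j) x)
  good-e-mk {D} {x} {E} {s} i j i∈ j∈ g = good-e (mk i j)
    (i∈ ∘ subst (_∈ D) (row-mk i j)) (j∈ ∘ subst (_∈ E) (col-mk i j))
    (subst₂ (λ i′ j′ → Good (i′ ∷ D) (j′ ∷ E) s x) (sym (row-mk i j)) (sym (col-mk i j)) g)

  filler-mk : ∀ i j → Exact s (i ∷ D) (j ∷ E) → Good D E (suc s) x → ∂ᴸ x ≈ 𝟘 →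
    ∃ λ u → Good (i ∷ D) (j ∷ E) (suc s) u × Good D E (suc (suc s)) (e (mk i j) u) × ∂ᴸ u ≈ a (mk i j) x
  filler-mk {s} {D} {E} {x} i j = subst₂
    (λ i′ j′ → Exact s (i′ ∷ D) (j′ ∷ E) → Good D E (suc s) x → ∂ᴸ x ≈ 𝟘 →
      ∃ λ u → Good (i′ ∷ D) (j′ ∷ E) (suc s) u × Good D E (suc (suc s)) (e (mk i j) u) × ∂ᴸ u ≈ a (mk i j) x)
    (row-mk i j) (col-mk i j) (filler (mk i j))

  avoidRow-mk : ∀ {i} → Good D E s x → i ∈ D → ∀ j → a (mk i j) x ≈ 𝟘
  avoidRow-mk {D} {i = i} g i∈ j = avoidRow g (subst (_∈ D) (sym (row-mk i j)) i∈)

  avoidCol-mk : ∀ {j} → Good D E s x → j ∈ E → ∀ i → a (mk i j) x ≈ 𝟘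
  avoidCol-mk {E = E} {j = j} g j∈ i = avoidCol g (subst (_∈ E) (sym (col-mk i j)) j∈)

  conf-row : ∀ i j k → Good D E s x → a (mk i j) (a (mk i k) x) ≈ 𝟘
  conf-row i j k g = conf g (inj₁ (trans (row-mk i j) (sym (row-mk i k))))

  conf-col : ∀ i j k → Good D E s x → a (mk j i) (a (mk k i) x) ≈ 𝟘
  conf-col i j k g = conf g (inj₂ (trans (col-mk j i) (sym (col-mk k i))))

  aa-zero : ∀ u v → Alt x → a u (a v x) ≈ 𝟘 → a v (a u x) ≈ 𝟘
  aa-zero u v α p = ≈-trans (aa-anti α v u) (≈𝟘⇒-≈𝟘 p)

  ae-fix : ∀ v → a v x ≈ 𝟘 → a v (e v x) ≈ x
  ae-fix v p = ≈-trans (ae-same v _) (⊖-identityʳ (null (e-linear v) p))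

  mk≢-row : ∀ {i i′ j j′} → i ≢ i′ → mk i j ≢ mk i′ j′
  mk≢-row i≢ eq = i≢ (proj₁ (mk-injective eq))

  mk≢-col : ∀ {i i′ j j′} → j ≢ j′ → mk i j ≢ mk i′ j′
  mk≢-col j≢ eq = j≢ (proj₂ (mk-injective eq))

  -- Suspension over two edges of a row, and the clearing of rows and columns

  twin : Fin p → Fin q → Fin q → Λ → Λ
  twin r c₁ c₂ y = e (mk r c₁) y ⊖ e (mk r c₂) y

  twin-linear : ∀ r c₁ c₂ → Linear (twin r c₁ c₂)
  twin-linear r c₁ c₂ = linear-⊖ (e-linear _) (e-linear _)

  ∂-twin : ∀ r c₁ c₂ y → ∂ᴸ (twin r c₁ c₂ y) ≈ -ₗ twin r c₁ c₂ (∂ᴸ y)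
  ∂-twin r c₁ c₂ y = begin
    ∂ᴸ (twin r c₁ c₂ y)
      ≈⟨ sub ∂-linear _ _ ⟩
    ∂ᴸ (e (mk r c₁) y) ⊖ ∂ᴸ (e (mk r c₂) y)
      ≈⟨ ⊖-cong (∂e _ _) (∂e _ _) ⟩
    (y ⊖ e (mk r c₁) (∂ᴸ y)) ⊖ (y ⊖ e (mk r c₂) (∂ᴸ y))
      ≈⟨ Λ-solve 3 (λ y b c → (y :⊕ (⊝ b)) :⊕ (⊝ (y :⊕ (⊝ c))) :≈ ⊝ (b :⊕ (⊝ c))) ≈-refl _ _ _ ⟩
    -ₗ twin r c₁ c₂ (∂ᴸ y) ∎

  good-twin : ∀ {r c₁ c₂} → r ∉ D → c₁ ∉ E → c₂ ∉ E → Good (r ∷ D) (c₂ ∷ c₁ ∷ E) s y →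
    Good D E (suc s) (twin r c₁ c₂ y)
  good-twin r∉ c₁∉ c₂∉ g = good-⊖
    (good-e-mk _ _ (λ i → contradiction i r∉) (λ i → contradiction i c₁∉) (good-shrink id there g))
    (good-e-mk _ _ (λ i → contradiction i r∉) (λ i → contradiction i c₂∉)
      (good-shrink id (λ { (here eq) → here eq ; (there i) → there (there i) }) g))

  -- x − ∂w involves row r only through the edges to c₁ and c₂, which forces both coefficients to be ± y.
  twin-form : ∀ {r c₁ c₂} → r ∉ D → c₁ ∉ E → c₂ ∉ E → c₁ ≢ c₂ →
    Good D E (suc (suc s)) x → ∂ᴸ x ≈ 𝟘 →
    (∀ j → j ≢ c₁ → j ≢ c₂ → a (mk r j) x ≈ 𝟘) →
    (∀ b d → b ≢ r → d ≢ r → a (mk d c₂) (a (mk b c₁) x) ≈ 𝟘) →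
    ∃₂ λ w y → Good D E (suc (suc (suc s))) w × Good (r ∷ D) (c₂ ∷ c₁ ∷ E) (suc s) y × ∂ᴸ y ≈ 𝟘
             × x ≈ ∂ᴸ w ⊕ twin r c₁ c₂ y
  twin-form {D} {E} {s} {x} {r} {c₁} {c₂} r∉ c₁∉ c₂∉ c₁≢c₂ g z row-free col-free =
    w , t , good-w , good-t , ∂t , x-form
    where
    module C = ColLine c₁
    P Q : Vertex
    P = mk r c₁
    Q = mk r c₂
    X₁ X₂ h h₁ h₂ w t t₂ : Λ
    X₁ = a P x
    X₂ = a Q x
    h  = x ⊖ (e P X₁ ⊕ e Q X₂)
    h₁ = C.keep h
    h₂ = C.drop h
    -- `h₂` avoids `c₁` and `h₁` avoids `c₂`, so each half of `h` can be coned from the edge of `r`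
    -- to the column that it avoids. The two cones absorb `h` and leave only terms through `P` and
    -- `Q`.
    w  = e P h₂ ⊕ e Q h₁
    t  = X₁ ⊕ ∂ᴸ h₂
    t₂ = X₂ ⊕ ∂ᴸ h₁

    P≢Q : P ≢ Q
    P≢Q = mk≢-col c₁≢c₂

    a-h : ∀ u → a u h ≈ a u x ⊖ (a u (e P X₁) ⊕ a u (e Q X₂))
    a-h u = ≈-trans (sub (a-linear u) _ _) (⊖-cong ≈-refl (add (a-linear u) _ _))

    h-free : ∀ j → Dec (j ≡ c₁) → Dec (j ≡ c₂) → a (mk r j) h ≈ 𝟘
    h-free j (yes refl) _ = begin
      a P h                                   ≈⟨ a-h P ⟩
      X₁ ⊖ (a P (e P X₁) ⊕ a P (e Q X₂))      ≈⟨ ⊖-cong ≈-refl (⊕-identityʳ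
                                                  (ae-zero P Q (λ eq → contradiction eq P≢Q) (conf-row r c₁ c₂ g))) ⟩
      X₁ ⊖ a P (e P X₁)                       ≈⟨ ⊖-inverse (≈-sym (ae-fix P (conf-row r c₁ c₁ g))) ⟩
      𝟘                                       ∎
    h-free j (no _) (yes refl) = begin
      a Q h                                   ≈⟨ a-h Q ⟩
      X₂ ⊖ (a Q (e P X₁) ⊕ a Q (e Q X₂))      ≈⟨ ⊖-cong ≈-refl (⊕-identityˡ
                                                  (ae-zero Q P (λ eq → contradiction (sym eq) P≢Q) (conf-row r c₂ c₁ g))) ⟩
      X₂ ⊖ a Q (e Q X₂)                       ≈⟨ ⊖-inverse (≈-sym (ae-fix Q (conf-row r c₂ c₂ g))) ⟩
      𝟘                                       ∎
    h-free j (no j≢c₁) (no j≢c₂) = ≈-trans (a-h (mk r j)) (⊖-zero (row-free j j≢c₁ j≢c₂) (⊕-zero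
      (ae-zero _ P (λ eq → contradiction eq (mk≢-col j≢c₁)) (conf-row r j c₁ g))
      (ae-zero _ Q (λ eq → contradiction eq (mk≢-col j≢c₂)) (conf-row r j c₂ g))))

    good-h : Good (r ∷ D) E (suc (suc s)) h
    good-h = good-∷ʳ (λ j → h-free j (j ≟F c₁) (j ≟F c₂)) (good-⊖ g (good-⊕ (good-ea P g) (good-ea Q g)))

    h-col : ∀ b d → Dec (b ≡ r) → Dec (d ≡ r) → a (mk d c₂) (a (mk b c₁) h) ≈ 𝟘
    h-col b d (yes refl) _ = null (a-linear _) (avoidRow-mk good-h (here refl) c₁)
    h-col b d (no _) (yes refl) =
      aa-zero _ _ (alt good-h) (null (a-linear _) (avoidRow-mk good-h (here refl) c₂))
    h-col b d (no b≢) (no d≢) = ≈-trans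
      (≈-trans (resp (a-linear _) (a-h _)) (≈-trans (sub (a-linear _) _ _) (⊖-cong ≈-refl (add (a-linear _) _ _))))
      (⊖-zero (col-free b d b≢ d≢) (⊕-zero
        (aae-zero _ _ P (λ eq → contradiction eq (mk≢-row b≢)) (λ eq → contradiction eq (mk≢-row d≢))
          (null (a-linear _) (conf-col c₁ b r g)))
        (aae-zero _ _ Q (λ eq → contradiction eq (mk≢-row b≢)) (λ eq → contradiction eq (mk≢-row d≢))
          (aa-zero _ _ (alt-a Q (alt g)) (null (a-linear _) (conf-col c₂ d r g))))))

    good-h₁ : Good (r ∷ D) (c₂ ∷ E) (suc (suc s)) h₁
    good-h₁ = good-∷ᶜ (λ i → ≈-trans (C.a-cone-off λ k → mk≢-col c₁≢c₂) (≈𝟘⇒-≈𝟘 (∑-zero λ b →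
      null (e-linear _) (h-col b i (b ≟F r) (i ≟F r))))) (C.good-keep good-h)

    good-h₂ : Good (r ∷ D) (c₁ ∷ E) (suc (suc s)) h₂
    good-h₂ = good-∷ᶜ (C.a-drop-on good-h) (C.good-drop good-h)

    good-w : Good D E (suc (suc (suc s))) w
    good-w = good-⊕
      (good-e-mk r c₁ (λ i → contradiction i r∉) (λ i → contradiction i c₁∉) good-h₂)
      (good-e-mk r c₂ (λ i → contradiction i r∉) (λ i → contradiction i c₂∉) good-h₁)

    ∂X : ∀ v → ∂ᴸ (a v x) ≈ 𝟘
    ∂X v = a-cycle v (alt g) z

    ∂eX : ∀ v → ∂ᴸ (e v (a v x)) ≈ a v x
    ∂eX v = ≈-trans (∂e v _) (⊖-identityʳ (null (e-linear v) (∂X v)))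

    ∂t : ∂ᴸ t ≈ 𝟘
    ∂t = ≈-trans (add ∂-linear _ _) (⊕-zero (∂X P) (∂∂ (alt good-h₂)))

    ∂h : ∂ᴸ h ≈ -ₗ (X₁ ⊕ X₂)
    ∂h = begin
      ∂ᴸ h                                     ≈⟨ sub ∂-linear _ _ ⟩
      ∂ᴸ x ⊖ ∂ᴸ (e P X₁ ⊕ e Q X₂)              ≈⟨ ⊕-identityˡ z ⟩
      -ₗ ∂ᴸ (e P X₁ ⊕ e Q X₂)                  ≈⟨ -ₗ-cong (≈-trans (add ∂-linear _ _) (⊕-cong (∂eX P) (∂eX Q))) ⟩
      -ₗ (X₁ ⊕ X₂)                             ∎

    -- `e P X₁` and `e Q X₂` are cones over cycles, so `∂ᴸ x = 0` forces `∂ᴸ h = -(X₁ + X₂)`, and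
    -- `h₁` and `h₂` add up to `h`.
    t₂≈ : t₂ ≈ -ₗ t
    t₂≈ = begin
      X₂ ⊕ ∂ᴸ h₁
        ≈⟨ Λ-solve 4 (λ b c d f → b :⊕ d :≈ (⊝ (c :⊕ f)) :⊕ ((c :⊕ b) :⊕ (d :⊕ f))) ≈-refl X₂ X₁ (∂ᴸ h₁) (∂ᴸ h₂) ⟩
      -ₗ t ⊕ ((X₁ ⊕ X₂) ⊕ (∂ᴸ h₁ ⊕ ∂ᴸ h₂))
        ≈⟨ ⊕-identityʳ (≈-trans (⊕-cong ≈-refl (≈-trans (≈-sym (add ∂-linear _ _)) (≈-trans (resp ∂-linear h-split) ∂h)))
             (⊖-inverse ≈-refl)) ⟩
      -ₗ t ∎
      where
      h-split : h₁ ⊕ h₂ ≈ h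
      h-split = Λ-solve 2 (λ b c → b :⊕ (c :⊕ (⊝ b)) :≈ c) ≈-refl h₁ h

    t≈ : -ₗ t₂ ≈ t
    t≈ = ≈-trans (-ₗ-cong t₂≈) -ₗ-involutive

    good-X : ∀ c → Good (r ∷ D) (c ∷ E) (suc s) (a (mk r c) x)
    good-X c = good-a-mk r c g

    -- By its formula `t` avoids only `c₁`; that it avoids `c₂` as well is inherited from `t₂`, of
    -- which it is the negative.
    good-t : Good (r ∷ D) (c₂ ∷ c₁ ∷ E) (suc s) t
    good-t = good-∷ᶜ (λ i → avoidCol-mk (good-resp t≈ (good-neg good-t₂)) (here refl) i)
                     (good-⊕ (good-X c₁) (good-∂ good-h₂))
      where
      good-t₂ : Good (r ∷ D) (c₂ ∷ E) (suc s) t₂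
      good-t₂ = good-⊕ (good-X c₂) (good-∂ good-h₁)

    x-form : x ≈ ∂ᴸ w ⊕ twin r c₁ c₂ t
    x-form = begin
      x
        ≈⟨ Λ-solve 6 (λ x eX₁ eX₂ h₁ f₁ f₂ →
             x :≈ (((x :⊕ (⊝ (eX₁ :⊕ eX₂))) :⊕ (⊝ h₁)) :⊕ (⊝ f₁) :⊕ (h₁ :⊕ (⊝ f₂))) :⊕ ((eX₁ :⊕ f₁) :⊕ (eX₂ :⊕ f₂)))
             ≈-refl x (e P X₁) (e Q X₂) h₁ (e P (∂ᴸ h₂)) (e Q (∂ᴸ h₁)) ⟩
      ((h₂ ⊖ e P (∂ᴸ h₂)) ⊕ (h₁ ⊖ e Q (∂ᴸ h₁))) ⊕ ((e P X₁ ⊕ e P (∂ᴸ h₂)) ⊕ (e Q X₂ ⊕ e Q (∂ᴸ h₁)))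
        ≈⟨ ⊕-cong (≈-sym (≈-trans (add ∂-linear _ _) (⊕-cong (∂e P h₂) (∂e Q h₁))))
             (⊕-cong (≈-sym (add (e-linear P) _ _)) (≈-trans (≈-sym (add (e-linear Q) _ _))
               (≈-trans (resp (e-linear Q) t₂≈) (neg (e-linear Q) _)))) ⟩
      ∂ᴸ w ⊕ twin r c₁ c₂ t ∎

  a-neg : ∀ {x} u → a u (-ₗ x) ≈ -ₗ a u x
  a-neg u = neg (a-linear u) _

  -- The coefficient of each edge of `c` is a cycle in the link of that edge; the cone over all the
  -- fillings clears the column, by `a-∂cone`.
  column-fill : ∀ {c} → (∀ b → Exact s (b ∷ D) (c ∷ E)) → Good D E (suc s) x → ∂ᴸ x ≈ 𝟘 →
    ∃ λ w → Good D E (suc (suc s)) w × (∀ b → a (mk b c) (x ⊕ ∂ᴸ w) ≈ 𝟘)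
  column-fill {s} {D} {E} {x} {c} exact g z = cone u , good-∑ good-eu , free
    where
    open ColLine c
    fill : ∀ b → _
    fill b = filler-mk b c (exact b) g z
    u : Fin p → Λ
    u b = proj₁ (fill b)
    good-u : ∀ b → Good (b ∷ D) (c ∷ E) (suc s) (u b)
    good-u b = proj₁ (proj₂ (fill b))
    good-eu : ∀ b → Good D E (suc (suc s)) (e (mk b c) (u b))
    good-eu b = proj₁ (proj₂ (proj₂ (fill b)))
    ∂u : ∀ b → ∂ᴸ (u b) ≈ a (mk b c) x
    ∂u b = proj₂ (proj₂ (proj₂ (fill b)))
    free : ∀ b → a (mk b c) (x ⊕ ∂ᴸ (cone u)) ≈ 𝟘
    free b = ≈-trans (add (a-linear _) _ _)
      (≈-trans (⊕-cong ≈-refl (≈-trans (a-∂cone (λ i → alt (good-eu i)) (λ i j → avoidCol-mk (good-u j) (here refl) i) b)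
                                        (-ₗ-cong (∂u b))))
               (⊖-inverse ≈-refl))

  -- No word uses both columns.
  Split : Fin q → Fin q → Λ → Set
  Split c₁ c₂ x = ∀ b d → a (mk d c₂) (a (mk b c₁) x) ≈ 𝟘

  split-⊕ : ∀ {c₁ c₂} → Split c₁ c₂ x → Split c₁ c₂ y → Split c₁ c₂ (x ⊕ y)
  split-⊕ α β b d = ≈-trans (resp (a-linear _) (add (a-linear _) _ _))
    (≈-trans (add (a-linear _) _ _) (⊕-zero (α b d) (β b d)))

  -- Inside the link of each edge `b c₁`, `column-fill` clears `c₂` from the coefficient of that
  -- edge. The sign of the cone is negative because contraction with `b c₁` turns `∂ᴸ (cone u)` into
  -- `-∂ᴸ (u b)`, whereas the coefficient has to be corrected by `+∂ᴸ (u b)`.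
  make-split : ∀ {c₁ c₂} → c₁ ∉ E → (∀ b d → Exact s (d ∷ b ∷ D) (c₂ ∷ c₁ ∷ E)) →
    Good D E (suc (suc s)) x → ∂ᴸ x ≈ 𝟘 →
    ∃ λ w → Good D E (suc (suc (suc s))) w × Split c₁ c₂ (x ⊕ ∂ᴸ w)
  make-split {E} {s} {D} {x} {c₁} {c₂} c₁∉ exact g z = -ₗ cone u , good-neg (good-∑ good-eu) , split
    where
    open ColLine c₁
    Fill : Fin p → Set
    Fill b = ∃ λ u → Good (b ∷ D) (c₁ ∷ E) (suc (suc s)) u × Good D E (suc (suc (suc s))) (e (mk b c₁) u)
                   × (∀ d → a (mk d c₂) (a (mk b c₁) x ⊕ ∂ᴸ u) ≈ 𝟘)
    fill′ : ∀ b → Dec (b ∈ D) → Fill b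
    fill′ b (yes b∈) = 𝟘 , good-𝟘 , good-zero (null (e-linear _) ≈-refl)
      , λ d → null (a-linear _) (⊕-zero (avoidRow-mk g b∈ c₁) (null ∂-linear ≈-refl))
    fill′ b (no b∉) =
      let u , gu , free = column-fill (exact b) (good-a-mk b c₁ g) (a-cycle _ (alt g) z)
      in u , gu , good-e-mk b c₁ (λ i → contradiction i b∉) (λ i → contradiction i c₁∉) gu , free
    fill : ∀ b → Fill b
    fill b = fill′ b (b ∈ʳ? D)
    u : Fin p → Λ
    u b = proj₁ (fill b)
    good-eu : ∀ b → Good D E (suc (suc (suc s))) (e (mk b c₁) (u b))
    good-eu b = proj₁ (proj₂ (proj₂ (fill b)))
    split : Split c₁ c₂ (x ⊕ ∂ᴸ (-ₗ cone u))
    split b d = ≈-trans (resp (a-linear _) (begin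
      a (mk b c₁) (x ⊕ ∂ᴸ (-ₗ cone u))               ≈⟨ add (a-linear _) _ _ ⟩
      a (mk b c₁) x ⊕ a (mk b c₁) (∂ᴸ (-ₗ cone u))   ≈⟨ ⊕-cong ≈-refl (≈-trans (resp (a-linear _) (neg ∂-linear _)) (a-neg _)) ⟩
      a (mk b c₁) x ⊖ a (mk b c₁) (∂ᴸ (cone u))      ≈⟨ ⊖-cong ≈-refl (a-∂cone (λ i → alt (good-eu i))
                                                          (λ i j → avoidCol-mk (proj₁ (proj₂ (fill j))) (here refl) i) b) ⟩
      a (mk b c₁) x ⊖ -ₗ ∂ᴸ (u b)                    ≈⟨ ⊕-cong ≈-refl -ₗ-involutive ⟩
      a (mk b c₁) x ⊕ ∂ᴸ (u b)                       ∎)) (proj₂ (proj₂ (proj₂ (fill b))) d)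

  -- Mayer–Vietoris for the two subcomplexes that avoid one of the columns.
  split-exact : ∀ {c₁ c₂} → c₁ ≢ c₂ → Exact (suc s) D (c₁ ∷ E) → Exact (suc s) D (c₂ ∷ E) →
    Exact s D (c₂ ∷ c₁ ∷ E) → Good D E (suc s) x → ∂ᴸ x ≈ 𝟘 → Split c₁ c₂ x →
    ∃ λ w → Good D E (suc (suc s)) w × Split c₁ c₂ w × ∂ᴸ w ≈ x
  split-exact {s} {D} {E} {x} {c₁} {c₂} c₁≢c₂ exact₁ exact₂ exact₁₂ g z split =
    w₁ ⊕ w₂
    , good-⊕ (good-shrink id there gw₁) (good-shrink id there gw₂)
    , split-⊕ (λ b d → aa-zero _ _ (alt gw₁) (null (a-linear _) (avoidCol-mk gw₁ (here refl) d)))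
              (λ b d → null (a-linear _) (avoidCol-mk gw₂ (here refl) b))
    , (begin
        ∂ᴸ (w₁ ⊕ w₂)             ≈⟨ add ∂-linear _ _ ⟩
        ∂ᴸ w₁ ⊕ ∂ᴸ w₂            ≈⟨ ⊕-cong ∂w₁ ∂w₂ ⟩
        (keep x ⊖ u) ⊕ (drop x ⊕ u) ≈⟨ Λ-solve 3 (λ k u x → (k :⊕ (⊝ u)) :⊕ ((x :⊕ (⊝ k)) :⊕ u) :≈ x) ≈-refl (keep x) u x ⟩
        x                        ∎)
    where
    open ColLine c₁
    -- `ann x` is the image of `x` under the connecting map: the boundary of the half `keep x`,
    -- which lies in the intersection of the two subcomplexes. Its filling `u` closes up both
    -- halves.
    good-ann : Good D (c₂ ∷ c₁ ∷ E) s (ann x)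
    good-ann = good-∑ λ b → good-∷ᶜ (λ d → split b d) (good-shrink there id (good-a-mk b c₁ g))
    ∂ann : ∂ᴸ (ann x) ≈ 𝟘
    ∂ann = ≈-trans (∂-ann (alt g)) (≈𝟘⇒-≈𝟘 (null ann-linear z))
    filled = exact₁₂ good-ann ∂ann
    u = proj₁ filled
    good-u : Good D (c₂ ∷ c₁ ∷ E) (suc s) u
    good-u = proj₁ (proj₂ filled)
    ∂u : ∂ᴸ u ≈ ann x
    ∂u = proj₂ (proj₂ filled)
    good-keep-u : Good D (c₂ ∷ E) (suc s) (keep x ⊖ u)
    good-keep-u = good-⊖
      (good-∷ᶜ (λ d → ≈-trans (a-cone-off λ k → mk≢-col c₁≢c₂) (≈𝟘⇒-≈𝟘 (∑-zero λ b → null (e-linear _) (split b d))))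
               (good-keep g))
      (good-shrink id (λ { (here eq) → here eq ; (there i) → there (there i) }) good-u)
    ∂keep-u : ∂ᴸ (keep x ⊖ u) ≈ 𝟘
    ∂keep-u = ≈-trans (sub ∂-linear _ _) (≈-trans (⊖-cong (≈-trans (∂-keep (alt g)) (⊕-identityʳ (null keep-linear z))) ∂u)
                                                   (⊖-inverse ≈-refl))
    good-drop-u : Good D (c₁ ∷ E) (suc s) (drop x ⊕ u)
    good-drop-u = good-⊕ (good-∷ᶜ (a-drop-on g) (good-drop g)) (good-shrink id there good-u)
    ∂drop-u : ∂ᴸ (drop x ⊕ u) ≈ 𝟘
    ∂drop-u = ≈-trans (add ∂-linear _ _) (≈-trans (⊕-cong (≈-trans (∂-drop (alt g)) (⊕-identityˡ (drop-zero z))) ∂u)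
      (≈-trans (Λ-solve 1 (λ b → (⊝ b) :⊕ b :≈ b :⊕ (⊝ b)) ≈-refl _) (⊖-inverse ≈-refl)))
    fill₁ = exact₂ good-keep-u ∂keep-u
    fill₂ = exact₁ good-drop-u ∂drop-u
    w₁ = proj₁ fill₁
    w₂ = proj₁ fill₂
    gw₁ : Good D (c₂ ∷ E) (suc (suc s)) w₁
    gw₁ = proj₁ (proj₂ fill₁)
    gw₂ : Good D (c₁ ∷ E) (suc (suc s)) w₂
    gw₂ = proj₁ (proj₂ fill₂)
    ∂w₁ = proj₂ (proj₂ fill₁)
    ∂w₂ = proj₂ (proj₂ fill₂)

  aa-∂ : ∀ u v → Alt x → a u (a v (∂ᴸ x)) ≈ ∂ᴸ (a u (a v x))
  aa-∂ {x} u v α = begin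
    a u (a v (∂ᴸ x))       ≈⟨ resp (a-linear u) (a∂ α v) ⟩
    a u (-ₗ ∂ᴸ (a v x))    ≈⟨ a-neg u ⟩
    -ₗ a u (∂ᴸ (a v x))    ≈⟨ -ₗ-cong (a∂ (alt-a v α) u) ⟩
    -ₗ (-ₗ ∂ᴸ (a u (a v x))) ≈⟨ -ₗ-involutive ⟩
    ∂ᴸ (a u (a v x))       ∎

  cycle-⊕∂ : ∀ {w} → Alt w → ∂ᴸ x ≈ 𝟘 → ∂ᴸ (x ⊕ ∂ᴸ w) ≈ 𝟘
  cycle-⊕∂ α z = ≈-trans (add ∂-linear _ _) (⊕-zero z (∂∂ α))

  -- Where this is applied, only `s + 2` undeleted rows are guaranteed. Clearing the pairs on the
  -- board without `r`, as in `twin-surjective`, would delete three rows in degree `s`. So the pairs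
  -- are cleared first, at the cost of two rows, and the row `r` afterwards in a way that preserves
  -- the result. What remains is a twin, and it bounds because its core `t` lies on a board that is
  -- exact one degree lower.
  exact-step : ∀ {r c₁ c₂} → r ∉ D → c₁ ∉ E → c₂ ∉ E → c₁ ≢ c₂ →
    (∀ b d → Exact s (d ∷ b ∷ D) (c₂ ∷ c₁ ∷ E)) →
    (∀ j → Exact (suc s) (r ∷ D) (c₁ ∷ j ∷ E)) →
    (∀ j → Exact (suc s) (r ∷ D) (c₂ ∷ j ∷ E)) →
    (∀ j → Exact s (r ∷ D) (c₂ ∷ c₁ ∷ j ∷ E)) →
    Exact (suc s) (r ∷ D) (c₂ ∷ c₁ ∷ E) →
    Exact (suc (suc s)) D E
  exact-step {D} {E} {s} {r} {c₁} {c₂} r∉ c₁∉ c₂∉ c₁≢c₂ exact-b exact₁ exact₂ exact₁₂ exact-r {x} g z =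
    W , good-W , ∂W
    where
    open RowLine r
    split₀ = make-split c₁∉ exact-b g z
    w₀ = proj₁ split₀
    good-w₀ : Good D E (suc (suc (suc s))) w₀
    good-w₀ = proj₁ (proj₂ split₀)
    x′ = x ⊕ ∂ᴸ w₀
    split-x′ : Split c₁ c₂ x′
    split-x′ = proj₂ (proj₂ split₀)
    good-x′ : Good D E (suc (suc s)) x′
    good-x′ = good-⊕ g (good-∂ good-w₀)
    ∂x′ : ∂ᴸ x′ ≈ 𝟘
    ∂x′ = cycle-⊕∂ (alt good-w₀) z

    -- The fillings are themselves split, so clearing the row brings back no word using both
    -- columns, except words in which one of these two edges lies in row `r`. `col-free` asks for
    -- nothing about those.
    Fill : Fin q → Set
    Fill j = ∃ λ u → Good (r ∷ D) (j ∷ E) (suc (suc s)) u × Good D E (suc (suc (suc s))) (e (mk r j) u)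
                   × Split c₁ c₂ u × (j ≢ c₁ → j ≢ c₂ → ∂ᴸ u ≈ a (mk r j) x′)
    trivial-fill : ∀ j → (j ≢ c₁ → j ≢ c₂ → a (mk r j) x′ ≈ 𝟘) → Fill j
    trivial-fill j h = 𝟘 , good-𝟘 , good-zero (null (e-linear _) ≈-refl)
      , (λ b d → null (a-linear _) (null (a-linear _) ≈-refl))
      , λ j≢c₁ j≢c₂ → ≈-trans (null ∂-linear ≈-refl) (≈-sym (h j≢c₁ j≢c₂))
    fill′ : ∀ j → Dec (j ∈ E) → Fill j
    fill′ j (yes j∈) = trivial-fill j (λ _ _ → avoidCol-mk good-x′ j∈ r)
    fill′ j (no j∉) =
      let u , gu , su , ∂u = split-exact c₁≢c₂ (exact₁ j) (exact₂ j) (exact₁₂ j) (good-a-mk r j good-x′)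
                               (a-cycle _ (alt good-x′) ∂x′) split-a
      in u , gu , good-e-mk r j (λ i → contradiction i r∉) (λ i → contradiction i j∉) gu , su , λ _ _ → ∂u
      where
      split-a : Split c₁ c₂ (a (mk r j) x′)
      split-a b d = ≈-trans (resp (a-linear _) (aa-anti (alt good-x′) _ _)) (≈-trans (a-neg _) (≈𝟘⇒-≈𝟘
        (≈-trans (aa-anti (alt-a _ (alt good-x′)) _ _) (≈𝟘⇒-≈𝟘 (null (a-linear _) (split-x′ b d))))))
    fill : ∀ j → Fill j
    fill j = fill′ j (j ∈ᶜ? E)
    u : Fin q → Λ
    u j = proj₁ (fill j)
    good-eu : ∀ j → Good D E (suc (suc (suc s))) (e (mk r j) (u j))
    good-eu j = proj₁ (proj₂ (proj₂ (fill j)))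
    w₁ = cone u
    good-w₁ : Good D E (suc (suc (suc s))) w₁
    good-w₁ = good-∑ good-eu
    x″ = x′ ⊕ ∂ᴸ w₁
    good-x″ : Good D E (suc (suc s)) x″
    good-x″ = good-⊕ good-x′ (good-∂ good-w₁)

    row-free : ∀ j → j ≢ c₁ → j ≢ c₂ → a (mk r j) x″ ≈ 𝟘
    row-free j j≢c₁ j≢c₂ = ≈-trans (add (a-linear _) _ _) (≈-trans (⊕-cong ≈-refl
      (≈-trans (a-∂cone (λ i → alt (good-eu i)) (λ i k → avoidRow-mk (proj₁ (proj₂ (fill k))) (here refl) i) j)
               (-ₗ-cong (proj₂ (proj₂ (proj₂ (proj₂ (fill j)))) j≢c₁ j≢c₂)))) (⊖-inverse ≈-refl))

    col-free : ∀ b d → b ≢ r → d ≢ r → a (mk d c₂) (a (mk b c₁) x″) ≈ 𝟘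
    col-free b d b≢ d≢ = ≈-trans (resp (a-linear _) (add (a-linear _) _ _)) (≈-trans (add (a-linear _) _ _)
      (⊕-zero (split-x′ b d) (≈-trans (aa-∂ _ _ (alt good-w₁)) (null ∂-linear (begin
        a (mk d c₂) (a (mk b c₁) w₁)          ≈⟨ resp (a-linear _) (sum (a-linear _) _) ⟩
        a (mk d c₂) (∑ λ j → a (mk b c₁) (e (mk r j) (u j))) ≈⟨ sum (a-linear _) _ ⟩
        (∑ λ j → a (mk d c₂) (a (mk b c₁) (e (mk r j) (u j)))) ≈⟨ ∑-zero (λ j → aae-zero _ _ _
            (λ eq → contradiction eq (mk≢-row b≢)) (λ eq → contradiction eq (mk≢-row d≢))
            (proj₁ (proj₂ (proj₂ (proj₂ (fill j)))) b d)) ⟩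
        𝟘                                     ∎)))))

    shape = twin-form r∉ c₁∉ c₂∉ c₁≢c₂ good-x″ (cycle-⊕∂ (alt good-w₁) ∂x′) row-free col-free
    w₂ = proj₁ shape
    t = proj₁ (proj₂ shape)
    good-w₂ : Good D E (suc (suc (suc s))) w₂
    good-w₂ = proj₁ (proj₂ (proj₂ shape))
    filled = exact-r (proj₁ (proj₂ (proj₂ (proj₂ shape)))) (proj₁ (proj₂ (proj₂ (proj₂ (proj₂ shape)))))
    v = proj₁ filled
    good-v : Good (r ∷ D) (c₂ ∷ c₁ ∷ E) (suc (suc s)) v
    good-v = proj₁ (proj₂ filled)
    T = twin r c₁ c₂ v
    ∂T : ∂ᴸ T ≈ -ₗ twin r c₁ c₂ t
    ∂T = ≈-trans (∂-twin r c₁ c₂ v) (-ₗ-cong (resp (twin-linear r c₁ c₂) (proj₂ (proj₂ filled))))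
    W = ((w₂ ⊖ T) ⊖ w₀) ⊖ w₁
    good-W : Good D E (suc (suc (suc s))) W
    good-W = good-⊖ (good-⊖ (good-⊖ good-w₂ (good-twin r∉ c₁∉ c₂∉ good-v)) good-w₀) good-w₁
    ∂W : ∂ᴸ W ≈ x
    ∂W = begin
      ∂ᴸ W
        ≈⟨ ≈-trans (sub ∂-linear _ _) (⊖-cong (≈-trans (sub ∂-linear _ _) (⊖-cong (sub ∂-linear _ _) ≈-refl)) ≈-refl) ⟩
      ((∂ᴸ w₂ ⊖ ∂ᴸ T) ⊖ ∂ᴸ w₀) ⊖ ∂ᴸ w₁
        ≈⟨ ⊖-cong (⊖-cong (⊕-cong ≈-refl (≈-trans (-ₗ-cong ∂T) -ₗ-involutive)) ≈-refl) ≈-refl ⟩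
      ((∂ᴸ w₂ ⊕ twin r c₁ c₂ t) ⊖ ∂ᴸ w₀) ⊖ ∂ᴸ w₁
        ≈⟨ ⊖-cong (⊖-cong (≈-sym (proj₂ (proj₂ (proj₂ (proj₂ (proj₂ shape)))))) ≈-refl) ≈-refl ⟩
      (((x ⊕ ∂ᴸ w₀) ⊕ ∂ᴸ w₁) ⊖ ∂ᴸ w₀) ⊖ ∂ᴸ w₁
        ≈⟨ Λ-solve 3 (λ x b c → (((x :⊕ b) :⊕ c) :⊕ (⊝ b)) :⊕ (⊝ c) :≈ x) ≈-refl x (∂ᴸ w₀) (∂ᴸ w₁) ⟩
      x ∎

  -- In the critical degree the row has to go first: its links lose one column each, whereas
  -- fillings that preserve a splitting would need boards with one more column deleted in the same
  -- degree, exceeding the budget by one. The pairs are then cleared on the board without `r`, at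
  -- the price of a third deleted row.
  twin-surjective : ∀ {r c₁ c₂} → r ∉ D → c₁ ∉ E → c₂ ∉ E → c₁ ≢ c₂ →
    (∀ j → Exact (suc s) (r ∷ D) (j ∷ E)) →
    (∀ b d → Exact s (d ∷ b ∷ r ∷ D) (c₂ ∷ c₁ ∷ E)) →
    Good D E (suc (suc s)) x → ∂ᴸ x ≈ 𝟘 →
    ∃₂ λ w y → Good D E (suc (suc (suc s))) w × Good (r ∷ D) (c₂ ∷ c₁ ∷ E) (suc s) y × ∂ᴸ y ≈ 𝟘
             × x ≈ ∂ᴸ w ⊕ twin r c₁ c₂ y
  twin-surjective {D} {E} {s} {x} {r} {c₁} {c₂} r∉ c₁∉ c₂∉ c₁≢c₂ exact-row exact-pair g z =
    (w₂ ⊖ w₁) ⊖ w₀ , t , good-⊖ (good-⊖ good-w₂ good-w₁) good-w₀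
    , proj₁ (proj₂ (proj₂ (proj₂ shape))) , proj₁ (proj₂ (proj₂ (proj₂ (proj₂ shape)))) , x-form
    where
    module R = RowLine r
    module C₁ = ColLine c₁
    module C₂ = ColLine c₂

    Fill : Fin q → Set
    Fill j = ∃ λ u → Good (r ∷ D) (j ∷ E) (suc (suc s)) u × Good D E (suc (suc (suc s))) (e (mk r j) u)
                   × ∂ᴸ u ≈ a (mk r j) x
    fill : ∀ j → Fill j
    fill j = filler-mk r j (exact-row j) g z
    u : Fin q → Λ
    u j = proj₁ (fill j)
    good-eu : ∀ j → Good D E (suc (suc (suc s))) (e (mk r j) (u j))
    good-eu j = proj₁ (proj₂ (proj₂ (fill j)))
    w₀ = R.cone u
    good-w₀ : Good D E (suc (suc (suc s))) w₀
    good-w₀ = good-∑ good-eu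
    x′ = x ⊕ ∂ᴸ w₀
    good-x′ : Good D E (suc (suc s)) x′
    good-x′ = good-⊕ g (good-∂ good-w₀)
    ∂x′ : ∂ᴸ x′ ≈ 𝟘
    ∂x′ = cycle-⊕∂ (alt good-w₀) z
    row-free : ∀ j → a (mk r j) x′ ≈ 𝟘
    row-free j = ≈-trans (add (a-linear _) _ _) (≈-trans (⊕-cong ≈-refl
      (≈-trans (R.a-∂cone (λ i → alt (good-eu i)) (λ i k → avoidRow-mk (proj₁ (proj₂ (fill k))) (here refl) i) j)
               (-ₗ-cong (proj₂ (proj₂ (proj₂ (fill j))))))) (⊖-inverse ≈-refl))

    good-r : Good (r ∷ D) E (suc (suc s)) x′
    good-r = good-∷ʳ row-free good-x′
    split₀ = make-split c₁∉ exact-pair good-r ∂x′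
    w₁ = proj₁ split₀
    good-w₁ : Good D E (suc (suc (suc s))) w₁
    good-w₁ = good-shrink there id (proj₁ (proj₂ split₀))
    x″ = x′ ⊕ ∂ᴸ w₁
    good-x″ : Good (r ∷ D) E (suc (suc s)) x″
    good-x″ = good-⊕ good-r (good-∂ (proj₁ (proj₂ split₀)))
    shape = twin-form r∉ c₁∉ c₂∉ c₁≢c₂ (good-shrink there id good-x″) (cycle-⊕∂ (alt good-w₁) ∂x′)
              (λ j _ _ → avoidRow-mk good-x″ (here refl) j) (λ b d _ _ → proj₂ (proj₂ split₀) b d)
    w₂ = proj₁ shape
    t = proj₁ (proj₂ shape)
    good-w₂ : Good D E (suc (suc (suc s))) w₂
    good-w₂ = proj₁ (proj₂ (proj₂ shape))
    x-form : x ≈ ∂ᴸ ((w₂ ⊖ w₁) ⊖ w₀) ⊕ twin r c₁ c₂ t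
    x-form = begin
      x
        ≈⟨ Λ-solve 3 (λ x b c → x :≈ ((x :⊕ b) :⊕ c) :⊕ (⊝ (b :⊕ c))) ≈-refl x (∂ᴸ w₀) (∂ᴸ w₁) ⟩
      x″ ⊖ (∂ᴸ w₀ ⊕ ∂ᴸ w₁)
        ≈⟨ ⊖-cong (proj₂ (proj₂ (proj₂ (proj₂ (proj₂ shape))))) ≈-refl ⟩
      (∂ᴸ w₂ ⊕ twin r c₁ c₂ t) ⊖ (∂ᴸ w₀ ⊕ ∂ᴸ w₁)
        ≈⟨ Λ-solve 4 (λ d t b c → (d :⊕ t) :⊕ (⊝ (b :⊕ c)) :≈ ((d :⊕ (⊝ c)) :⊕ (⊝ b)) :⊕ t) ≈-refl _ _ _ _ ⟩
      ((∂ᴸ w₂ ⊖ ∂ᴸ w₁) ⊖ ∂ᴸ w₀) ⊕ twin r c₁ c₂ t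
        ≈⟨ ⊕-cong (≈-sym (≈-trans (sub ∂-linear _ _) (⊖-cong (sub ∂-linear _ _) ≈-refl))) ≈-refl ⟩
      ∂ᴸ ((w₂ ⊖ w₁) ⊖ w₀) ⊕ twin r c₁ c₂ t ∎

  -- Transposition of two rows

  module RowSwap (b d : Fin p) (b≢d : b ≢ d) where

    τ : Fin p → Fin p
    τ = PC.transpose b d

    τ-fst : τ b ≡ d
    τ-fst rewrite dec-true (b ≟F b) refl = refl

    τ-snd : τ d ≡ b
    τ-snd rewrite dec-false (d ≟F b) (b≢d ∘ sym) | dec-true (d ≟F d) refl = refl

    τ-other : ∀ {i} → i ≢ b → i ≢ d → τ i ≡ i
    τ-other {i} i≢b i≢d rewrite dec-false (i ≟F b) i≢b | dec-false (i ≟F d) i≢d = refl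

    τ-involutive : ∀ i → τ (τ i) ≡ i
    τ-involutive i = by-cases (i ≟F b) (i ≟F d)
      where
      by-cases : Dec (i ≡ b) → Dec (i ≡ d) → τ (τ i) ≡ i
      by-cases (yes refl) _          = trans (cong τ τ-fst) τ-snd
      by-cases (no _)     (yes refl) = trans (cong τ τ-snd) τ-fst
      by-cases (no i≢b)   (no i≢d)   = trans (cong τ (τ-other i≢b i≢d)) (τ-other i≢b i≢d)

    τᵛ : Vertex → Vertex
    τᵛ v = mk (τ (row v)) (col v)

    τᵛ-mk : ∀ i j → τᵛ (mk i j) ≡ mk (τ i) j
    τᵛ-mk i j = cong₂ (λ i′ j′ → mk (τ i′) j′) (row-mk i j) (col-mk i j)

    τᵛ-involutive : ∀ v → τᵛ (τᵛ v) ≡ v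
    τᵛ-involutive v = trans (τᵛ-mk _ _) (trans (cong (λ i → mk i (col v)) (τ-involutive (row v))) (mk-η v))

    swap : Λ → Λ
    swap x ⟨ σ ⟩ = x ⟨ map τᵛ σ ⟩

    swap-linear : Linear swap
    resp swap-linear eq = pointwise λ σ → at eq (map τᵛ σ)
    add swap-linear x y = pointwise λ σ → refl

    a-swap : ∀ v x → a v (swap x) ≈ swap (a (τᵛ v) x)
    a-swap v x = pointwise λ σ → refl

    δ-swap : ∀ u v c → δ (τᵛ u) v c ≡ δ u (τᵛ v) c
    δ-swap u v c = by-cases (τᵛ u ≟ v)
      where
      by-cases : Dec (τᵛ u ≡ v) → δ (τᵛ u) v c ≡ δ u (τᵛ v) c
      by-cases (yes refl) = trans (δ-same (τᵛ u) c)
        (sym (trans (cong (λ w → δ u w c) (τᵛ-involutive u)) (δ-same u c)))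
      by-cases (no τu≢v) = trans (δ-diff c τu≢v)
        (sym (δ-diff c (λ eq → τu≢v (trans (cong τᵛ eq) (τᵛ-involutive v)))))

    swap-e : ∀ v x → swap (e v x) ≈ e (τᵛ v) (swap x)
    swap-e v x = pointwise (go x)
      where
      go : ∀ x σ → e v x ⟨ map τᵛ σ ⟩ ≡ e (τᵛ v) (swap x) ⟨ σ ⟩
      go x []      = refl
      go x (u ∷ σ) = cong₂ (λ c f → c +F (-F f)) (δ-swap u v (x ⟨ map τᵛ σ ⟩))
        (trans (go (a (τᵛ u) x) σ) (sym (at (resp (e-linear (τᵛ v)) (a-swap u x)) σ)))

    swap-∂ : ∀ x → ∂ᴸ (swap x) ≈ swap (∂ᴸ x)
    swap-∂ x = begin
      ∂ᴸ (swap x)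
        ≈⟨ pointwise (λ σ → ΣF-cong p λ i → ΣF-cong q λ j → cong (λ v → x ⟨ v ∷ map τᵛ σ ⟩) (τᵛ-mk i j)) ⟩
      (∑ λ i → ∑ λ j → swap (a (mk (τ i) j) x))
        ≈⟨ pointwise (λ σ → ΣF-permute p (transpose b d) (λ i → ΣF q λ j → x ⟨ mk i j ∷ map τᵛ σ ⟩)) ⟩
      (∑ λ i → ∑ λ j → swap (a (mk i j) x))
        ≈⟨ pointwise (λ σ → refl) ⟩
      swap (∂ᴸ x) ∎

    τ-fixes : ∀ {D : List (Fin p)} → b ∉ D → d ∉ D → ∀ {i} → i ∈ D → τ i ∈ D
    τ-fixes {D} b∉ d∉ {i} i∈ = subst (_∈ D) (sym (τ-other (λ { refl → b∉ i∈ }) (λ { refl → d∉ i∈ }))) i∈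

    good-swap : b ∉ D → d ∉ D → Good D E s x → Good D E s (swap x)
    good-swap {D} {E} {s} {x} b∉ d∉ g = record
      { alt = alternating λ ρ u v σ → trans (cong (x ⟨_⟩) (map-++ τᵛ ρ (u ∷ v ∷ σ)))
                (trans (swap-sign (alt g) (map τᵛ ρ) (τᵛ u) (τᵛ v) (map τᵛ σ))
                       (cong (λ τ′ → -F (x ⟨ τ′ ⟩)) (sym (map-++ τᵛ ρ (v ∷ u ∷ σ)))))
      ; deg = degree λ σ n → off-degree (deg g) (map τᵛ σ) (n ∘ trans (cong suc (sym (length-map τᵛ σ))))
      ; conf = λ {u} {v} c → pointwise λ σ → at (conf g {τᵛ u} {τᵛ v} (τᵛ-conf c)) (map τᵛ σ)
      ; avoidRow = λ {v} i → pointwise λ σ → at (avoidRow g {τᵛ v} (subst (_∈ D) (sym (row-mk _ _)) (τ-fixes b∉ d∉ i))) (map τᵛ σ)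
      ; avoidCol = λ {v} i → pointwise λ σ → at (avoidCol g {τᵛ v} (subst (_∈ E) (sym (col-mk _ _)) i)) (map τᵛ σ)
      }
      where
      τᵛ-conf : ∀ {u v} → Conf u v → Conf (τᵛ u) (τᵛ v)
      τᵛ-conf (inj₁ eq) = inj₁ (trans (row-mk _ _) (trans (cong τ eq) (sym (row-mk _ _))))
      τᵛ-conf (inj₂ eq) = inj₂ (trans (col-mk _ _) (trans eq (sym (col-mk _ _))))

    -- A word with a letter in row `b` or `d` has value zero before and after the swap; in every
    -- other word all letters are fixed.
    swap-fixes : (∀ j → a (mk b j) x ≈ 𝟘) → (∀ j → a (mk d j) x ≈ 𝟘) → Alt x → swap x ≈ x
    swap-fixes b-free d-free α = pointwise (go b-free d-free α)
      where
      go : ∀ {x} → (∀ j → a (mk b j) x ≈ 𝟘) → (∀ j → a (mk d j) x ≈ 𝟘) → Alt x →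
        ∀ σ → x ⟨ map τᵛ σ ⟩ ≡ x ⟨ σ ⟩
      go b-free d-free α []      = refl
      go {x} b-free d-free α (u ∷ σ) = by-cases (row u ≟F b) (row u ≟F d)
        where
        at-u : ∀ {i} → row u ≡ i → (∀ j → a (mk i j) x ≈ 𝟘) → a u x ≈ 𝟘
        at-u eq free = subst (λ w → a w x ≈ 𝟘) (trans (cong (λ i → mk i (col u)) (sym eq)) (mk-η u)) (free (col u))
        by-cases : Dec (row u ≡ b) → Dec (row u ≡ d) → x ⟨ τᵛ u ∷ map τᵛ σ ⟩ ≡ x ⟨ u ∷ σ ⟩
        by-cases (yes eq) _ = trans
          (at (subst (λ i → a (mk i (col u)) x ≈ 𝟘) (sym (trans (cong τ eq) τ-fst)) (d-free (col u))) (map τᵛ σ))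
          (sym (at (at-u eq b-free) σ))
        by-cases (no _) (yes eq) = trans
          (at (subst (λ i → a (mk i (col u)) x ≈ 𝟘) (sym (trans (cong τ eq) τ-snd)) (b-free (col u))) (map τᵛ σ))
          (sym (at (at-u eq d-free) σ))
        by-cases (no u≢b) (no u≢d) = trans
          (cong (λ w → x ⟨ w ∷ map τᵛ σ ⟩) (trans (cong (λ i → mk i (col u)) (τ-other u≢b u≢d)) (mk-η u)))
          (go (λ j → aa-zero _ _ α (null (a-linear u) (b-free j)))
              (λ j → aa-zero _ _ α (null (a-linear u) (d-free j))) (alt-a u α) σ)

    -- swap exchanges the two terms of the difference, so it acts as −1 on such classes.
    swap-negates : ∀ {w y c} → b ∉ D → d ∉ D → Good D E (suc s) w →
      (∀ j → a (mk b j) y ≈ 𝟘) → (∀ j → a (mk d j) y ≈ 𝟘) → Alt y →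
      x ≈ ∂ᴸ w ⊕ (e (mk b c) y ⊖ e (mk d c) y) →
      ∃ λ v → Good D E (suc s) v × ∂ᴸ v ≈ x ⊕ swap x
    swap-negates {D} {E} {s} {x} {w} {y} {c} b∉ d∉ gw b-free d-free α eq = w ⊕ swap w , good-⊕ gw (good-swap b∉ d∉ gw) , (begin
      ∂ᴸ (w ⊕ swap w)
        ≈⟨ ≈-trans (add ∂-linear _ _) (⊕-cong ≈-refl (swap-∂ w)) ⟩
      ∂ᴸ w ⊕ swap (∂ᴸ w)
        ≈⟨ Λ-solve 4 (λ p q b d → p :⊕ q :≈ (p :⊕ (b :⊕ (⊝ d))) :⊕ (q :⊕ (d :⊕ (⊝ b)))) ≈-refl _ _ (e (mk b c) y) (e (mk d c) y) ⟩
      (∂ᴸ w ⊕ (e (mk b c) y ⊖ e (mk d c) y)) ⊕ (swap (∂ᴸ w) ⊕ (e (mk d c) y ⊖ e (mk b c) y))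
        ≈⟨ ⊕-cong (≈-sym eq) (≈-sym swap-x) ⟩
      x ⊕ swap x ∎)
      where
      swap-ey : ∀ i → swap (e (mk i c) y) ≈ e (mk (τ i) c) y
      swap-ey i = ≈-trans (swap-e _ y) (≈-trans
        (subst (λ v → e (τᵛ (mk i c)) (swap y) ≈ e v (swap y)) (τᵛ-mk i c) ≈-refl)
        (resp (e-linear _) (swap-fixes b-free d-free α)))
      swap-x : swap x ≈ swap (∂ᴸ w) ⊕ (e (mk d c) y ⊖ e (mk b c) y)
      swap-x = begin
        swap x
          ≈⟨ resp swap-linear eq ⟩
        swap (∂ᴸ w ⊕ (e (mk b c) y ⊖ e (mk d c) y))
          ≈⟨ add swap-linear _ _ ⟩
        swap (∂ᴸ w) ⊕ swap (e (mk b c) y ⊖ e (mk d c) y)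
          ≈⟨ ⊕-cong ≈-refl (≈-trans (sub swap-linear _ _) (⊖-cong (swap-ey b) (swap-ey d))) ⟩
        swap (∂ᴸ w) ⊕ (e (mk (τ b) c) y ⊖ e (mk (τ d) c) y)
          ≈⟨ subst₂ (λ i j → swap (∂ᴸ w) ⊕ (e (mk (τ b) c) y ⊖ e (mk (τ d) c) y) ≈ swap (∂ᴸ w) ⊕ (e (mk i c) y ⊖ e (mk j c) y))
               τ-fst τ-snd ≈-refl ⟩
        swap (∂ᴸ w) ⊕ (e (mk d c) y ⊖ e (mk b c) y) ∎

  -- Chains that bound

  Bounds : ℕ → List (Fin p) → List (Fin q) → Λ → Set
  Bounds s D E x = ∃ λ w → Good D E (suc s) w × ∂ᴸ w ≈ x

  bounds-resp : x ≈ y → Bounds s D E x → Bounds s D E y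
  bounds-resp eq (w , g , ∂w) = w , g , ≈-trans ∂w eq

  bounds-𝟘 : x ≈ 𝟘 → Bounds s D E x
  bounds-𝟘 eq = 𝟘 , good-𝟘 , ≈-trans (null ∂-linear ≈-refl) (≈-sym eq)

  bounds-⊕ : Bounds s D E x → Bounds s D E y → Bounds s D E (x ⊕ y)
  bounds-⊕ (w , g , ∂w) (v , h , ∂v) = w ⊕ v , good-⊕ g h , ≈-trans (add ∂-linear _ _) (⊕-cong ∂w ∂v)

  bounds-neg : Bounds s D E x → Bounds s D E (-ₗ x)
  bounds-neg (w , g , ∂w) = -ₗ w , good-neg g , ≈-trans (neg ∂-linear _) (-ₗ-cong ∂w)

  bounds-⊖ : Bounds s D E x → Bounds s D E y → Bounds s D E (x ⊖ y)
  bounds-⊖ β γ = bounds-⊕ β (bounds-neg γ)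

  bounds-∑ : ∀ {k} {f : Fin k → Λ} → (∀ i → Bounds s D E (f i)) → Bounds s D E (∑ f)
  bounds-∑ {k = k} {f} β = ∑ (λ i → proj₁ (β i)) , good-∑ (λ i → proj₁ (proj₂ (β i)))
    , ≈-trans (sum ∂-linear _) (∑-cong λ i → proj₂ (proj₂ (β i)))

  bounds-∂ : Good D E (suc s) x → Bounds s D E (∂ᴸ x)
  bounds-∂ g = _ , g , ≈-refl

  bounds-term : ∀ {k} (i : Fin k) {f : Fin k → Λ} → (∀ j → j ≢ i → Bounds s D E (f j)) →
    Bounds s D E (∑ f) → Bounds s D E (f i)
  bounds-term {s} {D} {E} {k} i {f} others total =
    bounds-resp eq (bounds-⊖ total (bounds-∑ λ j → bounds-rest j (j ≟F i)))
    where
    rest : ∀ {j} → Dec (j ≡ i) → Λ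
    rest {j} (yes _) = 𝟘
    rest {j} (no _)  = f j
    bounds-rest : ∀ j (dec : Dec (j ≡ i)) → Bounds s D E (rest dec)
    bounds-rest j (yes _)  = bounds-𝟘 ≈-refl
    bounds-rest j (no j≢i) = others j j≢i
    rest-off : ∀ j → j ≢ i → (dec : Dec (j ≡ i)) → f j ⊖ rest dec ≈ 𝟘
    rest-off j j≢i (yes eq) = contradiction eq j≢i
    rest-off j j≢i (no _)   = ⊖-inverse ≈-refl
    rest-on : (dec : Dec (i ≡ i)) → f i ⊖ rest dec ≈ f i
    rest-on (yes _)  = ⊖-identityʳ ≈-refl
    rest-on (no i≢i) = contradiction refl i≢i
    eq : ∑ f ⊖ ∑ (λ j → rest (j ≟F i)) ≈ f i
    eq = ≈-trans (≈-sym (∑-⊖ _ _)) (≈-trans (∑-single i (λ j j≢i → rest-off j j≢i (j ≟F i))) (rest-on (i ≟F i)))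

  good-col-swap : ∀ {c₁ c₂} → Good D (c₁ ∷ c₂ ∷ E) s x → Good D (c₂ ∷ c₁ ∷ E) s x
  good-col-swap = good-shrink id λ { (here eq) → there (here eq) ; (there (here eq)) → here eq ; (there (there i)) → there (there i) }

  module _ {c : Fin q} where
    open ColLine c

    good-ann : Good D E (suc s) x → Good D (c ∷ E) s (ann x)
    good-ann g = good-∑ λ b → good-shrink there id (good-a-mk b c g)

    good-drop-col : Good D E (suc s) x → Good D (c ∷ E) (suc s) (drop x)
    good-drop-col g = good-∷ᶜ (a-drop-on g) (good-drop g)

  -- Kernel of the twin map: a filling of a twin yields a filling of its core

  module TwinCycle {D : List (Fin p)} {E : List (Fin q)} {s : ℕ} {r : Fin p} {c₁ c₂ : Fin q} (c₁≢c₂ : c₁ ≢ c₂) {w y : Λ}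
    (good-w : Good D E (suc (suc (suc s))) w)
    (good-y : Good (r ∷ D) (c₂ ∷ c₁ ∷ E) (suc s) y)
    (∂w : ∂ᴸ w ≈ twin r c₁ c₂ y) where

    module R  = RowLine r
    module C₁ = ColLine c₁
    module C₂ = ColLine c₂

    Dʳ : List (Fin p)
    Dʳ = r ∷ D
    E₁₂ : List (Fin q)
    E₁₂ = c₂ ∷ c₁ ∷ E
    Bd : Λ → Set
    Bd = Bounds (suc s) Dʳ E₁₂

    W : Fin q → Λ
    W j = a (mk r j) w

    good-W : ∀ j → Good Dʳ (j ∷ E) (suc (suc s)) (W j)
    good-W j = good-a-mk r j good-w

    row-y : ∀ j → a (mk r j) y ≈ 𝟘
    row-y = avoidRow-mk good-y (here refl)

    P≢Q : mk r c₁ ≢ mk r c₂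
    P≢Q = mk≢-col c₁≢c₂

    ∂W : ∀ j → ∂ᴸ (W j) ≈ -ₗ (a (mk r j) (twin r c₁ c₂ y))
    ∂W j = ≈-trans (∂a (alt good-w) _) (-ₗ-cong (resp (a-linear _) ∂w))

    ∂W₁ : ∂ᴸ (W c₁) ≈ -ₗ y
    ∂W₁ = ≈-trans (∂W c₁) (-ₗ-cong (≈-trans (sub (a-linear _) _ _)
      (≈-trans (⊖-identityʳ (ae-zero _ _ (λ eq → contradiction eq P≢Q) (row-y c₁))) (ae-fix _ (row-y c₁)))))

    ∂W-other : ∀ j → j ≢ c₁ → j ≢ c₂ → ∂ᴸ (W j) ≈ 𝟘
    ∂W-other j j≢c₁ j≢c₂ = ≈-trans (∂W j) (≈𝟘⇒-≈𝟘 (≈-trans (sub (a-linear _) _ _) (⊖-zero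
      (ae-zero _ _ (λ eq → contradiction eq (mk≢-col j≢c₁)) (row-y j))
      (ae-zero _ _ (λ eq → contradiction eq (mk≢-col j≢c₂)) (row-y j)))))

    w₀ : Λ
    w₀ = R.drop w

    good-w₀ : Good Dʳ E (suc (suc (suc s))) w₀
    good-w₀ = good-∷ʳ (R.a-drop-on good-w) (R.good-drop good-w)

    ∂w₀ : ∂ᴸ w₀ ≈ -ₗ ∑ W
    ∂w₀ = begin
      ∂ᴸ (R.drop w)          ≈⟨ R.∂-drop (alt good-w) ⟩
      R.drop (∂ᴸ w) ⊖ ∑ W    ≈⟨ ⊕-identityˡ (≈-trans (resp R.drop-linear ∂w) (⊖-inverse (≈-sym keep-twin))) ⟩
      -ₗ ∑ W                 ∎
      where
      keep-e : ∀ i → R.keep (e (mk r i) y) ≈ e (mk r i) y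
      keep-e i = ≈-trans
        (∑-single i λ j j≢i → null (e-linear _) (ae-zero _ _ (λ eq → contradiction eq (mk≢-col j≢i)) (row-y j)))
        (resp (e-linear _) (ae-fix _ (row-y i)))
      keep-twin : R.keep (twin r c₁ c₂ y) ≈ twin r c₁ c₂ y
      keep-twin = ≈-trans (sub R.keep-linear _ _) (⊖-cong (keep-e c₁) (keep-e c₂))

    -- The letter in column `c₂` is removed from `W j`, and the words that use `c₁` are discarded.
    -- The result avoids both columns, so that it can be compared with `y`: `q̂ c₁` is `-y` up to a
    -- boundary.
    q̂ : Fin q → Λ
    q̂ j = C₁.drop (C₂.ann (W j))

    aa : Fin p → Fin p → Λ → Λ
    aa b d x = a (mk b c₁) (a (mk d c₂) x)

    aa-linear : ∀ b d → Linear (aa b d)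
    aa-linear b d = linear-∘ (a-linear _) (a-linear _)

    -- The words of `W j` that use both columns, at rows `b` and `d`, have these two edges replaced
    -- by one edge of column `j`, once at row `b` and once at row `d`. These are the terms for which
    -- the part of `w₀` using both columns is traded.
    Ŝ : Fin q → Λ
    Ŝ j = ∑ λ b → ∑ λ d → e (mk b j) (aa b d (W j)) ⊕ e (mk d j) (aa b d (W j))

    good-aa : ∀ b d {D E s x} → Good D E (suc (suc s)) x → Good (b ∷ d ∷ D) (c₁ ∷ c₂ ∷ E) s (aa b d x)
    good-aa b d g = good-a-mk b c₁ (good-a-mk d c₂ g)

    -- `∑ W` is `-∂ᴸ w₀`. Moving the boundary out through `C₂.ann` costs a sign, and moving it out
    -- through `C₁.drop` leaves the error term `C₁.ann (C₂.ann w₀)`, the double sum on the right.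
    q̂-sum : ∑ q̂ ≈ ∂ᴸ (C₁.drop (C₂.ann w₀)) ⊕ (∑ λ b → ∑ λ d → aa b d w₀)
    q̂-sum = begin
      ∑ q̂
        ≈⟨ ≈-sym (≈-trans (resp C₁.drop-linear (sum C₂.ann-linear W)) (sum C₁.drop-linear _)) ⟩
      C₁.drop (C₂.ann (∑ W))
        ≈⟨ resp C₁.drop-linear (≈-trans (resp C₂.ann-linear (≈-trans (≈-sym -ₗ-involutive) (-ₗ-cong (≈-sym ∂w₀))))
             (≈-trans (neg C₂.ann-linear _) (≈-sym (C₂.∂-ann (alt good-w₀))))) ⟩
      C₁.drop (∂ᴸ (C₂.ann w₀))
        ≈⟨ Λ-solve 2 (λ b c → b :≈ (b :⊕ (⊝ c)) :⊕ c) ≈-refl _ (C₁.ann (C₂.ann w₀)) ⟩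
      (C₁.drop (∂ᴸ (C₂.ann w₀)) ⊖ C₁.ann (C₂.ann w₀)) ⊕ C₁.ann (C₂.ann w₀)
        ≈⟨ ⊕-cong (≈-sym (C₁.∂-drop (alt (good-ann {c = c₂} good-w₀)))) (∑-cong λ b → sum (a-linear _) _) ⟩
      ∂ᴸ (C₁.drop (C₂.ann w₀)) ⊕ (∑ λ b → ∑ λ d → aa b d w₀) ∎

    -- `W c₁` already avoids `c₁` and has boundary `-y`. Its words off `c₂` form a chain on the
    -- right board whose boundary is `-y - q̂ c₁`.
    y-from-q̂ : Bd (q̂ c₁) → Bd y
    y-from-q̂ β = bounds-resp eq (bounds-neg (bounds-⊕ (bounds-∂ (good-drop-col {c = c₂} (good-W c₁))) β))
      where
      y-col₂ : C₂.drop (-ₗ y) ≈ -ₗ y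
      y-col₂ = C₂.drop-fixes λ i → ≈-trans (a-neg _) (≈𝟘⇒-≈𝟘 (avoidCol-mk good-y (here refl) i))
      q̂₁ : q̂ c₁ ≈ C₂.ann (W c₁)
      q̂₁ = C₁.drop-fixes λ i → avoidCol-mk (good-ann {c = c₂} (good-W c₁)) (there (here refl)) i
      eq : -ₗ (∂ᴸ (C₂.drop (W c₁)) ⊕ q̂ c₁) ≈ y
      eq = begin
        -ₗ (∂ᴸ (C₂.drop (W c₁)) ⊕ q̂ c₁)
          ≈⟨ -ₗ-cong (⊕-cong (≈-trans (C₂.∂-drop (alt (good-W c₁)))
               (⊖-cong (≈-trans (resp C₂.drop-linear ∂W₁) y-col₂) ≈-refl)) q̂₁) ⟩
        -ₗ (((-ₗ y) ⊖ C₂.ann (W c₁)) ⊕ C₂.ann (W c₁))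
          ≈⟨ Λ-solve 2 (λ y b → ⊝ (((⊝ y) :⊕ (⊝ b)) :⊕ b) :≈ y) ≈-refl y _ ⟩
        y ∎

    terms-zero : ∀ {j} → (∀ b d → aa b d (W j) ≈ 𝟘) → Ŝ j ≈ 𝟘
    terms-zero z = ∑-zero λ b → ∑-zero λ d → ⊕-zero (null (e-linear _) (z b d)) (null (e-linear _) (z b d))

    module Column {j : Fin q} (j∉ : j ∉ E₁₂) (∂u : ∂ᴸ (W j) ≈ 𝟘) where
      u : Λ
      u = W j

      q₁ q₂ : Fin p → Λ
      q₁ d = C₁.drop (a (mk d c₂) u)
      q₂ b = C₂.drop (a (mk b c₁) u)

      good-q₁ : ∀ d → Good (d ∷ Dʳ) (j ∷ E₁₂) (suc s) (q₁ d)
      good-q₁ d = good-shrink id (λ { (here eq) → there (there (here eq)) ; (there (here eq)) → there (here eq)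
                                    ; (there (there (here eq))) → here eq ; (there (there (there i))) → there (there (there i)) })
                    (good-drop-col {c = c₁} (good-a-mk d c₂ (good-W j)))

      good-q₂ : ∀ b → Good (b ∷ Dʳ) (j ∷ E₁₂) (suc s) (q₂ b)
      good-q₂ b = good-shrink id (λ { (here eq) → there (there (here eq)) ; (there (here eq)) → here eq
                                    ; (there (there (here eq))) → there (here eq) ; (there (there (there i))) → there (there (there i)) })
                    (good-drop-col {c = c₂} (good-a-mk b c₁ (good-W j)))

      good-eq : ∀ {x} b → (b ∈ Dʳ → x ≈ 𝟘) → Good (b ∷ Dʳ) (j ∷ E₁₂) (suc s) x → Good Dʳ E₁₂ (suc (suc s)) (e (mk b j) x)
      good-eq b b∈ = good-e-mk b j b∈ (λ i → contradiction i j∉)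

      ∂q₁ : ∀ d → ∂ᴸ (q₁ d) ≈ -ₗ ∑ λ b → aa b d u
      ∂q₁ d = ≈-trans (C₁.∂-drop (alt-a _ (alt (good-W j))))
        (⊕-identityˡ (C₁.drop-zero (a-cycle _ (alt (good-W j)) ∂u)))

      ∂q₂ : ∀ b → ∂ᴸ (q₂ b) ≈ ∑ λ d → aa b d u
      ∂q₂ b = begin
        ∂ᴸ (q₂ b)                                     ≈⟨ C₂.∂-drop (alt-a _ (alt (good-W j))) ⟩
        C₂.drop (∂ᴸ (a (mk b c₁) u)) ⊖ C₂.ann (a (mk b c₁) u)
          ≈⟨ ⊕-identityˡ (C₂.drop-zero (a-cycle _ (alt (good-W j)) ∂u)) ⟩
        -ₗ C₂.ann (a (mk b c₁) u)                     ≈⟨ sum linear-neg _ ⟩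
        (∑ λ d → -ₗ a (mk d c₂) (a (mk b c₁) u))      ≈⟨ ∑-cong (λ d → ≈-sym (aa-anti (alt (good-W j)) _ _)) ⟩
        (∑ λ d → aa b d u)                            ∎

      e∂ : ∀ v x → e v (∂ᴸ x) ≈ x ⊖ ∂ᴸ (e v x)
      e∂ v x = begin
        e v (∂ᴸ x)                    ≈⟨ Λ-solve 2 (λ b x → b :≈ x :⊕ (⊝ (x :⊕ (⊝ b)))) ≈-refl (e v (∂ᴸ x)) x ⟩
        x ⊖ (x ⊖ e v (∂ᴸ x))          ≈⟨ ⊖-cong ≈-refl (≈-sym (∂e v x)) ⟩
        x ⊖ ∂ᴸ (e v x)                ∎

      e₁ e₂ : Λ
      e₁ = ∑ λ d → e (mk d j) (q₁ d)
      e₂ = ∑ λ b → e (mk b j) (q₂ b)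

      -- For fixed `b`, the sum over `d` is the boundary of `q₂ b`, since `a (mk b c₁) u` is a
      -- cycle; `e∂` then exchanges the cone over a boundary for the chain itself modulo boundaries.
      Ŝ-first : (∑ λ b → ∑ λ d → e (mk b j) (aa b d u)) ≈ ∑ q₂ ⊖ ∂ᴸ e₂
      Ŝ-first = begin
        (∑ λ b → ∑ λ d → e (mk b j) (aa b d u))   ≈⟨ ∑-cong (λ b → ≈-trans (≈-sym (sum (e-linear _) _)) (resp (e-linear _) (≈-sym (∂q₂ b)))) ⟩
        (∑ λ b → e (mk b j) (∂ᴸ (q₂ b)))          ≈⟨ ∑-cong (λ b → e∂ _ _) ⟩
        (∑ λ b → q₂ b ⊖ ∂ᴸ (e (mk b j) (q₂ b)))   ≈⟨ ∑-⊖ _ _ ⟩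
        ∑ q₂ ⊖ (∑ λ b → ∂ᴸ (e (mk b j) (q₂ b)))   ≈⟨ ⊖-cong ≈-refl (≈-sym (sum ∂-linear _)) ⟩
        ∑ q₂ ⊖ ∂ᴸ e₂                              ∎

      Ŝ-second : (∑ λ b → ∑ λ d → e (mk d j) (aa b d u)) ≈ -ₗ (∑ q₁ ⊖ ∂ᴸ e₁)
      Ŝ-second = begin
        (∑ λ b → ∑ λ d → e (mk d j) (aa b d u))   ≈⟨ ∑-swap _ ⟩
        (∑ λ d → ∑ λ b → e (mk d j) (aa b d u))   ≈⟨ ∑-cong (λ d → ≈-trans (≈-sym (sum (e-linear _) _)) (resp (e-linear _)
                                                      (≈-trans (≈-sym -ₗ-involutive) (-ₗ-cong (≈-sym (∂q₁ d)))))) ⟩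
        (∑ λ d → e (mk d j) (-ₗ ∂ᴸ (q₁ d)))       ≈⟨ ∑-cong (λ d → ≈-trans (neg (e-linear _) _) (-ₗ-cong (e∂ _ _))) ⟩
        (∑ λ d → -ₗ (q₁ d ⊖ ∂ᴸ (e (mk d j) (q₁ d)))) ≈⟨ ≈-sym (sum linear-neg _) ⟩
        -ₗ (∑ λ d → q₁ d ⊖ ∂ᴸ (e (mk d j) (q₁ d))) ≈⟨ -ₗ-cong (≈-trans (∑-⊖ _ _) (⊖-cong ≈-refl (≈-sym (sum ∂-linear _)))) ⟩
        -ₗ (∑ q₁ ⊖ ∂ᴸ e₁)                         ∎

      -- The words of the cycle `u` that avoid both columns have a boundary made up of what words
      -- with exactly one letter in the two columns lose with that letter, up to sign. So `∑ q₁` and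
      -- `-∑ q₂` agree up to a boundary.
      q-sum : ∂ᴸ (C₁.drop (C₂.drop u)) ≈ -ₗ (∑ q₁ ⊕ ∑ q₂)
      q-sum = begin
        ∂ᴸ (C₁.drop (C₂.drop u))
          ≈⟨ C₁.∂-drop (C₂.alt-drop (alt (good-W j))) ⟩
        C₁.drop (∂ᴸ (C₂.drop u)) ⊖ C₁.ann (C₂.drop u)
          ≈⟨ ⊖-cong (resp C₁.drop-linear (≈-trans (C₂.∂-drop (alt (good-W j))) (⊕-identityˡ (C₂.drop-zero ∂u))))
               (∑-cong λ b → C₂.a-drop-off (alt (good-W j)) (λ d eq → c₁≢c₂ (sym (proj₂ (mk-injective eq))))) ⟩
        C₁.drop (-ₗ C₂.ann u) ⊖ ∑ q₂
          ≈⟨ ⊖-cong (≈-trans (neg C₁.drop-linear _) (-ₗ-cong (sum C₁.drop-linear _))) ≈-refl ⟩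
        (-ₗ ∑ q₁) ⊖ ∑ q₂
          ≈⟨ Λ-solve 2 (λ b c → (⊝ b) :⊕ (⊝ c) :≈ ⊝ (b :⊕ c)) ≈-refl _ _ ⟩
        -ₗ (∑ q₁ ⊕ ∑ q₂) ∎

      -- The coefficient 2 = −1 of ∑ q₁ is where the characteristic enters.
      bounds-column : Bd (q̂ j ⊖ Ŝ j)
      bounds-column = (C₁.drop (C₂.drop u) ⊕ e₂) ⊖ e₁
        , good-⊖ (good-⊕ (good-shrink id (λ { (here eq) → there (here eq) ; (there (here eq)) → here eq ; (there (there i)) → there (there (there i)) })
                            (good-drop-col {c = c₁} (good-drop-col {c = c₂} (good-W j))))
                         (good-∑ λ b → good-eq b (λ b∈ → C₂.drop-zero (avoidRow-mk (good-W j) b∈ c₁)) (good-q₂ b)))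
                 (good-∑ λ d → good-eq d (λ d∈ → C₁.drop-zero (avoidRow-mk (good-W j) d∈ c₂)) (good-q₁ d))
        , (begin
          ∂ᴸ ((C₁.drop (C₂.drop u) ⊕ e₂) ⊖ e₁)
            ≈⟨ ≈-trans (sub ∂-linear _ _) (⊖-cong (≈-trans (add ∂-linear _ _) (⊕-cong q-sum ≈-refl)) ≈-refl) ⟩
          (-ₗ (∑ q₁ ⊕ ∑ q₂) ⊕ ∂ᴸ e₂) ⊖ ∂ᴸ e₁
            ≈⟨ Λ-solve 4 (λ q₁ q₂ e₁ e₂ → ((⊝ (q₁ :⊕ q₂)) :⊕ e₂) :⊕ (⊝ e₁)
                 :≈ q₁ :⊕ (⊝ ((q₂ :⊕ (⊝ e₂)) :⊕ (⊝ (q₁ :⊕ (⊝ e₁)))))) ≈-refl (∑ q₁) (∑ q₂) (∂ᴸ e₁) (∂ᴸ e₂) ⟩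
          ∑ q₁ ⊖ ((∑ q₂ ⊖ ∂ᴸ e₂) ⊕ (-ₗ (∑ q₁ ⊖ ∂ᴸ e₁)))
            ≈⟨ ⊖-cong (≈-sym (sum C₁.drop-linear _)) (⊕-cong (≈-sym Ŝ-first) (≈-sym Ŝ-second)) ⟩
          q̂ j ⊖ ((∑ λ b → ∑ λ d → e (mk b j) (aa b d u)) ⊕ (∑ λ b → ∑ λ d → e (mk d j) (aa b d u)))
            ≈⟨ ⊖-cong ≈-refl (≈-sym (≈-trans (∑-cong λ b → ∑-⊕ _ _) (∑-⊕ _ _))) ⟩
          q̂ j ⊖ Ŝ j ∎)

    bounds-columns : ∀ j → j ≢ c₁ → Bd (q̂ j ⊖ Ŝ j)
    bounds-columns j j≢c₁ = by-cases (j ≟F c₂) (j ∈ᶜ? E)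
      where
      trivial : (∀ d → a (mk d c₂) (W j) ≈ 𝟘) → Bd (q̂ j ⊖ Ŝ j)
      trivial z = bounds-𝟘 (⊖-zero (C₁.drop-zero (∑-zero z)) (terms-zero λ b d → null (a-linear _) (z d)))
      by-cases : Dec (j ≡ c₂) → Dec (j ∈ E) → Bd (q̂ j ⊖ Ŝ j)
      -- `W c₂` is not covered by `∂W-other`, but it avoids column `c₂`, so its `q̂` and `Ŝ` both
      -- vanish.
      by-cases (yes refl) _       = trivial (avoidCol-mk (good-W j) (here refl))
      by-cases (no _) (yes j∈)    = trivial (λ d → null (a-linear _) (avoidCol-mk good-w j∈ r))
      by-cases (no j≢c₂) (no j∉)  = Column.bounds-column
        (λ { (here eq) → j≢c₂ eq ; (there (here eq)) → j≢c₁ eq ; (there (there i)) → j∉ i }) (∂W-other j j≢c₁ j≢c₂)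

    module Pair {b d : Fin p} (b≢d : b ≢ d) (b∉ : b ∉ Dʳ) (d∉ : d ∉ Dʳ) where
      open RowSwap b d b≢d

      v T : Λ
      v = aa b d w₀
      T = ∑ λ j → e (mk b j) (aa b d (W j)) ⊕ e (mk d j) (aa b d (W j))

      -- The boundary of `v` is minus the sum of the `aa b d (W j)`, by `∂w₀`. Each of these is a
      -- cycle, so coning it from the edge `b j` restores it with the opposite sign and closes `v`
      -- up; this makes the antisymmetry applicable.
      cycle : Λ
      cycle = v ⊕ ∑ λ j → e (mk b j) (aa b d (W j))

      good-s : ∀ j → Good (b ∷ d ∷ Dʳ) (c₁ ∷ c₂ ∷ j ∷ E) s (aa b d (W j))
      good-s j = good-aa b d (good-W j)

      s-zero : ∀ {j} → j ∈ E₁₂ → aa b d (W j) ≈ 𝟘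
      s-zero {j} (here refl)         = null (a-linear _) (avoidCol-mk (good-W j) (here refl) d)
      s-zero {j} (there (here refl)) = aa-zero _ _ (alt (good-W j)) (null (a-linear _) (avoidCol-mk (good-W j) (here refl) b))
      s-zero {j} (there (there j∈))  = null (a-linear _) (null (a-linear _) (avoidCol-mk good-w j∈ r))

      good-cycle : Good Dʳ E₁₂ (suc s) cycle
      good-cycle = good-⊕ (good-col-swap (good-shrink (there ∘ there) id (good-aa b d good-w₀)))
        (good-∑ λ j → good-e-mk b j (λ i → contradiction i b∉) s-zero
          (good-shrink (λ { (here eq) → here eq ; (there i) → there (there i) })
            (λ { (here eq) → there (there (here eq)) ; (there (here eq)) → there (here eq)
               ; (there (there (here eq))) → here eq ; (there (there (there i))) → there (there (there i)) }) (good-s j)))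

      -- For `j = c₁` and `j = c₂` the boundary of `W j` is `y` up to sign; since `y` avoids both
      -- columns, the double contraction removes it.
      ∂s : ∀ j → ∂ᴸ (aa b d (W j)) ≈ 𝟘
      ∂s j = ≈-trans (≈-sym (aa-∂ _ _ (alt (good-W j)))) (≈-trans (resp (aa-linear b d) (∂W j))
        (≈-trans (neg (aa-linear b d) _) (≈𝟘⇒-≈𝟘 (≈-trans (resp (aa-linear b d) (sub (a-linear _) _ _))
        (≈-trans (sub (aa-linear b d) _ _) (⊖-zero (off c₁) (off c₂)))))))
        where
        off : ∀ c → aa b d (a (mk r j) (e (mk r c) y)) ≈ 𝟘
        off c = by-cases (j ≟F c)
          where
          by-cases : Dec (j ≡ c) → aa b d (a (mk r j) (e (mk r c) y)) ≈ 𝟘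
          by-cases (yes refl) = ≈-trans (resp (aa-linear b d) (ae-fix _ (row-y j)))
                                        (null (a-linear _) (avoidCol-mk good-y (here refl) d))
          by-cases (no j≢c) = null (aa-linear b d) (ae-zero _ _ (λ eq → contradiction eq (mk≢-col j≢c)) (row-y j))

      ∂cycle : ∂ᴸ cycle ≈ 𝟘
      ∂cycle = begin
        ∂ᴸ cycle
          ≈⟨ add ∂-linear _ _ ⟩
        ∂ᴸ v ⊕ ∂ᴸ (∑ λ j → e (mk b j) (aa b d (W j)))
          ≈⟨ ⊕-cong (≈-sym (aa-∂ _ _ (alt good-w₀))) (≈-trans (sum ∂-linear _) (∑-cong λ j →
               ≈-trans (∂e _ _) (⊖-identityʳ (null (e-linear _) (∂s j))))) ⟩
        aa b d (∂ᴸ w₀) ⊕ (∑ λ j → aa b d (W j))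
          ≈⟨ ⊕-cong (≈-trans (resp (aa-linear b d) ∂w₀) (neg (aa-linear b d) _)) (≈-sym (sum (aa-linear b d) W)) ⟩
        (-ₗ aa b d (∑ W)) ⊕ aa b d (∑ W)
          ≈⟨ ≈-trans (Λ-solve 1 (λ b → (⊝ b) :⊕ b :≈ b :⊕ (⊝ b)) ≈-refl _) (⊖-inverse ≈-refl) ⟩
        𝟘 ∎

      swap-cycle : swap cycle ≈ v ⊕ ∑ λ j → e (mk d j) (aa b d (W j))
      swap-cycle = ≈-trans (add swap-linear _ _) (⊕-cong
        (swap-fixes (avoidRow-mk (good-aa b d good-w₀) (here refl)) (avoidRow-mk (good-aa b d good-w₀) (there (here refl)))
                    (alt (good-aa b d good-w₀)))
        (≈-trans (sum swap-linear _) (∑-cong λ j → ≈-trans (swap-e _ _)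
          (subst (λ t → e (τᵛ (mk b j)) (swap (aa b d (W j))) ≈ e t (aa b d (W j)))
            (trans (τᵛ-mk b j) (cong (λ i → mk i j) τ-fst))
            (resp (e-linear _) (swap-fixes (avoidRow-mk (good-s j) (here refl)) (avoidRow-mk (good-s j) (there (here refl)))
                                           (alt (good-s j))))))))

      -- The swap fixes `v` and moves the cones from row `b` to row `d`, so the bounding sum is
      -- `2v + T`, which is `-(v - T)` in F₃.
      bounds-pair : Bd (cycle ⊕ swap cycle) → Bd (v ⊖ T)
      bounds-pair β = bounds-resp (begin
        -ₗ (cycle ⊕ swap cycle)
          ≈⟨ -ₗ-cong (⊕-cong ≈-refl swap-cycle) ⟩
        -ₗ ((v ⊕ _) ⊕ (v ⊕ _))
          ≈⟨ Λ-solve 3 (λ v b d → ⊝ ((v :⊕ b) :⊕ (v :⊕ d)) :≈ v :⊕ (⊝ (b :⊕ d))) ≈-refl v _ _ ⟩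
        v ⊖ (_ ⊕ _)
          ≈⟨ ⊖-cong ≈-refl (≈-sym (∑-⊕ _ _)) ⟩
        v ⊖ T ∎) (bounds-neg β)

    Antisymmetric : Set
    Antisymmetric = ∀ {b d} (b≢d : b ≢ d) → b ∉ Dʳ → d ∉ Dʳ → ∀ {x} →
      Good Dʳ E₁₂ (suc s) x → ∂ᴸ x ≈ 𝟘 → Bd (x ⊕ RowSwap.swap b d b≢d x)

    bounds-pairs : Antisymmetric → ∀ b d →
      Bd (aa b d w₀ ⊖ ∑ λ j → e (mk b j) (aa b d (W j)) ⊕ e (mk d j) (aa b d (W j)))
    bounds-pairs anti b d = by-cases (b ∈ʳ? Dʳ) (d ∈ʳ? Dʳ) (b ≟F d)
      where
      Goal : Set
      Goal = Bd (aa b d w₀ ⊖ ∑ λ j → e (mk b j) (aa b d (W j)) ⊕ e (mk d j) (aa b d (W j)))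
      trivial : (∀ {E k x} → Good Dʳ E k x → aa b d x ≈ 𝟘) → Goal
      trivial z = bounds-𝟘 (⊖-zero (z good-w₀) (∑-zero λ j →
        ⊕-zero (null (e-linear _) (z (good-W j))) (null (e-linear _) (z (good-W j)))))
      by-cases : Dec (b ∈ Dʳ) → Dec (d ∈ Dʳ) → Dec (b ≡ d) → Goal
      by-cases (yes b∈) _ _ = trivial λ g → aa-zero _ _ (alt g) (null (a-linear _) (avoidRow-mk g b∈ c₁))
      by-cases (no _) (yes d∈) _ = trivial λ g → null (a-linear _) (avoidRow-mk g d∈ c₂)
      by-cases (no _) (no _) (yes refl) = trivial λ g → conf-row b c₁ c₂ g
      by-cases (no b∉) (no d∉) (no b≢d) = bounds-pair (anti b≢d b∉ d∉ good-cycle ∂cycle)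
        where open Pair b≢d b∉ d∉

    -- By `q̂-sum` and `bounds-pairs`, the sum of all `q̂ j ⊖ Ŝ j` bounds. The terms with `j ≠ c₁`
    -- bound individually, hence so does the last one, where `Ŝ c₁` is zero because `W c₁` avoids
    -- `c₁`.
    bounds-y : Antisymmetric → Bd y
    bounds-y anti = y-from-q̂ (bounds-resp (⊖-identityʳ (terms-zero λ b d →
        aa-zero _ _ (alt (good-W c₁)) (null (a-linear _) (avoidCol-mk (good-W c₁) (here refl) b))))
      (bounds-term c₁ {λ j → q̂ j ⊖ Ŝ j} bounds-columns (bounds-resp (≈-sym total)
        (bounds-⊕ (bounds-∂ (good-col-swap (good-drop-col {c = c₁} (good-ann {c = c₂} good-w₀))))
                  (bounds-∑ λ b → bounds-∑ λ d → bounds-pairs anti b d)))))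
      where
      t : Fin p → Fin p → Fin q → Λ
      t b d j = e (mk b j) (aa b d (W j)) ⊕ e (mk d j) (aa b d (W j))
      total : ∑ (λ j → q̂ j ⊖ Ŝ j) ≈ ∂ᴸ (C₁.drop (C₂.ann w₀)) ⊕ (∑ λ b → ∑ λ d → aa b d w₀ ⊖ ∑ (t b d))
      total = begin
        ∑ (λ j → q̂ j ⊖ Ŝ j)
          ≈⟨ ∑-⊖ q̂ Ŝ ⟩
        ∑ q̂ ⊖ ∑ Ŝ
          ≈⟨ ⊖-cong q̂-sum (≈-trans (∑-swap _) (∑-cong λ b → ∑-swap _)) ⟩
        (∂ᴸ (C₁.drop (C₂.ann w₀)) ⊕ (∑ λ b → ∑ λ d → aa b d w₀)) ⊖ (∑ λ b → ∑ λ d → ∑ (t b d))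
          ≈⟨ Λ-solve 3 (λ b c d → (b :⊕ c) :⊕ (⊝ d) :≈ b :⊕ (c :⊕ (⊝ d))) ≈-refl _ _ _ ⟩
        ∂ᴸ (C₁.drop (C₂.ann w₀)) ⊕ ((∑ λ b → ∑ λ d → aa b d w₀) ⊖ (∑ λ b → ∑ λ d → ∑ (t b d)))
          ≈⟨ ⊕-cong ≈-refl (≈-sym (≈-trans (∑-cong λ b → ∑-⊖ _ _) (∑-⊖ _ _))) ⟩
        ∂ᴸ (C₁.drop (C₂.ann w₀)) ⊕ (∑ λ b → ∑ λ d → aa b d w₀ ⊖ ∑ (t b d)) ∎

  -- Connectivity: vanishing of homology below the bottom dimension ν

  Bound : ℕ → List (Fin p) → List (Fin q) → Set
  Bound s D E = s + length D ≤ p × s + length E ≤ q × s + s + s + length D + length E ≤ suc (p + q)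

  -- Descending by one degree pays for three deleted lines and by two degrees for six; the boards of
  -- `exact-step` delete three and at most four. The extra column is needed because two columns are
  -- deleted in degree `s + 1` and three in degree `s`.
  connectivity-step :
    (∀ D E → Bound s D E → Exact s D E) →
    (∀ D E → Bound (suc s) D E → Exact (suc s) D E) →
    ∀ D E → Bound (suc (suc s)) D E → suc (suc (suc s)) + length E ≤ q → Exact (suc (suc s)) D E
  connectivity-step {s} exact₀ exact₁ D E (rows , _ , total) cols =
    exact-step r∉ c₁∉ (c₂∉ ∘ there) (λ eq → c₂∉ (here (sym eq)))
      (λ b d → exact₀ _ _ (≤-trans (≤-reflexive (arith₀ s |D|)) rows
                          , ≤-trans (m≤n+m _ 1) (≤-trans (≤-reflexive (arith₁ s |E|)) cols)
                          , ≤-trans (m≤n+m _ 2) (≤-trans (≤-reflexive (arith₂ s |D| |E|)) total)))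
      (λ j → exact₁ _ _ bound₁) (λ j → exact₁ _ _ bound₁)
      (λ j → exact₀ _ _ (≤-trans (m≤n+m _ 1) (≤-trans (≤-reflexive (arith₃ s |D|)) rows)
                        , ≤-trans (≤-reflexive (arith₄ s |E|)) cols
                        , ≤-trans (m≤n+m _ 2) (≤-trans (≤-reflexive (arith₅ s |D| |E|)) total)))
      (exact₁ _ _ bound₁)
    where
    |D| = length D
    |E| = length E
    arith₀ : ∀ s D → s + (2 + D) ≡ 2 + s + D
    arith₀ = solve-∀
    arith₁ : ∀ s E → 1 + (s + (2 + E)) ≡ 3 + s + E
    arith₁ = solve-∀
    arith₂ : ∀ s D E → 2 + (s + s + s + (2 + D) + (2 + E)) ≡ (2 + s) + (2 + s) + (2 + s) + D + E
    arith₂ = solve-∀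
    arith₃ : ∀ s D → 1 + (s + (1 + D)) ≡ 2 + s + D
    arith₃ = solve-∀
    arith₄ : ∀ s E → s + (3 + E) ≡ 3 + s + E
    arith₄ = solve-∀
    arith₅ : ∀ s D E → 2 + (s + s + s + (1 + D) + (3 + E)) ≡ (2 + s) + (2 + s) + (2 + s) + D + E
    arith₅ = solve-∀
    arith₆ : ∀ s D → 1 + s + (1 + D) ≡ 2 + s + D
    arith₆ = solve-∀
    arith₇ : ∀ s E → 1 + s + (2 + E) ≡ 3 + s + E
    arith₇ = solve-∀
    arith₈ : ∀ s D E → (1 + s) + (1 + s) + (1 + s) + (1 + D) + (2 + E) ≡ (2 + s) + (2 + s) + (2 + s) + D + E
    arith₈ = solve-∀
    bound₁ = ≤-trans (≤-reflexive (arith₆ s |D|)) rows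
           , ≤-trans (≤-reflexive (arith₇ s |E|)) cols
           , ≤-trans (≤-reflexive (arith₈ s |D| |E|)) total
    fresh-r = fresh D (≤-trans (s≤s (m≤n+m |D| (suc s))) rows)
    r∉ = proj₂ fresh-r
    fresh-c₁ = fresh E (≤-trans (s≤s (m≤n+m |E| (suc (suc s)))) cols)
    c₁∉ = proj₂ fresh-c₁
    fresh-c₂ = fresh (proj₁ fresh-c₁ ∷ E) (≤-trans (s≤s (s≤s (m≤n+m |E| (suc s)))) cols)
    c₂∉ = proj₂ fresh-c₂

  exact-zero : Exact 0 D E
  exact-zero g _ = 𝟘 , good-𝟘 , ≈-trans (null ∂-linear ≈-refl) (≈-sym (deg-zero (deg g)))

  -- In degree 1 a chain is a multiple of the empty word, so any edge of the board will do as apex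
  -- of a cone.
  exact-one : length D < p → length E < q → Exact 1 D E
  exact-one {D} {E} rows cols {x} g z = e (mk r c) x
    , good-e-mk r c (λ i → contradiction i r∉) (λ i → contradiction i c∉)
        (good-∷ʳ (λ j → isolated) (good-∷ᶜ (λ i → isolated) g))
    , ≈-trans (∂e _ x) (⊖-identityʳ (null (e-linear _) z))
    where
    r = proj₁ (fresh D rows)
    r∉ = proj₂ (fresh D rows)
    c = proj₁ (fresh E cols)
    c∉ = proj₂ (fresh E cols)
    isolated : ∀ {u} → a u x ≈ 𝟘
    isolated = deg-zero (deg-a _ (deg g))

-- The chessboard and its transpose

_≟V_ : ∀ {p q} → DecidableEquality (V p q)
_≟V_ = ×-≡-dec _≟F_ _≟F_

module Chessboard (p q : ℕ) where
  open Words (_≟V_ {p} {q}) public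
  open Board (_≟V_ {p} {q}) p q proj₁ proj₂ _,_ (λ _ _ → refl) (λ _ _ → refl) (λ _ → refl) public

  -- Both instances have the vertex type `V p q`, so a chain of the transposed board is the same
  -- function; only the order of summation in the boundary differs.
  module T where
    open Board (_≟V_ {p} {q}) q p proj₂ proj₁ (λ j i → i , j) (λ _ _ → refl) (λ _ _ → refl) (λ _ → refl) public
      
  private variable
    D : List (Fin p)
    E : List (Fin q)
    s : ℕ
    x : Λ

  ∂-transpose : ∀ x → ∂ᴸ x ≈ T.∂ᴸ x
  ∂-transpose x = ∑-swap _

  good-transpose : Good D E s x → T.Good E D s x
  good-transpose g = record
    { alt = alt g ; deg = deg g ; conf = λ c → conf g (Sum.swap c)
    ; avoidRow = avoidCol g ; avoidCol = avoidRow g }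

  good-untranspose : T.Good E D s x → Good D E s x
  good-untranspose g = record
    { alt = T.alt g ; deg = T.deg g ; conf = λ c → T.conf g (Sum.swap c)
    ; avoidRow = T.avoidCol g ; avoidCol = T.avoidRow g }

  exact-transpose : Exact s D E → T.Exact s E D
  exact-transpose exact g z =
    let w , gw , ∂w = exact (good-untranspose g) (≈-trans (∂-transpose _) z)
    in w , good-transpose gw , ≈-trans (≈-sym (∂-transpose w)) ∂w

  exact-untranspose : T.Exact s E D → Exact s D E
  exact-untranspose exact g z =
    let w , gw , ∂w = exact (good-transpose g) (≈-trans (≈-sym (∂-transpose _)) z)
    in w , good-untranspose gw , ≈-trans (∂-transpose w) ∂w

  bound-transpose : Bound s D E → T.Bound s E D
  bound-transpose {s} {D} {E} (rows , cols , total) = cols , rows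
    , ≤-trans (≤-reflexive (arith s (length E) (length D))) (≤-trans total (≤-reflexive (cong suc (+-comm p q))))
    where
    arith : ∀ s E D → s + s + s + E + D ≡ s + s + s + D + E
    arith = solve-∀

  bound-untranspose : T.Bound s E D → Bound s D E
  bound-untranspose {s} {E} {D} (cols , rows , total) = rows , cols
    , ≤-trans (≤-reflexive (arith s (length D) (length E))) (≤-trans total (≤-reflexive (cong suc (+-comm q p))))
    where
    arith : ∀ s E D → s + s + s + E + D ≡ s + s + s + D + E
    arith = solve-∀

  connectivity-rec :
    (∀ D E → Bound s D E → Exact s D E) →
    (∀ D E → Bound (suc s) D E → Exact (suc s) D E) →
    ∀ D E → Bound (suc (suc s)) D E → Exact (suc (suc s)) D E
  connectivity-rec {s} exact₀ exact₁ D E bound@(rows , cols , total) = by-cases (suc (suc (suc s)) + length E ≤? q)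
    where
    by-cases : Dec (suc (suc (suc s)) + length E ≤ q) → Exact (suc (suc s)) D E
    by-cases (yes cols⁺) = connectivity-step exact₀ exact₁ D E bound cols⁺
    by-cases (no cols-tight) = exact-untranspose (T.connectivity-step
      (λ E′ D′ b → exact-transpose (exact₀ D′ E′ (bound-untranspose {s} {E′} {D′} b)))
      (λ E′ D′ b → exact-transpose (exact₁ D′ E′ (bound-untranspose {suc s} {E′} {D′} b)))
      E D (bound-transpose {suc (suc s)} {D} {E} bound) rows⁺)
      where
      -- With exactly `s + 2` columns left, the bound on the sum forces at least `2s + 3` rows to be
      -- left, so the step applies after transposition.
      q≡ : q ≡ suc (suc s) + length E
      q≡ = ≤-antisym (≤-pred (≰⇒> cols-tight)) cols
      arith : ∀ s D E → (2 + s + E + 1) + (3 + s + D + s) ≡ (2 + s) + (2 + s) + (2 + s) + D + E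
      arith = solve-∀
      arith′ : ∀ p c → suc (p + c) ≡ (c + 1) + p
      arith′ = solve-∀
      rows⁺ : suc (suc (suc s)) + length D ≤ p
      rows⁺ = ≤-trans (m≤m+n _ s) (+-cancelˡ-≤ (suc (suc s) + length E + 1) _ _
        (≤-trans (≤-reflexive (arith s (length D) (length E))) (≤-trans total (≤-reflexive
          (trans (cong (λ c → suc (p + c)) q≡) (arith′ p (suc (suc s) + length E)))))))

  -- With `m ≤ n` rows and columns left, `Bound` reads `s ≤ min(m, ⌊(m+n+1)/3⌋)`, that is, dimension
  -- `s - 2` lies below `ν m n`. The lists may contain repetitions: their lengths then overcount the
  -- deleted lines, which only strengthens `Bound`. This lets a deleted line range over all indices
  -- without case distinctions.
  connectivity : ∀ s D E → Bound s D E → Exact s D E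
  connectivity zero D E _ = exact-zero
  connectivity (suc zero) D E (rows , cols , _) = exact-one rows cols
  connectivity (suc (suc s)) = connectivity-rec (connectivity s) (connectivity (suc s))

-- The twin map in the critical degree

module TwinHomology {p q : ℕ} {r : Fin p} {c₁ c₂ : Fin q} (c₁≢c₂ : c₁ ≢ c₂) {k : ℕ}
  (rows : suc k + 3 ≤ p) (cols : suc k + 4 ≤ q) (total : suc k + suc k + suc k + 5 ≤ suc (p + q)) where
  open Chessboard p q

  private
    d : ℕ
    d = suc k

    total-as : ∀ {n} → n ≡ suc k + suc k + suc k + 5 → n ≤ suc (p + q)
    total-as eq = ≤-trans (≤-reflexive eq) total

    rows-as : ∀ {n} j → j + n ≡ suc k + 3 → n ≤ p
    rows-as j eq = ≤-trans (m≤n+m _ j) (≤-trans (≤-reflexive eq) rows)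

    cols-as : ∀ {n} j → j + n ≡ suc k + 4 → n ≤ q
    cols-as j eq = ≤-trans (m≤n+m _ j) (≤-trans (≤-reflexive eq) cols)

  ∉[] : ∀ {n} {i : Fin n} → i ∉ []
  ∉[] ()

  -- The bound `d + 3 ≤ p` comes from the pair fillings, which delete three rows in degree `d`. Both
  -- families of boards meet the bound on the sum exactly at `3d + 5`.
  surjective : ∀ {x} → Good [] [] (suc (suc d)) x → ∂ᴸ x ≈ 𝟘 →
    ∃₂ λ w y → Good [] [] (suc (suc (suc d))) w × Good (r ∷ []) (c₂ ∷ c₁ ∷ []) (suc d) y × ∂ᴸ y ≈ 𝟘
             × x ≈ ∂ᴸ w ⊕ twin r c₁ c₂ y
  surjective = twin-surjective ∉[] ∉[] ∉[] c₁≢c₂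
    (λ j → connectivity _ _ _ (rows-as 1 (row-eq₁ k) , cols-as 2 (col-eq₁ k) , total-as (total-eq₁ k)))
    (λ b e → connectivity _ _ _ (rows-as 0 refl , cols-as 2 (col-eq₂ k) , total-as (total-eq₂ k)))
    where
    row-eq₁ : ∀ k → 1 + (suc (suc k) + 1) ≡ suc k + 3
    row-eq₁ = solve-∀
    col-eq₁ : ∀ k → 2 + (suc (suc k) + 1) ≡ suc k + 4
    col-eq₁ = solve-∀
    total-eq₁ : ∀ k → suc (suc k) + suc (suc k) + suc (suc k) + 1 + 1 ≡ suc k + suc k + suc k + 5
    total-eq₁ = solve-∀
    col-eq₂ : ∀ k → 2 + (suc k + 2) ≡ suc k + 4
    col-eq₂ = solve-∀
    total-eq₂ : ∀ k → suc k + suc k + suc k + 3 + 2 ≡ suc k + suc k + suc k + 5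
    total-eq₂ = solve-∀

  -- Surjectivity one degree lower, on the transposed board: a column `c` plays the part of `r`, and
  -- the rows `b` and `e` that of the two columns. Its pair fillings bring the number of deleted
  -- columns to five in degree `k`, the origin of `suc k + 4 ≤ q`.
  antisymmetric : ∀ {b e} (b≢e : b ≢ e) → b ∉ r ∷ [] → e ∉ r ∷ [] → ∀ {x} →
    Good (r ∷ []) (c₂ ∷ c₁ ∷ []) (suc d) x → ∂ᴸ x ≈ 𝟘 →
    Bounds (suc d) (r ∷ []) (c₂ ∷ c₁ ∷ []) (x ⊕ RowSwap.swap b e b≢e x)
  antisymmetric {b} {e} b≢e b∉ e∉ {x} g z =
    RowSwap.swap-negates b e b≢e {w = w} {y = y} {c = c} b∉ e∉ (good-untranspose good-w)
      (λ j → T.avoidCol good-y (there (here refl))) (λ j → T.avoidCol good-y (here refl)) (T.alt good-y)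
      (≈-trans x≈ (⊕-cong (≈-sym (∂-transpose w)) ≈-refl))
    where
    free-column = fresh (c₂ ∷ c₁ ∷ []) (cols-as (suc k + 1) (arith k))
      where
      arith : ∀ k → (suc k + 1) + 3 ≡ suc k + 4
      arith = solve-∀
    c : Fin q
    c = proj₁ free-column
    c∉ : c ∉ c₂ ∷ c₁ ∷ []
    c∉ = proj₂ free-column
    row-eq₁ : ∀ k → 1 + (suc k + 2) ≡ suc k + 3
    row-eq₁ = solve-∀
    col-eq₁ : ∀ k → 1 + (suc k + 3) ≡ suc k + 4
    col-eq₁ = solve-∀
    total-eq₁ : ∀ k → suc k + suc k + suc k + 2 + 3 ≡ suc k + suc k + suc k + 5
    total-eq₁ = solve-∀
    col-eq₂ : ∀ k → k + 5 ≡ suc k + 4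
    col-eq₂ = solve-∀
    total-eq₂ : ∀ k → k + k + k + 3 + 5 ≡ suc k + suc k + suc k + 5
    total-eq₂ = solve-∀
    exact₁ : ∀ i → T.Exact (suc k) (c ∷ c₂ ∷ c₁ ∷ []) (i ∷ r ∷ [])
    exact₁ i = exact-transpose (connectivity (suc k) (i ∷ r ∷ []) (c ∷ c₂ ∷ c₁ ∷ [])
      (rows-as 1 (row-eq₁ k) , cols-as 1 (col-eq₁ k) , total-as (total-eq₁ k)))
    exact₂ : ∀ j j′ → T.Exact k (j′ ∷ j ∷ c ∷ c₂ ∷ c₁ ∷ []) (e ∷ b ∷ r ∷ [])
    exact₂ j j′ = exact-transpose (connectivity k (e ∷ b ∷ r ∷ []) (j′ ∷ j ∷ c ∷ c₂ ∷ c₁ ∷ [])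
      (rows-as 1 refl , cols-as 0 (col-eq₂ k) , total-as (total-eq₂ k)))
    twin-shape : ∃₂ λ w y → T.Good (c₂ ∷ c₁ ∷ []) (r ∷ []) (suc (suc d)) w × T.Good (c ∷ c₂ ∷ c₁ ∷ []) (e ∷ b ∷ r ∷ []) d y
                         × T.∂ᴸ y ≈ 𝟘 × x ≈ T.∂ᴸ w ⊕ T.twin c b e y
    twin-shape = T.twin-surjective c∉ b∉ e∉ b≢e exact₁ exact₂ (good-transpose g) (≈-trans (≈-sym (∂-transpose x)) z)
    w y : Λ
    w = proj₁ twin-shape
    y = proj₁ (proj₂ twin-shape)
    good-w : T.Good (c₂ ∷ c₁ ∷ []) (r ∷ []) (suc (suc d)) w
    good-w = proj₁ (proj₂ (proj₂ twin-shape))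
    good-y : T.Good (c ∷ c₂ ∷ c₁ ∷ []) (e ∷ b ∷ r ∷ []) d y
    good-y = proj₁ (proj₂ (proj₂ (proj₂ twin-shape)))
    x≈ : x ≈ T.∂ᴸ w ⊕ T.twin c b e y
    x≈ = proj₂ (proj₂ (proj₂ (proj₂ (proj₂ twin-shape))))

  injective : ∀ {w y} → Good [] [] (suc (suc (suc d))) w → Good (r ∷ []) (c₂ ∷ c₁ ∷ []) (suc d) y →
    ∂ᴸ w ≈ twin r c₁ c₂ y → Bounds (suc d) (r ∷ []) (c₂ ∷ c₁ ∷ []) y
  injective gw gy ∂w = TwinCycle.bounds-y c₁≢c₂ gw gy ∂w antisymmetric

-- Comparison with the chains of Defs

ΣF-neg : ∀ k (f : Fin k → F3) → ΣF k (λ i → -F f i) ≡ -F ΣF k f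
ΣF-neg zero    f = refl
ΣF-neg (suc k) f = trans (cong ((-F f fz) +F_) (ΣF-neg k (f ∘ fs)))
  (solve 2 (λ c d → (:- c) :+ (:- d) := :- (c :+ d)) refl (f fz) (ΣF k (f ∘ fs)))

sgn-ΣF : ∀ {l} (i : Fin l) k (f : Fin k → F3) → sgn i (ΣF k f) ≡ ΣF k (λ j → sgn i (f j))
sgn-ΣF fz     k f = refl
sgn-ΣF (fs i) k f = trans (cong -F_ (sgn-ΣF i k f)) (sym (ΣF-neg k (λ j → sgn i (f j))))

sgn-+ : ∀ {l} (i : Fin l) c d → sgn i (c +F d) ≡ sgn i c +F sgn i d
sgn-+ fz     c d = refl
sgn-+ (fs i) c d = trans (cong -F_ (sgn-+ i c d))
  (solve 2 (λ c d → :- (c :+ d) := (:- c) :+ (:- d)) refl (sgn i c) (sgn i d))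

sgn-zero : ∀ {l} (i : Fin l) {c} → c ≡ 0F → sgn i c ≡ 0F
sgn-zero fz     eq = eq
sgn-zero (fs i) eq = cong -F_ (sgn-zero i eq)

sgn-neg : ∀ {l} (i : Fin l) c → sgn i (-F c) ≡ -F sgn i c
sgn-neg fz     c = refl
sgn-neg (fs i) c = cong -F_ (sgn-neg i c)

module _ {m n : ℕ} where

  -- Contraction in terms of sorted chains: if `c` is supported on sorted faces, at most one place
  -- of insertion contributes. Summed over all `v` it is the boundary, see `∂-contract`.
  contract : ∀ {k} → V m n → Cochain m n (suc k) → Cochain m n k
  contract {k} v c σ = ΣF (suc k) (λ i → sgn i (c (insertAt σ i v)))

  contract-[] : ∀ v (c : Cochain m n 1) → contract v c [] ≡ c (v ∷ [])
  contract-[] v c = +F-identityʳ _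

  contract-∷ : ∀ {k} v (c : Cochain m n (suc (suc k))) u τ →
    contract v c (u ∷ τ) ≡ c (v ∷ u ∷ τ) +F (-F contract v (λ ρ → c (u ∷ ρ)) τ)
  contract-∷ {k} v c u τ = cong (c (v ∷ u ∷ τ) +F_) (ΣF-neg (suc k) (λ i → sgn i (c (u ∷ insertAt τ i v))))

  contract-cong : ∀ {k} v {c c′ : Cochain m n (suc k)} → c ≐ c′ → contract v c ≐ contract v c′
  contract-cong {k} v eq σ = ΣF-cong (suc k) λ i → cong (sgn i) (eq (insertAt σ i v))

  contract-zero : ∀ {k} v {c : Cochain m n (suc k)} → c ≐ zeroC → contract v c ≐ zeroC
  contract-zero {k} v eq σ = ΣF-zero (suc k) λ i → sgn-zero i (eq (insertAt σ i v))

  contract-+ : ∀ {k} v (c c′ : Cochain m n (suc k)) → contract v (c +C c′) ≐ (contract v c +C contract v c′)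
  contract-+ {k} v c c′ σ = trans (ΣF-cong (suc k) λ i → sgn-+ i (c (insertAt σ i v)) (c′ (insertAt σ i v)))
    (ΣF-+ (suc k) (λ i → sgn i (c (insertAt σ i v))) (λ i → sgn i (c′ (insertAt σ i v))))

  contract-neg : ∀ {k} v (c : Cochain m n (suc k)) σ → contract v (λ ρ → -F c ρ) σ ≡ -F contract v c σ
  contract-neg {k} v c σ = trans (ΣF-cong (suc k) (λ i → sgn-neg i (c (insertAt σ i v))))
    (ΣF-neg (suc k) (λ i → sgn i (c (insertAt σ i v))))

  -- Any two places receive `u` and `v` in either order of insertion, and exchanging the order
  -- shifts one index by one and so flips the sign. The induction peels off the first letter of `σ`.
  contract-anti : ∀ {k} u v (c : Cochain m n (suc (suc k))) σ →
    contract u (contract v c) σ ≡ -F contract v (contract u c) σ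
  contract-anti u v c [] = trans (expand u v) (trans
    (solve 2 (λ x y → x :+ (:- y) := :- (y :+ (:- x))) refl (c (v ∷ u ∷ [])) (c (u ∷ v ∷ [])))
    (cong -F_ (sym (expand v u))))
    where
    expand : ∀ u v → contract u (contract v c) [] ≡ c (v ∷ u ∷ []) +F (-F c (u ∷ v ∷ []))
    expand u v = trans (contract-[] u (contract v c)) (trans (contract-∷ v c u [])
      (cong (λ d → c (v ∷ u ∷ []) +F (-F d)) (contract-[] v (λ ρ → c (u ∷ ρ)))))
  contract-anti {suc k} u v c (w ∷ τ) = trans (expand u v) (trans
    (solve 5 (λ x y p q r → (x :+ (:- (y :+ (:- p)))) :+ (:- (q :+ (:- (:- r))))
                          := :- ((y :+ (:- (x :+ (:- q)))) :+ (:- (p :+ (:- r))))) refl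
      (c (v ∷ u ∷ w ∷ τ)) (c (u ∷ v ∷ w ∷ τ)) (contract v (λ ρ → c (u ∷ w ∷ ρ)) τ)
      (contract u (λ ρ → c (v ∷ w ∷ ρ)) τ) (contract v (contract u (λ ρ → c (w ∷ ρ))) τ))
    (cong -F_ (sym (expand′ v u))))
    where
    expand′ : ∀ u v → contract u (contract v c) (w ∷ τ)
      ≡ (c (v ∷ u ∷ w ∷ τ) +F (-F (c (u ∷ v ∷ w ∷ τ) +F (-F contract v (λ ρ → c (u ∷ w ∷ ρ)) τ))))
        +F (-F (contract u (λ ρ → c (v ∷ w ∷ ρ)) τ +F (-F contract u (contract v (λ ρ → c (w ∷ ρ))) τ)))
    expand′ u v = trans (contract-∷ u (contract v c) w τ) (cong₂ (λ x y → x +F (-F y))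
      (trans (contract-∷ v c u (w ∷ τ)) (cong (λ x → c (v ∷ u ∷ w ∷ τ) +F (-F x)) (contract-∷ v (λ ρ → c (u ∷ ρ)) w τ)))
      (trans (contract-cong u (λ ρ → contract-∷ v c w ρ) τ) (trans (contract-+ u (λ ρ → c (v ∷ w ∷ ρ)) (λ ρ → -F contract v (λ ρ′ → c (w ∷ ρ′)) ρ) τ)
        (cong (contract u (λ ρ → c (v ∷ w ∷ ρ)) τ +F_) (contract-neg u (contract v (λ ρ → c (w ∷ ρ))) τ)))))
    expand : ∀ u v → contract u (contract v c) (w ∷ τ)
      ≡ (c (v ∷ u ∷ w ∷ τ) +F (-F (c (u ∷ v ∷ w ∷ τ) +F (-F contract v (λ ρ → c (u ∷ w ∷ ρ)) τ))))
        +F (-F (contract u (λ ρ → c (v ∷ w ∷ ρ)) τ +F (-F (-F contract v (contract u (λ ρ → c (w ∷ ρ))) τ))))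
    expand u v = trans (expand′ u v) (cong
      (λ x → (c (v ∷ u ∷ w ∷ τ) +F (-F (c (u ∷ v ∷ w ∷ τ) +F (-F contract v (λ ρ → c (u ∷ w ∷ ρ)) τ))))
             +F (-F (contract u (λ ρ → c (v ∷ w ∷ ρ)) τ +F (-F x))))
      (contract-anti u v (λ ρ → c (w ∷ ρ)) τ))

  ∂-contract : ∀ {k} (c : Cochain m n (suc k)) σ → ∂ c σ ≡ ΣF m (λ i → ΣF n (λ j → contract (i , j) c σ))
  ∂-contract {k} c σ = begin
    ∂ c σ
      ≡⟨ ΣF-cong (suc k) (λ l → trans (sgn-ΣF l m (λ i → ΣF n λ j → c (insertAt σ l (i , j)))) (ΣF-cong m λ i → sgn-ΣF l n (λ j → c (insertAt σ l (i , j))))) ⟩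
    ΣF (suc k) (λ l → ΣF m (λ i → ΣF n (λ j → sgn l (c (insertAt σ l (i , j))))))
      ≡⟨ ΣF-swap (suc k) m (λ l i → ΣF n λ j → sgn l (c (insertAt σ l (i , j)))) ⟩
    ΣF m (λ i → ΣF (suc k) (λ l → ΣF n (λ j → sgn l (c (insertAt σ l (i , j))))))
      ≡⟨ ΣF-cong m (λ i → ΣF-swap (suc k) n (λ l j → sgn l (c (insertAt σ l (i , j))))) ⟩
    ΣF m (λ i → ΣF n (λ j → contract (i , j) c σ)) ∎
    where open ≡-Reasoning

  Clash : V m n → V m n → Set
  Clash u v = proj₁ u ≡ proj₁ v ⊎ proj₂ u ≡ proj₂ v

  face-clash : ∀ {k} {σ : Vec (V m n) k} → IsFace σ → ∀ i j → i ≢ j → ¬ Clash (lookup σ i) (lookup σ j)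
  face-clash face i j i≢j clash = by-order (<-cmp (toℕ i) (toℕ j))
    where
    by-order : _ → _
    by-order (tri< i<j _ _) = [ proj₁ (proj₂ (face i j i<j)) , proj₂ (proj₂ (face i j i<j)) ]′ clash
    by-order (tri≈ _ eq _)  = i≢j (toℕ-injective eq)
    by-order (tri> _ _ j<i) = [ proj₁ (proj₂ (face j i j<i)) ∘ sym , proj₂ (proj₂ (face j i j<i)) ∘ sym ]′ clash

  contract-clash : ∀ {k} {c : Cochain m n (suc (suc k))} → IsChain c → ∀ {u v} → Clash u v →
    contract u (contract v c) ≐ zeroC
  contract-clash {k} {c} chain {u} {v} clash σ = ΣF-zero (suc k) λ i → sgn-zero i (ΣF-zero (suc (suc k)) λ j →
    sgn-zero j (chain (insertAt (insertAt σ i u) j v) λ face → face-clash {σ = insertAt (insertAt σ i u) j v} face (punchIn j i) j (punchInᵢ≢i j i)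
      (subst₂ Clash (sym (trans (insertAt-punchIn (insertAt σ i u) j v i) (insertAt-lookup σ i u)))
                    (sym (insertAt-lookup (insertAt σ i u) j v)) clash)))

  -- Lexicographic order and distinct rows together amount to strictly increasing rows. Distinctness
  -- of columns is left to the `conf` condition of the chains; the lower bound `ℓ` makes the notion
  -- inductive.
  data Inc (ℓ : ℕ) : ∀ {k} → Vec (V m n) k → Set where
    []  : Inc ℓ []
    _∷_ : ∀ {k v} {τ : Vec (V m n) k} → ℓ ≤ toℕ (proj₁ v) → Inc (suc (toℕ (proj₁ v))) τ → Inc ℓ (v ∷ τ)

  inc-weaken : ∀ {ℓ ℓ′ k} {τ : Vec (V m n) k} → ℓ ≤ ℓ′ → Inc ℓ′ τ → Inc ℓ τ
  inc-weaken ℓ≤ []      = []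
  inc-weaken ℓ≤ (h ∷ t) = ≤-trans ℓ≤ h ∷ t

  inc? : ∀ ℓ {k} (τ : Vec (V m n) k) → Dec (Inc ℓ τ)
  inc? ℓ []      = yes []
  inc? ℓ (v ∷ τ) = by-cases (ℓ ≤? toℕ (proj₁ v)) (inc? (suc (toℕ (proj₁ v))) τ)
    where
    by-cases : Dec (ℓ ≤ toℕ (proj₁ v)) → Dec (Inc (suc (toℕ (proj₁ v))) τ) → Dec (Inc ℓ (v ∷ τ))
    by-cases (yes h) (yes t) = yes (h ∷ t)
    by-cases (no h)  _       = no λ { (h′ ∷ _) → h h′ }
    by-cases _       (no t)  = no λ { (_ ∷ t′) → t t′ }

  face-inc : ∀ {k} {σ : Vec (V m n) k} ℓ → IsFace σ → (∀ i → ℓ ≤ toℕ (proj₁ (lookup σ i))) → Inc ℓ σ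
  face-inc {σ = []}    ℓ face above = []
  face-inc {σ = v ∷ τ} ℓ face above = above fz ∷ face-inc _ (λ i j i<j → face (fs i) (fs j) (s≤s i<j)) below
    where
    below : ∀ i → suc (toℕ (proj₁ v)) ≤ toℕ (proj₁ (lookup τ i))
    below i with face fz (fs i) (s≤s z≤n)
    ... | inj₁ lt , _         = lt
    ... | inj₂ (eq , _) , ≢ , _ = contradiction eq ≢

  inc-insertAt : ∀ {ℓ k} (σ : Vec (V m n) k) i v → Inc ℓ (insertAt σ i v) → Inc ℓ σ × ℓ ≤ toℕ (proj₁ v)
  inc-insertAt σ       fz     v (h ∷ t) = inc-weaken (≤-trans h (n≤1+n _)) t , h
  inc-insertAt (u ∷ σ) (fs i) v (h ∷ t) =
    let t′ , u<v = inc-insertAt σ i v t in h ∷ t′ , ≤-trans h (≤-trans (n≤1+n _) u<v)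

-- Subboards, and the alternating extension of a sorted chain

record Embedding (m p : ℕ) : Set where
  field
    to      : Fin m → Fin p
    from    : Fin p → Maybe (Fin m)
    from-to : ∀ i → from (to i) ≡ just i
    to-from : ∀ {j i} → from j ≡ just i → to i ≡ j
    -- This makes the boundary of the ambient board agree with that of the subboard on chains
    -- supported there.
    ΣF-to   : ∀ {h : Fin p → F3} → (∀ j → from j ≡ nothing → h j ≡ 0F) → ΣF p h ≡ ΣF m (h ∘ to)
open Embedding

identity : ∀ p → Embedding p p
identity p = record { to = id ; from = just ; from-to = λ i → refl ; to-from = sym ∘ just-injective ; ΣF-to = λ _ → refl }

shift : ∀ {m p} → Embedding m p → Embedding m (suc p)
shift {m} {p} ε = record
  { to = fs ∘ to ε
  ; from = from′
  ; from-to = from-to ε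
  ; to-from = λ { {fz} () ; {fs j} eq → cong fs (to-from ε eq) }
  ; ΣF-to = λ {h} off → trans (cong (_+F ΣF p (h ∘ fs)) (off fz refl))
                              (trans (+F-identityˡ _) (ΣF-to ε (λ j → off (fs j))))
  }
  where
  from′ : Fin (suc p) → Maybe (Fin m)
  from′ fz     = nothing
  from′ (fs j) = from ε j

-- A cochain c supported on faces extends to the alternating function K c. Here (m, n) is the board
-- obtained from the ambient one by deleting the rows D and the columns E, the complement of the image.
module Translation {m n p q : ℕ} (ρ : Embedding m p) (γ : Embedding n q) {D : List (Fin p)} {E : List (Fin q)}
  (D-off : ∀ {i} → i ∈ D → from ρ i ≡ nothing) (off-D : ∀ {i} → from ρ i ≡ nothing → i ∈ D)
  (E-off : ∀ {j} → j ∈ E → from γ j ≡ nothing) (off-E : ∀ {j} → from γ j ≡ nothing → j ∈ E) where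
  open Chessboard p q

  toV : V m n → V p q
  toV (i , j) = to ρ i , to γ j

  fromV : V p q → Maybe (V m n)
  fromV (i , j) = zip (from ρ i) (from γ j)

  fromV-toV : ∀ v → fromV (toV v) ≡ just v
  fromV-toV (i , j) = cong₂ zip (from-to ρ i) (from-to γ j)

  data Image (v : V p q) : Set where
    outside : fromV v ≡ nothing → (from ρ (proj₁ v) ≡ nothing ⊎ from γ (proj₂ v) ≡ nothing) → Image v
    inside  : ∀ v′ → fromV v ≡ just v′ → toV v′ ≡ v → Image v

  image : ∀ v → Image v
  image (i , j) = by-cases (from ρ i) (from γ j) refl refl
    where
    by-cases : ∀ x y → from ρ i ≡ x → from γ j ≡ y → Image (i , j)
    by-cases (just i′) (just j′) eq eq′ = inside (i′ , j′) (cong₂ zip eq eq′) (cong₂ _,_ (to-from ρ eq) (to-from γ eq′))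
    by-cases nothing   y         eq eq′ = outside (cong₂ zip eq eq′) (inj₁ eq)
    by-cases (just i′) nothing   eq eq′ = outside (cong₂ zip eq eq′) (inj₂ eq′)

  -- A word is evaluated by contracting with its letters one after the other. Alternation thus
  -- becomes `contract-anti`, compatibility with the boundary becomes `∂-contract`, and no
  -- permutation ever has to be sorted.
  Kᶜ : ∀ {k} → Cochain m n k → List (V p q) → F3
  Kᶜ {zero}  c []      = c []
  Kᶜ {zero}  c (_ ∷ _) = 0F
  Kᶜ {suc k} c []      = 0F
  Kᶜ {suc k} c (v ∷ σ) = maybe (λ v′ → Kᶜ (contract v′ c) σ) 0F (fromV v)

  K : ∀ {k} → Cochain m n k → Λ
  K c ⟨ σ ⟩ = Kᶜ c σ

  Kᶜ-cong : ∀ {k} {c c′ : Cochain m n k} → c ≐ c′ → ∀ σ → Kᶜ c σ ≡ Kᶜ c′ σ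
  Kᶜ-cong {zero}  eq []      = eq []
  Kᶜ-cong {zero}  eq (_ ∷ _) = refl
  Kᶜ-cong {suc k} eq []      = refl
  Kᶜ-cong {suc k} eq (v ∷ σ) with fromV v
  ... | nothing = refl
  ... | just v′ = Kᶜ-cong (contract-cong v′ eq) σ

  Kᶜ-zero : ∀ {k} {c : Cochain m n k} → c ≐ zeroC → ∀ σ → Kᶜ c σ ≡ 0F
  Kᶜ-zero {zero}  eq []      = eq []
  Kᶜ-zero {zero}  eq (_ ∷ _) = refl
  Kᶜ-zero {suc k} eq []      = refl
  Kᶜ-zero {suc k} eq (v ∷ σ) with fromV v
  ... | nothing = refl
  ... | just v′ = Kᶜ-zero (contract-zero v′ eq) σ

  Kᶜ-+ : ∀ {k} (c c′ : Cochain m n k) σ → Kᶜ (c +C c′) σ ≡ Kᶜ c σ +F Kᶜ c′ σ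
  Kᶜ-+ {zero}  c c′ []      = refl
  Kᶜ-+ {zero}  c c′ (_ ∷ _) = refl
  Kᶜ-+ {suc k} c c′ []      = refl
  Kᶜ-+ {suc k} c c′ (v ∷ σ) with fromV v
  ... | nothing = refl
  ... | just v′ = trans (Kᶜ-cong (contract-+ v′ c c′) σ) (Kᶜ-+ (contract v′ c) (contract v′ c′) σ)

  K-cong : ∀ {k} {c c′ : Cochain m n k} → c ≐ c′ → K c ≈ K c′
  K-cong eq = pointwise (Kᶜ-cong eq)

  K-zero : ∀ {k} {c : Cochain m n k} → c ≐ zeroC → K c ≈ 𝟘
  K-zero eq = pointwise (Kᶜ-zero eq)

  K-+ : ∀ {k} (c c′ : Cochain m n k) → K (c +C c′) ≈ K c ⊕ K c′
  K-+ c c′ = pointwise (Kᶜ-+ c c′)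

  K-neg : ∀ {k} (c : Cochain m n k) → K (λ σ → -F c σ) ≈ -ₗ K c
  K-neg c = begin
    K (λ σ → -F c σ)              ≈⟨ Λ-solve 2 (λ b d → d :≈ (b :⊕ d) :⊕ (⊝ b)) ≈-refl (K c) _ ⟩
    (K c ⊕ K (λ σ → -F c σ)) ⊖ K c ≈⟨ ⊕-identityˡ (≈-trans (≈-sym (K-+ c _)) (K-zero λ σ → -F-inverseʳ (c σ))) ⟩
    -ₗ K c                        ∎

  K-ΣF : ∀ {k} l (c : Fin l → Cochain m n k) → K (λ σ → ΣF l (λ i → c i σ)) ≈ ∑ (λ i → K (c i))
  K-ΣF zero    c = ≈-trans (K-zero λ σ → refl) (pointwise λ σ → refl)
  K-ΣF (suc l) c = ≈-trans (K-+ (c fz) _) (≈-trans (⊕-cong ≈-refl (K-ΣF l (c ∘ fs))) (pointwise λ σ → refl))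

  a-K-inside : ∀ {k v v′} (c : Cochain m n (suc k)) → fromV v ≡ just v′ → a v (K c) ≈ K (contract v′ c)
  a-K-inside c eq = pointwise λ σ → cong (maybe (λ v′ → Kᶜ (contract v′ c) σ) 0F) eq

  a-K : ∀ {k} v (c : Cochain m n (suc k)) → a (toV v) (K c) ≈ K (contract v c)
  a-K v c = a-K-inside c (fromV-toV v)

  a-K-outside : ∀ {k v} (c : Cochain m n k) → fromV v ≡ nothing → a v (K c) ≈ 𝟘
  a-K-outside {zero}  c eq = pointwise λ σ → refl
  a-K-outside {suc k} c eq = pointwise λ σ → cong (maybe (λ v′ → Kᶜ (contract v′ c) σ) 0F) eq

  a-K-empty : ∀ {v} (c : Cochain m n 0) → a v (K c) ≈ 𝟘
  a-K-empty c = pointwise λ σ → refl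

  alt-K : ∀ {k} (c : Cochain m n k) → Alt (K c)
  alt-K c = alternating (go c)
    where
    head : ∀ {k} (c : Cochain m n k) u v → Image u → Image v → a v (a u (K c)) ≈ -ₗ a u (a v (K c))
    head c u v (outside eq _) _ = ≈-trans (null (a-linear v) (a-K-outside c eq)) (≈-sym (≈𝟘⇒-≈𝟘 (zero-after c eq)))
      where
      zero-after : ∀ {k} (c : Cochain m n k) → fromV u ≡ nothing → a u (a v (K c)) ≈ 𝟘
      zero-after {zero} c eq = pointwise λ σ → refl
      zero-after {suc k} c eq with image v
      ... | outside eq′ _   = null (a-linear u) (a-K-outside c eq′)
      ... | inside v′ eq′ _ = ≈-trans (resp (a-linear u) (a-K-inside c eq′)) (a-K-outside (contract v′ c) eq)
    head {zero} c u v _ _ = pointwise λ σ → refl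
    head {suc k} c u v (inside u′ eq _) (outside eq′ _) =
      ≈-trans (≈-trans (resp (a-linear v) (a-K-inside c eq)) (a-K-outside (contract u′ c) eq′))
              (≈-sym (≈𝟘⇒-≈𝟘 (null (a-linear u) (a-K-outside c eq′))))
    head {suc zero} c u v (inside u′ eq _) (inside v′ eq′ _) =
      ≈-trans (≈-trans (resp (a-linear v) (a-K-inside c eq)) (a-K-empty (contract u′ c)))
              (≈-sym (≈𝟘⇒-≈𝟘 (≈-trans (resp (a-linear u) (a-K-inside c eq′)) (a-K-empty (contract v′ c)))))
    head {suc (suc k)} c u v (inside u′ eq _) (inside v′ eq′ _) = begin
      a v (a u (K c))                    ≈⟨ resp (a-linear v) (a-K-inside c eq) ⟩
      a v (K (contract u′ c))            ≈⟨ a-K-inside (contract u′ c) eq′ ⟩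
      K (contract v′ (contract u′ c))    ≈⟨ K-cong (contract-anti v′ u′ c) ⟩
      K (λ σ → -F contract u′ (contract v′ c) σ) ≈⟨ K-neg (contract u′ (contract v′ c)) ⟩
      -ₗ K (contract u′ (contract v′ c)) ≈⟨ -ₗ-cong (≈-sym (≈-trans (resp (a-linear u) (a-K-inside c eq′)) (a-K-inside (contract v′ c) eq))) ⟩
      -ₗ a u (a v (K c))                 ∎

    go : ∀ {k} (c : Cochain m n k) τ u v σ → Kᶜ c (τ ++ u ∷ v ∷ σ) ≡ -F Kᶜ c (τ ++ v ∷ u ∷ σ)
    go c [] u v σ = at (head c u v (image u) (image v)) σ
    go {zero}  c (w ∷ τ) u v σ = refl
    go {suc k} c (w ∷ τ) u v σ with fromV w
    ... | nothing = refl
    ... | just w′ = go (contract w′ c) τ u v σ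

  deg-K : ∀ {k} (c : Cochain m n k) → Deg (suc k) (K c)
  deg-K c = degree (go c)
    where
    go : ∀ {k} (c : Cochain m n k) σ → suc (length σ) ≢ suc k → Kᶜ c σ ≡ 0F
    go {zero}  c []      n = contradiction refl n
    go {zero}  c (_ ∷ _) n = refl
    go {suc k} c []      n = refl
    go {suc k} c (v ∷ σ) n with fromV v
    ... | nothing = refl
    ... | just v′ = go (contract v′ c) σ (n ∘ cong suc)

  toV-clash : ∀ {u u′ v v′} → toV u′ ≡ u → toV v′ ≡ v → Conf u v → Clash u′ v′
  toV-clash refl refl (inj₁ eq) = inj₁ (just-injective (trans (sym (from-to ρ _)) (trans (cong (from ρ) eq) (from-to ρ _))))
  toV-clash refl refl (inj₂ eq) = inj₂ (just-injective (trans (sym (from-to γ _)) (trans (cong (from γ) eq) (from-to γ _))))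

  fromV-nothingʳ : ∀ {v} → from ρ (proj₁ v) ≡ nothing → fromV v ≡ nothing
  fromV-nothingʳ {v} eq = cong (λ x → zip x (from γ (proj₂ v))) eq

  fromV-nothingᶜ : ∀ {v} → from γ (proj₂ v) ≡ nothing → fromV v ≡ nothing
  fromV-nothingᶜ {v} eq with from ρ (proj₁ v)
  ... | nothing = refl
  ... | just _  = cong (zip (just _)) eq

  good-K : ∀ {k} {c : Cochain m n k} → IsChain c → Good D E (suc k) (K c)
  good-K {k} {c} chain = record
    { alt = alt-K c
    ; deg = deg-K c
    ; conf = λ {u} {v} → conflict c chain (image u) (image v)
    ; avoidRow = λ i → a-K-outside c (fromV-nothingʳ (D-off i))
    ; avoidCol = λ i → a-K-outside c (fromV-nothingᶜ (E-off i))
    }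
    where
    conflict : ∀ {k u v} (c : Cochain m n k) → IsChain c → Image u → Image v → Conf u v → a u (a v (K c)) ≈ 𝟘
    conflict c chain _ (outside eq _) _ = null (a-linear _) (a-K-outside c eq)
    conflict {zero} c chain _ _ _ = pointwise λ σ → refl
    conflict {suc k} c chain (outside eq _) (inside v′ eq′ _) _ =
      ≈-trans (resp (a-linear _) (a-K-inside c eq′)) (a-K-outside (contract v′ c) eq)
    conflict {suc zero} c chain (inside _ _ _) (inside v′ eq′ _) _ =
      ≈-trans (resp (a-linear _) (a-K-inside c eq′)) (a-K-empty (contract v′ c))
    conflict {suc (suc k)} c chain (inside u′ eq r) (inside v′ eq′ r′) cf =
      ≈-trans (≈-trans (resp (a-linear _) (a-K-inside c eq′)) (a-K-inside (contract v′ c) eq))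
              (K-zero (contract-clash chain (toV-clash r r′ cf)))

  ∂-inside : ∀ {x} → (∀ {v} → fromV v ≡ nothing → a v x ≈ 𝟘) → ∂ᴸ x ≈ ∑ λ i → ∑ λ j → a (toV (i , j)) x
  ∂-inside {x} off = pointwise λ σ →
    trans (ΣF-to ρ λ i eq → ΣF-zero q λ j → at (off (fromV-nothingʳ {i , j} eq)) σ)
          (ΣF-cong m λ i → ΣF-to γ λ j eq → at (off (fromV-nothingᶜ {to ρ i , j} eq)) σ)

  ∂-K : ∀ {k} (c : Cochain m n (suc k)) → ∂ᴸ (K c) ≈ K (∂ c)
  ∂-K c = begin
    ∂ᴸ (K c)                                        ≈⟨ ∂-inside (λ {v} → a-K-outside c) ⟩
    (∑ λ i → ∑ λ j → a (toV (i , j)) (K c))         ≈⟨ ∑-cong (λ i → ∑-cong λ j → a-K (i , j) c) ⟩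
    (∑ λ i → ∑ λ j → K (contract (i , j) c))        ≈⟨ ∑-cong (λ i → ≈-sym (K-ΣF n _)) ⟩
    (∑ λ i → K (λ σ → ΣF n λ j → contract (i , j) c σ)) ≈⟨ ≈-sym (K-ΣF m _) ⟩
    K (λ σ → ΣF m λ i → ΣF n λ j → contract (i , j) c σ) ≈⟨ K-cong (λ σ → sym (∂-contract c σ)) ⟩
    K (∂ c)                                         ∎

-- Restriction of alternating functions to increasing words

when : ∀ {P : Set} → Dec P → F3 → F3
when (yes _) c = c
when (no  _) c = 0F

when-yes : ∀ {P : Set} (d : Dec P) {c} → P → when d c ≡ c
when-yes (yes _) p = refl
when-yes (no ¬p) p = contradiction p ¬p

when-no : ∀ {P : Set} (d : Dec P) {c} → ¬ P → when d c ≡ 0F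
when-no (yes p) ¬p = contradiction p ¬p
when-no (no _)  ¬p = refl

when-zero : ∀ {P : Set} (d : Dec P) {c} → c ≡ 0F → when d c ≡ 0F
when-zero (yes _) eq = eq
when-zero (no _)  eq = refl

when-neg : ∀ {P : Set} (d : Dec P) c → when d (-F c) ≡ -F when d c
when-neg (yes _) c = refl
when-neg (no _)  c = refl

when-ΣF : ∀ {P : Set} (d : Dec P) k (f : Fin k → F3) → when d (ΣF k f) ≡ ΣF k (λ i → when d (f i))
when-ΣF (yes _) k f = refl
when-ΣF (no _)  k f = sym (ΣF-zero k λ i → refl)

when-× : ∀ {P Q R : Set} (d : Dec P) (d₁ : Dec Q) (d₂ : Dec R) → (P → Q × R) → (Q → R → P) →
  ∀ c → when d c ≡ when d₁ (when d₂ c)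
when-× d (yes q) (yes r) split join c = when-yes d (join q r)
when-× d (yes _) (no ¬r) split join c = when-no d (¬r ∘ proj₂ ∘ split)
when-× d (no ¬q) d₂      split join c = when-no d (¬q ∘ proj₁ ∘ split)

-- Here `r` and `s` are the rows of a new letter and of the first letter of a word. The new letter
-- belongs either before or after; exactly one of the two guarded terms survives, and a tie is a
-- conflict, where the value is zero.
when-insert : ∀ {ℓ r s} (ℓ≤r : Dec (ℓ ≤ r)) (r<s : Dec (r < s)) (ℓ≤s : Dec (ℓ ≤ s)) (s<r : Dec (s < r)) c →
  (r ≡ s → c ≡ 0F) →
  when ℓ≤r (when r<s c) +F (-F when ℓ≤s (when s<r (-F c))) ≡ when ℓ≤r (when ℓ≤s c)
when-insert _       (yes r<s) _       (yes s<r) c tie = contradiction s<r (<-asym r<s)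
when-insert (yes h) (yes r<s) d       (no _)    c tie =
  trans (trans (cong (λ b → c +F (-F b)) (when-zero d refl)) (+F-identityʳ c)) (sym (when-yes d (≤-trans h (<⇒≤ r<s))))
when-insert (no _)  (yes r<s) d       (no _)    c tie = trans (+F-identityˡ _) (cong -F_ (when-zero d refl))
when-insert d       (no _)    (yes h) (yes s<r) c tie =
  trans (cong (_+F (-F (-F c))) (when-zero d refl))
        (trans (trans (+F-identityˡ _) (solve 1 (λ c → :- (:- c) := c) refl c)) (sym (when-yes d (≤-trans h (<⇒≤ s<r)))))
when-insert d       (no _)    (no _)  (yes s<r) c tie = trans (cong (_+F 0F) (when-zero d refl)) (sym (when-zero d refl))
when-insert {r = r} {s} d (no r≮s) d′ (no s≮r)  c tie =
  trans (cong₂ (λ x y → x +F (-F y)) (when-zero d refl) (when-zero d′ refl))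
        (sym (when-zero d (when-zero d′ (tie (≤-antisym (≮⇒≥ s≮r) (≮⇒≥ r≮s))))))

module Restriction {m n p q : ℕ} (ρ : Embedding m p) (γ : Embedding n q) {D : List (Fin p)} {E : List (Fin q)}
  (D-off : ∀ {i} → i ∈ D → from ρ i ≡ nothing) (off-D : ∀ {i} → from ρ i ≡ nothing → i ∈ D)
  (E-off : ∀ {j} → j ∈ E → from γ j ≡ nothing) (off-E : ∀ {j} → from γ j ≡ nothing → j ∈ E) where
  open Chessboard p q
  open Translation ρ γ D-off off-D E-off off-E

  word : ∀ {k} → Vec (V m n) k → List (V p q)
  word []      = []
  word (v ∷ τ) = toV v ∷ word τ

  height : V m n → ℕ
  height v = toℕ (proj₁ v)

  π : ∀ {k} → ℕ → Λ → Cochain m n k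
  π ℓ x σ = when (inc? ℓ σ) (x ⟨ word σ ⟩)

  record Sparse (x : Λ) : Set where
    field
      alternate : Alt x
      conflict  : ∀ {u v} → Conf u v → a u (a v x) ≈ 𝟘
  open Sparse

  sparse-good : ∀ {D E s x} → Good D E s x → Sparse x
  sparse-good g = record { alternate = alt g ; conflict = conf g }

  sparse-a : ∀ {x} v → Sparse x → Sparse (a v x)
  sparse-a v S = record
    { alternate = alt-a v (alternate S)
    ; conflict = λ {u} {w} c → ≈-trans (resp (a-linear u) (aa-anti (alternate S) w v)) (≈-trans (a-neg u)
        (≈𝟘⇒-≈𝟘 (aa-zero v u (alt-a w (alternate S)) (null (a-linear v) (conflict S c))))) }

  π-cong : ∀ {k} ℓ {x y} → x ≈ y → π {k} ℓ x ≐ π ℓ y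
  π-cong ℓ eq σ = cong (when (inc? ℓ σ)) (at eq (word σ))

  π-∷ : ∀ {k} ℓ x v (τ : Vec (V m n) k) → π ℓ x (v ∷ τ) ≡ when (ℓ ≤? height v) (π (suc (height v)) (a (toV v) x) τ)
  π-∷ ℓ x v τ = when-× (inc? ℓ (v ∷ τ)) (ℓ ≤? height v) (inc? _ τ) (λ { (h ∷ t) → h , t }) _∷_ (x ⟨ toV v ∷ word τ ⟩)

  -- Only the insertion of `v` at its sorted place survives the restriction, and its sign is the one
  -- that alternation charges for moving `v` there from the front.
  contract-π : ∀ {k} ℓ {x} → Sparse x → ∀ v (σ : Vec (V m n) k) →
    contract v (π ℓ x) σ ≡ when (ℓ ≤? height v) (π ℓ (a (toV v) x) σ)
  contract-π ℓ {x} S v [] = trans (contract-[] v (π ℓ x)) (π-∷ ℓ x v [])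
  contract-π ℓ {x} S v (u ∷ τ) =
    trans (contract-∷ v (π ℓ x) u τ)
    (trans (cong₂ (λ b c → b +F (-F c))
             (trans (π-∷ ℓ x v (u ∷ τ)) (cong (when v?) (π-∷ (suc (height v)) (a (toV v) x) u τ)))
             (trans (contract-cong v (π-∷ ℓ x u) τ) (trans (contract-when u? v (π (suc (height u)) (a (toV u) x)) τ)
               (cong (when u?) (trans (contract-π (suc (height u)) (sparse-a (toV u) S) v τ) (cong (when u<v?) flip))))))
    (trans (when-insert v? v<u? u? u<v? Z tie)
           (cong (when v?) (sym (π-∷ ℓ (a (toV v) x) u τ)))))
    where
    u? = ℓ ≤? height u
    v? = ℓ ≤? height v
    v<u? = suc (height v) ≤? height u
    u<v? = suc (height u) ≤? height v
    Z : F3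
    Z = π (suc (height u)) (a (toV u) (a (toV v) x)) τ
    flip : π (suc (height u)) (a (toV v) (a (toV u) x)) τ ≡ -F Z
    flip = trans (cong (when (inc? _ τ)) (swap-sign (alternate S) [] (toV u) (toV v) (word τ))) (when-neg (inc? _ τ) (x ⟨ toV v ∷ toV u ∷ word τ ⟩))
    tie : height v ≡ height u → Z ≡ 0F
    tie eq = when-zero (inc? _ τ) (at (conflict S (inj₁ (cong (to ρ) (toℕ-injective (sym eq))))) (word τ))
    contract-when : ∀ {P : Set} {k} (d : Dec P) v (c : Cochain m n (suc k)) σ →
      contract v (λ ρ → when d (c ρ)) σ ≡ when d (contract v c σ)
    contract-when (yes _) v c σ = refl
    contract-when (no _)  v c σ = contract-zero v {λ _ → 0F} (λ _ → refl) σ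

  outside-zero : ∀ {s x} → Good D E s x → ∀ {v} → fromV v ≡ nothing → a v x ≈ 𝟘
  outside-zero {x = x} g {v} eq = by-image (image v)
    where
    by-image : Image v → a v x ≈ 𝟘
    by-image (outside _ (inj₁ i)) = avoidRow g (off-D i)
    by-image (outside _ (inj₂ j)) = avoidCol g (off-E j)
    by-image (inside v′ eq′ _)    = contradiction (trans (sym eq) eq′) λ ()

  ∂-π : ∀ {s k x} → Good D E s x → ∂ (π {suc k} 0 x) ≐ π 0 (∂ᴸ x)
  ∂-π {k = k} {x} g σ = trans (∂-contract (π 0 x) σ)
    (trans (ΣF-cong m λ i → ΣF-cong n λ j → trans (contract-π 0 (sparse-good g) (i , j) σ) (when-yes (0 ≤? toℕ i) z≤n))
    (trans (sym (trans (when-ΣF d m (λ i → ΣF n λ j → x ⟨ toV (i , j) ∷ word σ ⟩))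
                      (ΣF-cong m λ i → when-ΣF d n (λ j → x ⟨ toV (i , j) ∷ word σ ⟩))))
           (cong (when d) (sym (at (∂-inside (outside-zero g)) (word σ))))))
    where
    d = inc? 0 σ

  word-zero : ∀ {k x} → Sparse x → (τ : Vec (V m n) k) → ∀ i → a (toV (lookup τ i)) x ≈ 𝟘 → x ⟨ word τ ⟩ ≡ 0F
  word-zero S (v ∷ τ) fz     z = at z (word τ)
  word-zero S (v ∷ τ) (fs i) z = word-zero (sparse-a (toV v) S) τ i
    (aa-zero _ _ (alternate S) (null (a-linear _) z))

  -- The rows are distinct by `Inc`; two letters in a common column would make the value zero by
  -- `conflict`.
  support-face : ∀ {k ℓ x} → Sparse x → {σ : Vec (V m n) k} → Inc ℓ σ → x ⟨ word σ ⟩ ≢ 0F →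
    IsFace σ × (∀ i → ℓ ≤ height (lookup σ i))
  support-face S [] ≢0 = (λ ()) , λ ()
  support-face {ℓ = ℓ} {x} S {v ∷ τ} (h ∷ t) ≢0 = face , λ { fz → h ; (fs i) → ≤-trans h (<⇒≤ (proj₂ ih i)) }
    where
    ih = support-face (sparse-a (toV v) S) t ≢0
    face : IsFace (v ∷ τ)
    face fz     (fs j) _         = inj₁ (proj₂ ih j)
      , (λ eq → <-irrefl (cong toℕ eq) (proj₂ ih j))
      , (λ eq → ≢0 (word-zero (sparse-a (toV v) S) τ j (conflict S (inj₂ (cong (to γ) (sym eq))))))
    face (fs i) (fs j) (s≤s i<j) = proj₁ ih i j i<j

  π-chain : ∀ {k x} → Sparse x → IsChain (π {k} 0 x)
  π-chain {x = x} S σ not-face = by-cases (inc? 0 σ) (x ⟨ word σ ⟩ ≟F 0F)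
    where
    by-cases : (d : Dec (Inc 0 σ)) → Dec (x ⟨ word σ ⟩ ≡ 0F) → when d (x ⟨ word σ ⟩) ≡ 0F
    by-cases d        (yes eq) = when-zero d eq
    by-cases (no _)   _        = refl
    by-cases (yes inc) (no ≢0) = contradiction (proj₁ (support-face S inc ≢0)) not-face

  Supported : ∀ {k} → Cochain m n k → Set
  Supported c = ∀ σ → ¬ Inc 0 σ → c σ ≡ 0F

  chain-supported : ∀ {k} {c : Cochain m n k} → IsChain c → Supported c
  chain-supported chain σ not-inc = chain σ λ face → not-inc (face-inc 0 face λ i → z≤n)

  contract-supported : ∀ {k} {c : Cochain m n (suc k)} v → Supported c → Supported (contract v c)
  contract-supported {k} v supp σ not-inc = ΣF-zero (suc k) λ i → sgn-zero i
    (supp (insertAt σ i v) (not-inc ∘ proj₁ ∘ inc-insertAt σ i v))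

  -- All rows of `τ` lie above that of `v`, so an insertion anywhere but at the front gives a word
  -- that is not increasing.
  contract-head : ∀ {k} {c : Cochain m n (suc k)} v → Supported c → ∀ {τ} → Inc (suc (height v)) τ →
    contract v c τ ≡ c (v ∷ τ)
  contract-head {c = c} v supp [] = contract-[] v c
  contract-head {suc k} {c} v supp {u ∷ τ} (v<u ∷ _) = trans (contract-∷ v c u τ)
    (trans (cong (λ b → c (v ∷ u ∷ τ) +F (-F b)) (ΣF-zero (suc k) λ i → sgn-zero i
      (supp (u ∷ insertAt τ i v) λ { (_ ∷ t) → <-asym v<u (proj₂ (inc-insertAt τ i v t)) })))
    (+F-identityʳ (c (v ∷ u ∷ τ))))

  K-word : ∀ {k ℓ} {c : Cochain m n k} → Supported c → ∀ {σ} → Inc ℓ σ → Kᶜ c (word σ) ≡ c σ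
  K-word supp [] = refl
  K-word {c = c} supp {v ∷ τ} (_ ∷ t) = trans (at (a-K v c) (word τ))
    (trans (K-word (contract-supported v supp) t) (contract-head v supp t))

  π-K : ∀ {k} {c : Cochain m n k} → IsChain c → π 0 (K c) ≐ c
  π-K {c = c} chain σ = by-cases (inc? 0 σ)
    where
    by-cases : (d : Dec (Inc 0 σ)) → when d (Kᶜ c (word σ)) ≡ c σ
    by-cases (yes inc) = K-word (chain-supported chain) inc
    by-cases (no ¬inc) = sym (chain-supported chain σ ¬inc)

  Vanishes : ℕ → Λ → Set
  Vanishes ℓ x = ∀ {k} {τ : Vec (V m n) k} → Inc ℓ τ → x ⟨ word τ ⟩ ≡ 0F

  -- One pass of insertion sort: `v` moves to the right by transpositions, each costing a sign,
  -- until it meets a letter of a higher row, a letter of its own row, where the value is zero, or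
  -- the end of the word.
  vanishes-insert : ∀ {ℓ x} → Sparse x → Vanishes ℓ x → ∀ {k} {τ : Vec (V m n) k} → Inc ℓ τ →
    ∀ v → ℓ ≤ height v → x ⟨ toV v ∷ word τ ⟩ ≡ 0F
  vanishes-insert S z [] v ℓ≤v = z (ℓ≤v ∷ [])
  vanishes-insert {ℓ} {x} S z {τ = u ∷ τ} (h ∷ t) v ℓ≤v = by-order (<-cmp (height v) (height u))
    where
    by-order : _ → x ⟨ toV v ∷ toV u ∷ word τ ⟩ ≡ 0F
    by-order (tri< v<u _ _) = z (ℓ≤v ∷ v<u ∷ t)
    by-order (tri≈ _ eq _)  = at (conflict S (inj₁ (cong (to ρ) (toℕ-injective (sym eq))))) (word τ)
    by-order (tri> _ _ u<v) = trans (swap-sign (alternate S) [] (toV v) (toV u) (word τ))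
      (cong -F_ (vanishes-insert (sparse-a (toV u) S) (λ t′ → z (h ∷ t′)) t v u<v))

  vanishes⇒zero : ∀ {x} → Sparse x → (∀ {v} → fromV v ≡ nothing → a v x ≈ 𝟘) → Vanishes 0 x → x ≈ 𝟘
  vanishes⇒zero S off z = pointwise (go S off z)
    where
    go : ∀ {x} → Sparse x → (∀ {v} → fromV v ≡ nothing → a v x ≈ 𝟘) → Vanishes 0 x → ∀ σ → x ⟨ σ ⟩ ≡ 0F
    go S off z [] = z []
    go {x} S off z (v ∷ σ) = by-image (image v)
      where
      by-image : Image v → x ⟨ v ∷ σ ⟩ ≡ 0F
      by-image (outside eq _) = at (off eq) σ
      by-image (inside v′ _ refl) = go (sparse-a v S)
        (λ eq → aa-zero _ _ (alternate S) (null (a-linear _) (off eq)))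
        (λ inc → vanishes-insert S z inc v′ z≤n) σ

  length-word : ∀ {k} (τ : Vec (V m n) k) → length (word τ) ≡ k
  length-word []      = refl
  length-word (v ∷ τ) = cong suc (length-word τ)

  -- The difference of the two sides is a chain that vanishes on increasing words, hence on all
  -- words by sorting and on words leaving the subboard by support.
  K-π : ∀ {k x} → Good D E (suc k) x → K (π {k} 0 x) ≈ x
  K-π {k} {x} g = ≈-sym (⊖≈𝟘⇒≈ (vanishes⇒zero (sparse-good good-z) (outside-zero good-z) z-vanishes))
    where
    chain : IsChain (π {k} 0 x)
    chain = π-chain (sparse-good g)
    good-z : Good D E (suc k) (x ⊖ K (π {k} 0 x))
    good-z = good-⊖ g (good-K chain)
    z-vanishes : Vanishes 0 (x ⊖ K (π {k} 0 x))
    z-vanishes {k′} {τ} inc = by-length (k′ ℕ.≟ k)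
      where
      by-length : Dec (k′ ≡ k) → (x ⊖ K (π {k} 0 x)) ⟨ word τ ⟩ ≡ 0F
      by-length (no k′≢k) = off-degree (deg good-z) (word τ) (k′≢k ∘ trans (sym (length-word τ)) ∘ cong pred)
      by-length (yes refl) = trans (cong (λ b → x ⟨ word τ ⟩ +F (-F b))
        (trans (K-word (chain-supported chain) inc) (when-yes (inc? 0 τ) inc))) (-F-inverseʳ (x ⟨ word τ ⟩))

-- Bases of homology and comparison of dimensions

*F-zeroʳ : ∀ c → c *F 0F ≡ 0F
*F-zeroʳ = from-yes (all? λ c → c *F 0F ≟F 0F)

two-*F : ∀ c → 2F *F c ≡ c +F c
two-*F = from-yes (all? λ c → 2F *F c ≟F c +F c)

-- An injection between sets of `3^b` and `3^b′` elements. Counting takes the place of linear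
-- algebra because the coordinates of homology classes come from the choice functions `spans`, for
-- which no additivity is stated.
≤-from-coefficients : ∀ {b b′} (Φ : (Fin b → F3) → (Fin b′ → F3)) →
  (∀ f g → (∀ i → Φ f i ≡ Φ g i) → ∀ i → f i ≡ g i) → b ≤ b′
≤-from-coefficients {b} {b′} Φ Φ-inj = ≮⇒≥ λ b′<b →
  <⇒≱ (^-monoʳ-< 3 (s≤s (s≤s z≤n)) b′<b) (injective⇒≤ {f = Φ̂} Φ̂-inj)
  where
  Φ̂ : Fin (3 ^ b) → Fin (3 ^ b′)
  Φ̂ i = funToFin (Φ (finToFun i))
  funToFin-cong : ∀ {k} {f g : Fin k → F3} → (∀ i → f i ≡ g i) → funToFin f ≡ funToFin g
  funToFin-cong {zero}  eq = refl
  funToFin-cong {suc k} eq = cong₂ combine (eq fz) (funToFin-cong (eq ∘ fs))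
  Φ̂-inj : ∀ {i j} → Φ̂ i ≡ Φ̂ j → i ≡ j
  Φ̂-inj {i} {j} eq = trans (sym (funToFin-finToFin {b} i)) (trans (funToFin-cong (Φ-inj (finToFun i) (finToFun j)
    λ l → trans (sym (finToFun-funToFin (Φ (finToFun i)) l))
                (trans (cong (λ t → finToFun t l) eq) (finToFun-funToFin (Φ (finToFun j)) l))))
    (funToFin-finToFin {b} j))

module Bases (p q : ℕ) where
  open Chessboard p q

  private variable
    D : List (Fin p)
    E : List (Fin q)
    s b : ℕ

  infixl 7 _⊙_
  _⊙_ : F3 → Λ → Λ
  (c ⊙ x) ⟨ σ ⟩ = c *F x ⟨ σ ⟩

  ⊙-zero : ∀ x → 0F ⊙ x ≈ 𝟘
  ⊙-zero x = pointwise λ σ → refl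

  ⊙-one : ∀ x → 1F ⊙ x ≈ x
  ⊙-one x = pointwise λ σ → *F-identityˡ (x ⟨ σ ⟩)

  ⊙-two : ∀ x → 2F ⊙ x ≈ x ⊕ x
  ⊙-two x = pointwise λ σ → two-*F (x ⟨ σ ⟩)

  -- The scalars are 0, 1 and 1 + 1, so additivity already gives homogeneity.
  ⊙-linear : ∀ {L} → Linear L → ∀ c x → L (c ⊙ x) ≈ c ⊙ L x
  ⊙-linear l fz x = ≈-trans (null l (⊙-zero x)) (≈-sym (⊙-zero _))
  ⊙-linear l 1F x = ≈-trans (resp l (⊙-one x)) (≈-sym (⊙-one _))
  ⊙-linear l 2F x = ≈-trans (resp l (⊙-two x)) (≈-trans (add l x x) (≈-sym (⊙-two _)))

  good-⊙ : ∀ {x} c → Good D E s x → Good D E s (c ⊙ x)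
  good-⊙ {x = x} fz g = good-zero (⊙-zero x)
  good-⊙ {x = x} 1F g = good-resp (≈-sym (⊙-one x)) g
  good-⊙ {x = x} 2F g = good-resp (≈-sym (⊙-two x)) (good-⊕ g g)

  record Basis (D : List (Fin p)) (E : List (Fin q)) (s b : ℕ) : Set where
    field
      cycle      : Fin b → Λ
      good-cycle : ∀ i → Good D E s (cycle i)
      ∂-cycle    : ∀ i → ∂ᴸ (cycle i) ≈ 𝟘

    comb : (Fin b → F3) → Λ
    comb c = ∑ λ i → c i ⊙ cycle i

    field
      independent : ∀ c → Bounds s D E (comb c) → ∀ i → c i ≡ 0F
      spans       : ∀ {x} → Good D E s x → ∂ᴸ x ≈ 𝟘 → ∃ λ c → Bounds s D E (x ⊖ comb c)

    good-comb : ∀ c → Good D E s (comb c)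
    good-comb c = good-∑ λ i → good-⊙ (c i) (good-cycle i)

    ∂-comb : ∀ c → ∂ᴸ (comb c) ≈ 𝟘
    ∂-comb c = ≈-trans (sum ∂-linear _) (∑-zero λ i → ≈-trans (⊙-linear ∂-linear (c i) (cycle i))
      (pointwise λ σ → trans (cong (c i *F_) (at (∂-cycle i) σ)) (*F-zeroʳ (c i))))

    comb-cong : ∀ {c c′} → (∀ i → c i ≡ c′ i) → comb c ≈ comb c′
    comb-cong eq = ∑-cong λ i → pointwise λ σ → cong (_*F cycle i ⟨ σ ⟩) (eq i)

    comb-unique : ∀ c c′ → Bounds s D E (comb c ⊖ comb c′) → ∀ i → c i ≡ c′ i
    comb-unique c c′ β i =
      trans (solve 2 (λ x y → x := (x :+ (:- y)) :+ y) refl (c i) (c′ i))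
      (trans (cong (_+F c′ i) (independent (λ i → c i +F (-F c′ i)) (bounds-resp eq β) i)) (+F-identityˡ (c′ i)))
      where
      eq : comb c ⊖ comb c′ ≈ comb (λ i → c i +F (-F c′ i))
      eq = ≈-trans (≈-sym (∑-⊖ _ _)) (∑-cong λ i → pointwise λ σ →
        solve 3 (λ c c′ x → (c :* x) :+ (:- (c′ :* x)) := (c :+ (:- c′)) :* x) refl (c i) (c′ i) (cycle i ⟨ σ ⟩))

  exact⇒empty : Exact s D E → Basis D E s b → b ≡ 0
  exact⇒empty {b = zero}  exact B = refl
  exact⇒empty {b = suc b} exact B = contradiction
    (independent (λ _ → 1F) (exact (good-comb _) (∂-comb _)) fz) λ ()
    where open Basis B

module TwinBases {p q : ℕ} {r : Fin p} {c₁ c₂ : Fin q} (c₁≢c₂ : c₁ ≢ c₂) {k : ℕ}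
  (rows : suc k + 3 ≤ p) (cols : suc k + 4 ≤ q) (total : suc k + suc k + suc k + 5 ≤ suc (p + q)) where
  open Chessboard p q
  open Bases p q
  open TwinHomology {p} {q} {r} {c₁} {c₂} c₁≢c₂ {k} rows cols total

  module _ {b b₁ : ℕ} (B : Basis [] [] (suc (suc (suc k))) b)
    (B₁ : Basis (r ∷ []) (c₂ ∷ c₁ ∷ []) (suc (suc k)) b₁) where
    private
      module B = Basis B
      module B₁ = Basis B₁

      T : Λ → Λ
      T = twin r c₁ c₂

      T-linear : Linear T
      T-linear = twin-linear r c₁ c₂

      combine-bounds : ∀ {s D E x x′ y y′} → y ≈ y′ → Bounds s D E (x ⊖ y) → Bounds s D E (x′ ⊖ y′) → Bounds s D E (x ⊖ x′)
      combine-bounds {x = x} {x′} {y} {y′} eq β β′ = bounds-resp (begin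
        (x ⊖ y) ⊖ (x′ ⊖ y′)   ≈⟨ ⊖-cong (⊖-cong ≈-refl eq) ≈-refl ⟩
        (x ⊖ y′) ⊖ (x′ ⊖ y′)  ≈⟨ Λ-solve 3 (λ x x′ y → (x :⊕ (⊝ y)) :⊕ (⊝ (x′ :⊕ (⊝ y))) :≈ x :⊕ (⊝ x′)) ≈-refl x x′ y′ ⟩
        x ⊖ x′                ∎) (bounds-⊖ β β′)

      expand : ∀ c → ∃ λ c′ → Bounds _ [] [] (T (B₁.comb c) ⊖ B.comb c′)
      expand c = B.spans (good-twin ∉[] ∉[] ∉[] (B₁.good-comb c))
        (≈-trans (∂-twin r c₁ c₂ _) (≈𝟘⇒-≈𝟘 (null T-linear (B₁.∂-comb c))))

      expand-inj : ∀ f g → (∀ i → proj₁ (expand f) i ≡ proj₁ (expand g) i) → ∀ i → f i ≡ g i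
      expand-inj f g eq = B₁.comb-unique f g
        (injective (proj₁ (proj₂ β)) (good-⊖ (B₁.good-comb f) (B₁.good-comb g))
                   (≈-trans (proj₂ (proj₂ β)) (≈-sym (sub T-linear _ _))))
        where
        β : Bounds _ [] [] (T (B₁.comb f) ⊖ T (B₁.comb g))
        β = combine-bounds (B.comb-cong eq) (proj₂ (expand f)) (proj₂ (expand g))

      lift : ∀ c → _
      lift c = surjective (B.good-comb c) (B.∂-comb c)

      y : (Fin b → F3) → Λ
      y c = proj₁ (proj₂ (lift c))

      contract-y : ∀ c → ∃ λ c′ → Bounds _ (r ∷ []) (c₂ ∷ c₁ ∷ []) (y c ⊖ B₁.comb c′)
      contract-y c = B₁.spans (proj₁ (proj₂ (proj₂ (proj₂ (lift c))))) (proj₁ (proj₂ (proj₂ (proj₂ (proj₂ (lift c))))))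

      lift-bounds : ∀ c → Bounds _ [] [] (B.comb c ⊖ T (y c))
      lift-bounds c = bounds-resp
        (≈-trans (Λ-solve 2 (λ d t → d :≈ (d :⊕ t) :⊕ (⊝ t)) ≈-refl _ (T (y c)))
                 (⊖-cong (≈-sym (proj₂ (proj₂ (proj₂ (proj₂ (proj₂ (lift c))))))) ≈-refl))
        (bounds-∂ (proj₁ (proj₂ (proj₂ (lift c)))))

      contract-inj : ∀ f g → (∀ i → proj₁ (contract-y f) i ≡ proj₁ (contract-y g) i) → ∀ i → f i ≡ g i
      contract-inj f g eq = B.comb-unique f g (bounds-resp
        (Λ-solve 4 (λ x x′ t t′ → ((x :⊕ (⊝ t)) :⊕ (⊝ (x′ :⊕ (⊝ t′)))) :⊕ (t :⊕ (⊝ t′)) :≈ x :⊕ (⊝ x′)) ≈-refl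
          (B.comb f) (B.comb g) (T (y f)) (T (y g)))
        (bounds-⊕ (bounds-⊖ (lift-bounds f) (lift-bounds g)) T-bounds))
        where
        β : Bounds _ (r ∷ []) (c₂ ∷ c₁ ∷ []) (y f ⊖ y g)
        β = combine-bounds (B₁.comb-cong eq) (proj₂ (contract-y f)) (proj₂ (contract-y g))
        T-bounds : Bounds _ [] [] (T (y f) ⊖ T (y g))
        T-bounds = -ₗ T (proj₁ β) , good-neg (good-twin ∉[] ∉[] ∉[] (proj₁ (proj₂ β)))
          , ≈-trans (neg ∂-linear _) (≈-trans (-ₗ-cong (∂-twin r c₁ c₂ _)) (≈-trans -ₗ-involutive
            (≈-trans (resp T-linear (proj₂ (proj₂ β))) (sub T-linear _ _))))

    twin-betti : b ≡ b₁
    twin-betti = ≤-antisym (≤-from-coefficients (proj₁ ∘ contract-y) contract-inj)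
                           (≤-from-coefficients (proj₁ ∘ expand) expand-inj)

module BettiBasis {m n p q : ℕ} (ρ : Embedding m p) (γ : Embedding n q) {D : List (Fin p)} {E : List (Fin q)}
  (D-off : ∀ {i} → i ∈ D → from ρ i ≡ nothing) (off-D : ∀ {i} → from ρ i ≡ nothing → i ∈ D)
  (E-off : ∀ {j} → j ∈ E → from γ j ≡ nothing) (off-E : ∀ {j} → from γ j ≡ nothing → j ∈ E) where
  open Chessboard p q
  open Bases p q
  open Translation ρ γ D-off off-D E-off off-E
  open Restriction ρ γ D-off off-D E-off off-E

  K-scale : ∀ {k} a (c : Cochain m n k) → K (λ σ → a *F c σ) ≈ a ⊙ K c
  K-scale fz c = ≈-trans (K-zero λ σ → refl) (≈-sym (⊙-zero _))
  K-scale 1F c = ≈-trans (K-cong λ σ → *F-identityˡ (c σ)) (≈-sym (⊙-one _))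
  K-scale 2F c = ≈-trans (K-cong λ σ → two-*F (c σ)) (≈-trans (K-+ c c) (≈-sym (⊙-two _)))

  K-lin : ∀ {k b} (c : Fin b → F3) (z : Fin b → Cochain m n k) → K (lin c z) ≈ ∑ λ i → c i ⊙ K (z i)
  K-lin {b = b} c z = ≈-trans (K-ΣF b _) (∑-cong λ i → K-scale (c i) (z i))

  lin-chain : ∀ {k b} (c : Fin b → F3) {z : Fin b → Cochain m n k} → (∀ i → IsChain (z i)) → IsChain (lin c z)
  lin-chain {b = b} c chain σ not-face = ΣF-zero b λ i →
    trans (cong (c i *F_) (chain i σ not-face)) (*F-zeroʳ (c i))

  basis : ∀ {d b} → IsBetti m n d b → Basis D E (suc (suc d)) b
  basis {d} {b} (z , chain , closed , indep , span) = record
    { cycle = K ∘ z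
    ; good-cycle = λ i → good-K (chain i)
    ; ∂-cycle = λ i → ≈-trans (∂-K (z i)) (K-zero (closed i))
    ; independent = λ { c (w , gw , ∂w) → indep c (π 0 w) (π-chain (sparse-good gw)) λ σ →
        trans (sym (π-K (lin-chain c chain) σ)) (trans (π-cong 0 (≈-trans (K-lin c z) (≈-sym ∂w)) σ) (sym (∂-π gw σ))) }
    ; spans = λ {x} g ∂x → spanning g (span (π 0 x) (π-chain (sparse-good g)) λ σ →
        trans (∂-π g σ) (trans (π-cong 0 ∂x σ) (when-zero (inc? 0 σ) refl)))
    }
    where
    spanning : ∀ {x} → Good D E (suc (suc d)) x →
      Σ (Fin b → F3) (λ c → Σ (Cochain m n (suc (suc d))) λ w → IsChain w × (π 0 x ≐ (lin c z +C ∂ w))) →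
      ∃ λ c → Bounds (suc (suc d)) D E (x ⊖ ∑ λ i → c i ⊙ K (z i))
    spanning {x} g (c , w , chain-w , eq) = c , K w , good-K chain-w , (begin
      ∂ᴸ (K w)
        ≈⟨ ∂-K w ⟩
      K (∂ w)
        ≈⟨ Λ-solve 2 (λ b l → b :≈ (l :⊕ b) :⊕ (⊝ l)) ≈-refl _ (K (lin c z)) ⟩
      (K (lin c z) ⊕ K (∂ w)) ⊖ K (lin c z)
        ≈⟨ ⊖-cong (≈-trans (≈-sym (K-+ _ _)) (≈-trans (K-cong λ σ → sym (eq σ)) (K-π g))) (K-lin c z) ⟩
      x ⊖ ∑ (λ i → c i ⊙ K (z i)) ∎)

-- The theorem

small-region : ∀ (n m : Fin 8) → toℕ m ≤ toℕ n → toℕ n + 5 ≤ 2 * toℕ m → (toℕ m + toℕ n) % 3 ≡ 1 →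
  ¬ (toℕ m ≡ 5 × toℕ n ≡ 5) → toℕ m + 8 ≤ 2 * toℕ n
small-region = from-yes (all? {8} λ n → all? {8} λ m →
  (toℕ m ≤? toℕ n) →-dec ((toℕ n + 5 ≤? 2 * toℕ m) →-dec (((toℕ m + toℕ n) % 3 ℕ.≟ 1) →-dec
  (¬? ((toℕ m ℕ.≟ 5) ×-dec (toℕ n ℕ.≟ 5)) →-dec (toℕ m + 8 ≤? 2 * toℕ n)))))

-- For `m + n = 3d + 4` the conclusion says `d + 4 ≤ n`. From `n ≥ 8` on it follows from `m ≤ n`;
-- the finitely many smaller pairs are decided by computation, and `(5,5)` is the only one to be
-- excluded.
region-bound : ∀ {m n} → m ≤ n → n + 5 ≤ 2 * m → (m + n) % 3 ≡ 1 → ¬ (m ≡ 5 × n ≡ 5) → m + 8 ≤ 2 * n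
region-bound {m} {n} m≤n n+5≤2m mod3 not55 = by-size (n <? 8)
  where
  by-size : Dec (n < 8) → m + 8 ≤ 2 * n
  by-size (no n≮8) = ≤-trans (+-mono-≤ m≤n (≮⇒≥ n≮8)) (≤-reflexive (cong (n +_) (sym (+-identityʳ n))))
  by-size (yes n<8) = subst₂ (λ m n → m ≤ n → n + 5 ≤ 2 * m → (m + n) % 3 ≡ 1 → ¬ (m ≡ 5 × n ≡ 5) → m + 8 ≤ 2 * n)
    (toℕ-fromℕ< m<8) (toℕ-fromℕ< n<8) (small-region (fromℕ< n<8) (fromℕ< m<8)) m≤n n+5≤2m mod3 not55
    where
    m<8 : m < 8
    m<8 = ≤-trans (s≤s m≤n) n<8

ν-value : ∀ {m n u} → m + n ≡ 4 + u * 3 → u + 3 ≤ m → ν m n ≡ u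
ν-value {m} {n} {u} sum-eq u+3≤m = trans (cong ((m ∸ 1) ⊓_) quotient) (m≥n⇒m⊓n≡n u≤m-1)
  where
  quotient : (m + n ∸ 4 + 2) / 3 ≡ u
  quotient = trans (cong (λ s → (s ∸ 4 + 2) / 3) sum-eq)
    (trans (cong (_/ 3) (+-comm (u * 3) 2)) (trans (+-distrib-/-∣ʳ 2 {u * 3} {3} (divides u refl)) (m*n/n≡m u 3)))
  u≤m-1 : u ≤ m ∸ 1
  u≤m-1 = ≤-trans (m≤m+n u 2) (≤-trans (≤-reflexive (arith u)) (∸-monoˡ-≤ 1 u+3≤m))
    where
    arith : ∀ u → u + 2 ≡ u + 3 ∸ 1
    arith u = sym (cong (_∸ 1) (+-suc u 2))

Region : ℕ → ℕ → Set
Region m n = ∃ λ k → ∃₂ λ m′ n′ → m ≡ suc m′ × n ≡ suc (suc n′) × ν m n ≡ suc k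
           × k + 3 ≤ m′ × k + 3 ≤ n′ × m′ + n′ ≡ k + k + k + 4

region : ∀ {m n} → m ≤ n → n + 5 ≤ 2 * m → (m + n) % 3 ≡ 1 → ¬ (m ≡ 5 × n ≡ 5) → Region m n
region {m} {n} m≤n n+5≤2m mod3 not55 = by-quotient ((m + n) / 3) m n
  (trans (m≡m%n+[m/n]*n (m + n) 3) (cong (_+ (m + n) / 3 * 3) mod3)) n+5≤2m (region-bound m≤n n+5≤2m mod3 not55)
  where
  -- Here `t = d + 1`, so the two bounds read `d + 3 ≤ m` and `d + 4 ≤ n`. They are obtained below
  -- after multiplication by 3, for instance `3(t + 2) = m + n + 5 ≤ 3m`.
  from-bounds : ∀ t m n → m + n ≡ 1 + t * 3 → t + 2 ≤ m → t + 3 ≤ n → Region m n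
  from-bounds zero m n sum-eq rows cols =
    contradiction (≤-trans (+-mono-≤ rows cols) (≤-reflexive sum-eq)) λ { (s≤s ()) }
  from-bounds (suc zero) m n sum-eq rows cols =
    contradiction (≤-trans (+-mono-≤ rows cols) (≤-reflexive sum-eq)) λ { (s≤s (s≤s (s≤s (s≤s ())))) }
  from-bounds (suc (suc k)) (suc m′) (suc (suc n′)) sum-eq (s≤s rows) (s≤s (s≤s cols)) =
    k , m′ , n′ , refl , refl
    , ν-value {suc m′} {suc (suc n′)} {suc k} sum-eq (s≤s (≤-trans (≤-reflexive (arith₁ k)) rows))
    , ≤-trans (≤-reflexive (arith₁ k)) rows , cols
    , +-cancelʳ-≡ 3 _ _ (trans (arith₂ m′ n′) (trans sum-eq (arith₃ k)))
    where
    arith₁ : ∀ k → k + 3 ≡ suc k + 2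
    arith₁ = solve-∀
    arith₂ : ∀ m n → m + n + 3 ≡ suc m + suc (suc n)
    arith₂ = solve-∀
    arith₃ : ∀ k → 1 + suc (suc k) * 3 ≡ k + k + k + 4 + 3
    arith₃ = solve-∀

  by-quotient : ∀ t m n → m + n ≡ 1 + t * 3 → n + 5 ≤ 2 * m → m + 8 ≤ 2 * n → Region m n
  by-quotient t m n sum-eq n+5≤2m m+8≤2n = from-bounds t m n sum-eq
    (*-cancelˡ-≤ 3 (≤-trans (≤-reflexive (trans (arith₁ t) (trans (cong (_+ 5) (sym sum-eq)) (arith₂ m n))))
                           (≤-trans (+-monoʳ-≤ m n+5≤2m) (≤-reflexive (arith₃ m)))))
    (*-cancelˡ-≤ 3 (≤-trans (≤-reflexive (trans (arith₄ t) (trans (cong (_+ 8) (sym sum-eq)) (arith₅ m n))))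
                           (≤-trans (+-monoʳ-≤ n m+8≤2n) (≤-reflexive (arith₃ n)))))
    where
    arith₁ : ∀ t → 3 * (t + 2) ≡ 1 + t * 3 + 5
    arith₁ = solve-∀
    arith₂ : ∀ m n → m + n + 5 ≡ m + (n + 5)
    arith₂ = solve-∀
    arith₃ : ∀ m → m + 2 * m ≡ 3 * m
    arith₃ = solve-∀
    arith₄ : ∀ t → 3 * (t + 3) ≡ 1 + t * 3 + 8
    arith₄ = solve-∀
    arith₅ : ∀ m n → m + n + 8 ≡ n + (m + 8)
    arith₅ = solve-∀

twin-betti-equation : ∀ k m′ n′ {b b₁ b₂ b₃} → k + 3 ≤ m′ → k + 3 ≤ n′ → m′ + n′ ≡ k + k + k + 4 →
  IsBetti (suc m′) (suc (suc n′)) (suc k) b →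
  IsBetti m′ n′ k b₁ →
  IsBetti m′ (suc n′) k b₂ →
  IsBetti (m′ ∸ 2) n′ (k ∸ 1) b₃ →
  b ≡ b₁ × b₂ ≡ 0 × b₃ ≡ 0
twin-betti-equation k m′ n′ {b₃ = b₃} rows cols total B B₁ B₂ B₃ =
  -- With the first row and the first two columns deleted, what is left is the image of one shift on
  -- rows and of two shifts on columns.
  TwinBases.twin-betti {r = fz} {c₁ = fz} {c₂ = 1F} (λ ()) {k}
    (s≤s rows)
    (≤-trans (≤-reflexive (arith₁ k)) (s≤s (s≤s cols)))
    (≤-reflexive (trans (arith₂ k) (cong suc (trans (cong (3 +_) (sym total)) (arith₃ m′ n′)))))
    (BettiBasis.basis (identity _) (identity _) (λ ()) (λ ()) (λ ()) (λ ()) B)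
    (BettiBasis.basis (shift (identity m′)) (shift (shift (identity n′)))
      (λ { (here refl) → refl ; (there ()) }) (λ { {fz} _ → here refl ; {fs _} () })
      (λ { (here refl) → refl ; (there (here refl)) → refl ; (there (there ())) })
      (λ { {fz} _ → there (here refl) ; {1F} _ → here refl ; {fs (fs _)} () }) B₁)
  , Bases.exact⇒empty m′ (suc n′) (Chessboard.connectivity m′ (suc n′) (suc (suc k)) [] []
      ( ≤-trans (m≤m+n _ 1) (≤-trans (≤-reflexive (arith₄ k)) rows)
      , ≤-trans (m≤m+n _ 2) (≤-trans (≤-reflexive (arith₅ k)) (s≤s cols))
      , ≤-reflexive (trans (arith₆ k) (trans (cong (2 +_) (sym total)) (arith₇ m′ n′)))))
      (BettiBasis.basis (identity _) (identity _) (λ ()) (λ ()) (λ ()) (λ ()) B₂)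
  , third k m′ rows cols total B₃
  where
  arith₁ : ∀ k → suc k + 4 ≡ 2 + (k + 3)
  arith₁ = solve-∀
  arith₂ : ∀ k → suc k + suc k + suc k + 5 ≡ suc (3 + (k + k + k + 4))
  arith₂ = solve-∀
  arith₃ : ∀ m n → 3 + (m + n) ≡ suc m + suc (suc n)
  arith₃ = solve-∀
  arith₄ : ∀ k → suc (suc k) + 0 + 1 ≡ k + 3
  arith₄ = solve-∀
  arith₅ : ∀ k → suc (suc k) + 0 + 2 ≡ suc (k + 3)
  arith₅ = solve-∀
  arith₆ : ∀ k → suc (suc k) + suc (suc k) + suc (suc k) + 0 + 0 ≡ 2 + (k + k + k + 4)
  arith₆ = solve-∀
  arith₇ : ∀ m n → 2 + (m + n) ≡ suc (m + suc n)
  arith₇ = solve-∀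

  third : ∀ k m′ → k + 3 ≤ m′ → k + 3 ≤ n′ → m′ + n′ ≡ k + k + k + 4 → IsBetti (m′ ∸ 2) n′ (k ∸ 1) b₃ → b₃ ≡ 0
  -- At `k = 0` the subtraction `k ∸ 1` would be truncated; the case cannot occur, since `3 + 3`
  -- exceeds `4`.
  third zero m′ rows cols total B₃ = contradiction
    (≤-trans (+-mono-≤ rows cols) (≤-reflexive total)) λ { (s≤s (s≤s (s≤s (s≤s ())))) }
  third (suc k) (suc (suc m″)) (s≤s rows) cols total B₃ =
    Bases.exact⇒empty m″ n′ (Chessboard.connectivity m″ n′ (suc (suc k)) [] []
      ( ≤-pred (≤-trans (≤-reflexive (arith₈ k)) rows)
      , ≤-trans (m≤m+n _ 2) (≤-trans (≤-reflexive (arith₉ k)) cols)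
      , ≤-reflexive (trans (arith₁₀ k) (cong (_∸ 1) (sym total)))))
      (BettiBasis.basis (identity _) (identity _) (λ ()) (λ ()) (λ ()) (λ ()) B₃)
    where
    arith₈ : ∀ k → suc (suc (suc k) + 0) ≡ k + 3
    arith₈ = solve-∀
    arith₉ : ∀ k → suc (suc k) + 0 + 2 ≡ suc k + 3
    arith₉ = solve-∀
    arith₁₀ : ∀ k → suc (suc k) + suc (suc k) + suc (suc k) + 0 + 0 ≡ k + suc k + suc k + 4
    arith₁₀ = solve-∀
  third (suc k) zero          ()           _    _     _
  third (suc k) (suc zero)    (s≤s rows)   _    _     _ = contradiction (≤-trans (m≤n+m 3 k) rows) λ ()

theorem4p10 : (m n d b b₁ b₂ b₃ : ℕ) →
    m ≤ n → n + 5 ≤ 2 * m → (m + n) % 3 ≡ 1 → ¬ (m ≡ 5 × n ≡ 5) → d ≡ ν m n →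
    IsBetti m n d b →
    IsBetti (m ∸ 1) (n ∸ 2) (d ∸ 1) b₁ →
    IsBetti (m ∸ 1) (n ∸ 1) (d ∸ 1) b₂ →
    IsBetti (m ∸ 3) (n ∸ 2) (d ∸ 2) b₃ →
    b ≡ b₁ + (n ∸ 2) * b₂ + 2 * ((m ∸ 1) C 2) * b₃
theorem4p10 m n d b b₁ b₂ b₃ m≤n n+5≤2m mod3 not55 d≡ν = in-region (region m≤n n+5≤2m mod3 not55) d≡ν
  where
  in-region : ∀ {m n d} → Region m n → d ≡ ν m n →
    IsBetti m n d b → IsBetti (m ∸ 1) (n ∸ 2) (d ∸ 1) b₁ → IsBetti (m ∸ 1) (n ∸ 1) (d ∸ 1) b₂ →
    IsBetti (m ∸ 3) (n ∸ 2) (d ∸ 2) b₃ →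
    b ≡ b₁ + (n ∸ 2) * b₂ + 2 * ((m ∸ 1) C 2) * b₃
  in-region (k , m′ , n′ , refl , refl , ν≡ , rows , cols , total) refl = at-degree ν≡
    where
    at-degree : ∀ {d} → d ≡ suc k →
      IsBetti (suc m′) (suc (suc n′)) d b → IsBetti m′ n′ (d ∸ 1) b₁ → IsBetti m′ (suc n′) (d ∸ 1) b₂ →
      IsBetti (m′ ∸ 2) n′ (d ∸ 2) b₃ → b ≡ b₁ + n′ * b₂ + 2 * (m′ C 2) * b₃
    at-degree refl B B₁ B₂ B₃ =
      let b≡ , b₂≡ , b₃≡ = twin-betti-equation k m′ n′ rows cols total B B₁ B₂ B₃ in
      trans b≡ (sym (trans (cong₂ (λ x y → b₁ + n′ * x + 2 * (m′ C 2) * y) b₂≡ b₃≡)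
        (trans (cong₂ (λ x y → b₁ + x + y) (*-zeroʳ n′) (*-zeroʳ (2 * (m′ C 2))))
               (trans (+-identityʳ _) (+-identityʳ b₁)))))
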